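{- $\rho\tau(K_{13}, o(\mathbf{Q}(5,n))) \le 4/15$. That is, for every $\gamma>0$ there is $\delta>0$ such that every $n$-vertex $K_{13}$-free graph $G$ with $\alpha(G)\le \delta\,\mathbf{Q}(5,n)$ satisfies $e(G)\le (4/15+\gamma)n^2$ for all sufficiently large $n$.
   Context: For a graph $H$ and a function $f(n)$, the Ramsey–Turán number $\mathbf{RT}(n,H,f(n))$ is the maximum number of edges in an $n$-vertex $H$-free graph with independence number at most $f(n)$. Let $\overline{\rho\tau}(H,f)=\limsup_{n\to\infty}\mathbf{RT}(n,H,f(n))/n^2$ and $\underline{\rho\tau}(H,f)=\liminf_{n\to\infty}\mathbf{RT}(n,H,f(n))/n^2$; when they coincide, their common value is $\rho\tau(H,f)$. Further $\rho\tau(H,o(f)) := \lim_{\delta\to 0}\rho\tau(H,\delta f)$; an upper bound $\rho\tau(H,o(f))\le c$ means $\lim_{\delta\to0}\overline{\rho\tau}(H,\delta f)\le c$. The inverse Ramsey number $\mathbf{Q}(t,n)$ is the minimum independence number of a $K_t$-free graph on $n$ vertices. -}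

module Defs where

open import Data.Nat using (ℕ; zero; suc; _≤_; _*_)
open import Data.Bool using (Bool; true; false; if_then_else_)
open import Data.Fin using (Fin; toℕ)
open import Data.Fin.Subset using (Subset; _∈_; ∣_∣)
open import Data.List using (List; map; allFin)
open import Data.Nat.ListAction using (sum)
open import Data.Integer using (+_)
open import Data.Rational using (ℚ; _/_)
open import Data.Product using (Σ; _×_; ∃)
open import Function.Definitions using (Injective)
open import Relation.Binary.PropositionalEquality using (_≡_; _≢_)
open import Relation.Nullary using (¬_; does)
import Data.Nat as ℕ

record Graph (n : ℕ) : Set where
  field
    adj   : Fin n → Fin n → Bool
    sym   : ∀ i j → adj i j ≡ adj j i
    irrefl : ∀ i → adj i i ≡ false
open Graph public

edges : ∀ {n} → Graph n → ℕ
edges {n} G =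
  sum (map (λ i → sum (map (λ j →
    if does (toℕ i ℕ.<? toℕ j) then (if adj G i j then 1 else 0) else 0)
    (allFin n))) (allFin n))

Independent : ∀ {n} → Graph n → Subset n → Set
Independent G S = ∀ i j → i ∈ S → j ∈ S → adj G i j ≡ false

IsIndepNumber : ∀ {n} → Graph n → ℕ → Set
IsIndepNumber G a =
  (Σ _ λ S → Independent G S × ∣ S ∣ ≡ a) × (∀ S → Independent G S → ∣ S ∣ ≤ a)

HasClique : ∀ {n} → ℕ → Graph n → Set
HasClique {n} t G =
  Σ (Fin t → Fin n) λ f → Injective _≡_ _≡_ f × (∀ i j → i ≢ j → adj G (f i) (f j) ≡ true)

CliqueFree : ∀ {n} → ℕ → Graph n → Set
CliqueFree t G = ¬ HasClique t G

IsQ : ℕ → ℕ → ℕ → Set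
IsQ t n q =
  (Σ (Graph n) λ H → CliqueFree t H × IsIndepNumber H q)
  × (∀ (H : Graph n) a → CliqueFree t H → IsIndepNumber H a → q ≤ a)

ℕtoℚ : ℕ → ℚ
ℕtoℚ k = (+ k) / 1

{-# OPTIONS --safe #-}
module Submission where

open import Defs hiding (sym)
open import Data.Nat using (ℕ; zero; suc; _+_; _*_; _∸_; _^_; _≤_; _<_; _≥_; z≤n; s≤s; z<s; NonZero; >-nonZero; _≤ᵇ_; _<ᵇ_; _≤?_; _<?_; ⌊_/2⌋; ⌈_/2⌉)
open import Data.Nat.Properties
open import Data.Nat.DivMod using (_/_; _%_; m≡m%n+[m/n]*n; m%n<n)
import Data.Nat.ListAction
open import Data.Nat.Tactic.RingSolver using (solve-∀)
import Data.Integer as ℤ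
import Data.Integer.Properties as ℤ
open import Data.Rational using (ℚ; 0ℚ; mkℚ; toℚᵘ)
import Data.Rational as ℚ
import Data.Rational.Properties as ℚ
open import Data.Rational.Unnormalised using (mkℚᵘ)
import Data.Rational.Unnormalised as ℚᵘ
import Data.Rational.Unnormalised.Properties as ℚᵘ
open import Data.Bool using (Bool; true; false; _∧_; _∨_; not; if_then_else_)
open import Data.Bool.Properties using (∨-comm)
open import Data.Fin using (Fin; toℕ; fromℕ<; inject≤; remQuot; combine; _↑ˡ_; _↑ʳ_) renaming (zero to fzero; suc to fsuc)
open import Data.Fin.Properties using (inject≤-injective; toℕ-injective; combine-remQuot; remQuot-combine)
  renaming (_≟_ to _≟ᶠ_; suc-injective to fsuc-injective)
open import Data.Fin.Subset using (Subset; _∈_; ∣_∣)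
open import Data.Vec using (Vec; []; _∷_; lookup) renaming (tabulate to tabulateᵛ)
open import Data.Vec.Properties using (lookup⇒[]=; []=⇒lookup; lookup∘tabulate)
open import Data.List using (List; []; _∷_; _++_; length; allFin; tabulate; cartesianProduct) renaming (map to mapL)
import Data.List.Properties
open import Data.List.Membership.Propositional using () renaming (_∈_ to _∈ˡ_)
open import Data.List.Membership.Propositional.Properties using (∈-lookup; ∈-map⁺; ∈-++⁺ˡ; ∈-++⁺ʳ)
open import Data.List.Relation.Unary.All using (All; []; _∷_)
import Data.List.Relation.Unary.All as All
import Data.List.Relation.Unary.All.Properties as All
open import Data.List.Relation.Unary.AllPairs using (AllPairs; []; _∷_)
open import Data.List.Relation.Unary.AllPairs.Properties using () renaming (tabulate⁺ to pairs-tabulate⁺)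
open import Data.List.Relation.Unary.Any using (Any; here; there)
open import Data.Product using (Σ; _×_; _,_; proj₁; proj₂)
open import Data.Sum using (_⊎_; inj₁; inj₂)
open import Data.Empty using (⊥; ⊥-elim)
open import Data.Unit using (tt)
open import Function using (_∘_; id)
open import Relation.Binary.Definitions using (tri<; tri≈; tri>)
open import Relation.Binary.PropositionalEquality using (_≡_; _≢_; refl; sym; trans; cong; cong₂; subst; subst₂; module ≡-Reasoning)
open import Relation.Nullary using (yes; no; does)
open import Relation.Nullary.Decidable using (dec-true; dec-false)

-- Every set of linear size contains a K₅, since otherwise disjoint copies of it would give a K₅-free graph
-- of small independence number. The deletion method gives Q(5,n) ≤ n^(2/5+o(1)), so sets of size n^(9/10)
-- contain triangles, and dependent random choice finds in any dense relation U × Ω a triangle in U whose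
-- common neighbourhood has positive density. Hence cn⁴ copies of K₄ yield 3+3+3+5 = 14 > 13 vertices, and
-- a "triangle of dense pairs" with one pair of density above 4/5 yields 3+5+5 = 13. Pass to minimum degree
-- (8/15+ε)m and choose, by density increments instead of the regularity lemma, sets X, Y, Z that are pairwise
-- lower-regular of positive density. On average the densities of a vertex into X, Y, Z sum to more than 8/5,
-- so many vertices either see all three (many K₄), or see one of them with density above 4/5 and a second one
-- with density at least 1/2; both cases give a K₁₃.

-- The final inequality is decidable, so the graph argument is one derivation of `⊥`, and existence
-- claims take the form `(... → ⊥) → ⊥`. Densities are cleared of denominators; `g` with `1/g ≤ γ`
-- measures all surpluses. Dependent random choice returns only about n^(9/10) vertices, a sublinear
-- set in which the comparison with Q(5,n) yields no K₅. Triangles are still available there: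
-- R(3,s+1) ≤ (s+1)², and the squared independence number is at most n^(4/5+o(1)). Hence each
-- construction spends triangles first and takes a K₅ only from sets of linear size. The value 4/5
-- appears because five vertices that each miss less than a fifth of a set have a common
-- neighbourhood of positive density in it. Three densities with sum above 8/5 = 3 · 8/15, one of
-- them negligible, leave two with the same sum, so that one exceeds 4/5; and 8/15 is twice 4/15
-- because degrees count every edge twice. All constants depend on `g` alone and are chosen from the
-- last step backwards, since a pair made regular early must remain regular inside subsets cut out
-- later.

private
  variable
    𝓘 𝓙 : Set

-- Linear arithmetic by certificate: k is the slack, and the identity is left to the ring solver.
lin : ∀ {L R} a b k → L ≤ R → a + R + k ≡ b + L → a ≤ b
lin {L} {R} a b k L≤R eq = +-cancelʳ-≤ L a b (begin
  a + L ≤⟨ +-monoʳ-≤ a L≤R ⟩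
  a + R ≤⟨ m≤m+n (a + R) k ⟩
  a + R + k ≡⟨ eq ⟩
  b + L ∎)
  where open ≤-Reasoning

-- Elementary inequalities and Boolean indicators

1≤m*n : ∀ {m n} → 1 ≤ m → 1 ≤ n → 1 ≤ m * n
1≤m*n p q = *-mono-≤ p q

1≤m^n : ∀ {m} n → 1 ≤ m → 1 ≤ m ^ n
1≤m^n zero p = ≤-refl
1≤m^n (suc n) p = 1≤m*n p (1≤m^n n p)

cancelˡ-≤ : ∀ {a b} k → 1 ≤ k → k * a ≤ k * b → a ≤ b
cancelˡ-≤ (suc k) _ p = *-cancelˡ-≤ (suc k) p

factor-pos : ∀ c x → 0 < c * x → 0 < x
factor-pos c zero p = ⊥-elim (<⇒≱ p (≤-reflexive (*-zeroʳ c)))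
factor-pos c (suc x) p = s≤s z≤n

≤-mulˡ : ∀ {n} m → 1 ≤ n → m ≤ n * m
≤-mulˡ {n} m p = subst (_≤ n * m) (*-identityˡ m) (*-monoˡ-≤ m p)

n<2^n : ∀ n → n < 2 ^ n
n<2^n zero = s≤s z≤n
n<2^n (suc n) = subst (suc (suc n) ≤_) (cong (2 ^ n +_) (sym (+-identityʳ (2 ^ n))))
  (+-mono-≤ (1≤m^n n z<s) (n<2^n n))

𝟙 : Bool → ℕ
𝟙 true = 1
𝟙 false = 0

𝟙≤1 : ∀ b → 𝟙 b ≤ 1
𝟙≤1 true = ≤-refl
𝟙≤1 false = z≤n

𝟙-∧ : ∀ a b → 𝟙 (a ∧ b) ≡ 𝟙 a * 𝟙 b
𝟙-∧ true b = sym (+-identityʳ (𝟙 b))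
𝟙-∧ false b = refl

∧-elimˡ : ∀ {a b} → a ∧ b ≡ true → a ≡ true
∧-elimˡ {true} _ = refl

∧-elimʳ : ∀ {a b} → a ∧ b ≡ true → b ≡ true
∧-elimʳ {true} p = p

∧-intro : ∀ {a b} → a ≡ true → b ≡ true → a ∧ b ≡ true
∧-intro refl refl = refl

≢true⇒≡false : ∀ {b} → (b ≡ true → ⊥) → b ≡ false
≢true⇒≡false {true} p = ⊥-elim (p refl)
≢true⇒≡false {false} p = refl

𝟙*-mono : ∀ b {x y} → (b ≡ true → x ≤ y) → 𝟙 b * x ≤ 𝟙 b * y
𝟙*-mono true p = *-monoʳ-≤ 1 (p refl)
𝟙*-mono false p = z≤n

𝟙-cong-≤ : ∀ {a b} → (a ≡ true → b ≡ true) → 𝟙 a ≤ 𝟙 b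
𝟙-cong-≤ {false} p = z≤n
𝟙-cong-≤ {true} {b} p = subst (λ x → 1 ≤ 𝟙 x) (sym (p refl)) ≤-refl

≤ᵇ-true : ∀ {m n} → m ≤ n → (m ≤ᵇ n) ≡ true
≤ᵇ-true {m} {n} p with m ≤ᵇ n | ≤⇒≤ᵇ p
... | true | _ = refl

≤ᵇ-sound : ∀ m n → (m ≤ᵇ n) ≡ true → m ≤ n
≤ᵇ-sound m n p = ≤ᵇ⇒≤ m n (subst Data.Bool.T (sym p) tt)

≤ᵇ-false : ∀ m n → (m ≤ᵇ n) ≡ false → n < m
≤ᵇ-false m n p = ≰⇒> λ q → case-⊥ (trans (sym p) (≤ᵇ-true q))
  where
  case-⊥ : false ≡ true → ⊥
  case-⊥ ()

-- Finite sums

∑ : List 𝓘 → (𝓘 → ℕ) → ℕ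
∑ [] f = 0
∑ (x ∷ xs) f = f x + ∑ xs f

∑-mono : ∀ (xs : List 𝓘) {f g} → (∀ x → f x ≤ g x) → ∑ xs f ≤ ∑ xs g
∑-mono [] p = z≤n
∑-mono (x ∷ xs) p = +-mono-≤ (p x) (∑-mono xs p)

∑-cong : ∀ (xs : List 𝓘) {f g} → (∀ x → f x ≡ g x) → ∑ xs f ≡ ∑ xs g
∑-cong [] p = refl
∑-cong (x ∷ xs) p = cong₂ _+_ (p x) (∑-cong xs p)

∑-+ : ∀ (xs : List 𝓘) f g → ∑ xs (λ x → f x + g x) ≡ ∑ xs f + ∑ xs g
∑-+ [] f g = refl
∑-+ (x ∷ xs) f g = trans (cong (f x + g x +_) (∑-+ xs f g)) (shuffle (f x) (g x) _ _)
  where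
  shuffle : ∀ a b c d → a + b + (c + d) ≡ a + c + (b + d)
  shuffle = solve-∀

∑-*ˡ : ∀ (xs : List 𝓘) c f → ∑ xs (λ x → c * f x) ≡ c * ∑ xs f
∑-*ˡ [] c f = sym (*-zeroʳ c)
∑-*ˡ (x ∷ xs) c f = trans (cong (c * f x +_) (∑-*ˡ xs c f)) (sym (*-distribˡ-+ c (f x) _))

∑-*ʳ : ∀ (xs : List 𝓘) c f → ∑ xs (λ x → f x * c) ≡ ∑ xs f * c
∑-*ʳ xs c f = trans (∑-cong xs (λ x → *-comm (f x) c)) (trans (∑-*ˡ xs c f) (*-comm c _))

∑-zero : ∀ (xs : List 𝓘) → ∑ xs (λ _ → 0) ≡ 0
∑-zero [] = refl
∑-zero (x ∷ xs) = ∑-zero xs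

∑-const : ∀ (xs : List 𝓘) c → ∑ xs (λ _ → c) ≡ length xs * c
∑-const [] c = refl
∑-const (x ∷ xs) c = cong (c +_) (∑-const xs c)

∑-++ : ∀ (xs ys : List 𝓘) f → ∑ (xs ++ ys) f ≡ ∑ xs f + ∑ ys f
∑-++ [] ys f = refl
∑-++ (x ∷ xs) ys f = trans (cong (f x +_) (∑-++ xs ys f)) (sym (+-assoc (f x) _ _))

∑-map : ∀ (xs : List 𝓘) (h : 𝓘 → 𝓙) f → ∑ (mapL h xs) f ≡ ∑ xs (f ∘ h)
∑-map [] h f = refl
∑-map (x ∷ xs) h f = cong (f (h x) +_) (∑-map xs h f)

∑-swap : ∀ (xs : List 𝓘) (ys : List 𝓙) (f : 𝓘 → 𝓙 → ℕ) →
  ∑ xs (λ x → ∑ ys (f x)) ≡ ∑ ys (λ y → ∑ xs (λ x → f x y))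
∑-swap [] ys f = sym (∑-zero ys)
∑-swap (x ∷ xs) ys f = trans (cong (∑ ys (f x) +_) (∑-swap xs ys f))
  (sym (∑-+ ys (f x) (λ y → ∑ xs (λ x → f x y))))

∑-× : ∀ (xs : List 𝓘) (ys : List 𝓙) f →
  ∑ (cartesianProduct xs ys) f ≡ ∑ xs (λ x → ∑ ys (λ y → f (x , y)))
∑-× [] ys f = refl
∑-× (x ∷ xs) ys f = trans (∑-++ (mapL (x ,_) ys) (cartesianProduct xs ys) f)
  (cong₂ _+_ (∑-map ys (x ,_) f) (∑-× xs ys f))

∑-∑*∑ : ∀ (xs : List 𝓘) (ys : List 𝓙) f g →
  ∑ xs (λ x → ∑ ys (λ y → f x * g y)) ≡ ∑ xs f * ∑ ys g
∑-∑*∑ xs ys f g = trans (∑-cong xs (λ x → ∑-*ˡ ys (f x) g)) (∑-*ʳ xs (∑ ys g) f)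

-- If `f x < g x` everywhere, then `∑wf + ∑w ≤ ∑wg`, against the two hypotheses. In dependent random
-- choice this stands in for drawing `x` at random with weights `w`.
∑-average : ∀ (xs : List 𝓘) (w f g : 𝓘 → ℕ) → 0 < ∑ xs w →
  ∑ xs (λ x → w x * g x) ≤ ∑ xs (λ x → w x * f x) →
  (∀ x → g x ≤ f x → ⊥) → ⊥
∑-average xs w f g pos le none = <⇒≱ pos (+-cancelˡ-≤ _ (∑ xs w) 0 (begin
  ∑ xs (λ x → w x * f x) + ∑ xs w ≡⟨ sym (∑-+ xs _ w) ⟩
  ∑ xs (λ x → w x * f x + w x) ≤⟨ ∑-mono xs pointwise ⟩
  ∑ xs (λ x → w x * g x) ≤⟨ le ⟩
  ∑ xs (λ x → w x * f x) ≡⟨ sym (+-identityʳ _) ⟩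
  ∑ xs (λ x → w x * f x) + 0 ∎))
  where
  open ≤-Reasoning
  pointwise : ∀ x → w x * f x + w x ≤ w x * g x
  pointwise x = begin
    w x * f x + w x ≡⟨ +-comm (w x * f x) (w x) ⟩
    w x + w x * f x ≡⟨ sym (*-suc (w x) (f x)) ⟩
    w x * suc (f x) ≤⟨ *-monoʳ-≤ (w x) (≰⇒> (none x)) ⟩
    w x * g x ∎

∑-tabulate : ∀ {n} (h : Fin n → 𝓘) f → ∑ (tabulate h) f ≡ ∑ (allFin n) (f ∘ h)
∑-tabulate {n = zero} h f = refl
∑-tabulate {n = suc n} h f = cong (f (h fzero) +_)
  (trans (∑-tabulate (h ∘ fsuc) f) (sym (∑-tabulate fsuc (f ∘ h))))

∑-suc : ∀ n (f : Fin (suc n) → ℕ) → ∑ (allFin (suc n)) f ≡ f fzero + ∑ (allFin n) (f ∘ fsuc)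
∑-suc n f = cong (f fzero +_) (∑-tabulate fsuc f)

_==_ : ∀ {n} → Fin n → Fin n → Bool
fzero == fzero = true
fzero == fsuc _ = false
fsuc _ == fzero = false
fsuc i == fsuc j = i == j

==-sound : ∀ {n} (i j : Fin n) → (i == j) ≡ true → i ≡ j
==-sound fzero fzero p = refl
==-sound (fsuc i) (fsuc j) p = cong fsuc (==-sound i j p)

==-refl : ∀ {n} (i : Fin n) → (i == i) ≡ true
==-refl fzero = refl
==-refl (fsuc i) = ==-refl i

∑-pick : ∀ {n} (v : Fin n) (f : Fin n → ℕ) → ∑ (allFin n) (λ u → 𝟙 (u == v) * f u) ≡ f v
∑-pick {suc n} fzero f = trans (∑-suc n (λ u → 𝟙 (u == fzero) * f u))
  (trans (cong (1 * f fzero +_) (∑-zero (allFin n))) (trans (+-identityʳ _) (+-identityʳ _)))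
∑-pick {suc n} (fsuc v) f = trans (∑-suc n (λ u → 𝟙 (u == fsuc v) * f u)) (∑-pick v (f ∘ fsuc))

length-allFin : ∀ n → length (allFin n) ≡ n
length-allFin n = Data.List.Properties.length-tabulate {n = n} id
  where import Data.List.Properties

∑-allFin-const : ∀ n c → ∑ (allFin n) (λ _ → c) ≡ n * c
∑-allFin-const n c = trans (∑-const (allFin n) c) (cong (_* c) (length-allFin n))

term≤∑ : ∀ {n} (v : Fin n) (f : Fin n → ℕ) → f v ≤ ∑ (allFin n) f
term≤∑ {n} v f = subst (_≤ ∑ (allFin n) f) (∑-pick v f)
  (∑-mono (allFin n) λ u → subst (𝟙 (u == v) * f u ≤_) (*-identityˡ (f u)) (*-monoˡ-≤ (f u) (𝟙≤1 (u == v))))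

∑≡0 : ∀ {n} (f : Fin n → ℕ) → ∑ (allFin n) f ≡ 0 → ∀ v → f v ≡ 0
∑≡0 f eq v = n≤0⇒n≡0 (subst (f v ≤_) eq (term≤∑ v f))

-- Vertex sets as Boolean predicates

module _ {n : ℕ} where

  VSet : Set
  VSet = Fin n → Bool

  infix 4 _⊆ˢ_
  _⊆ˢ_ : VSet → VSet → Set
  A ⊆ˢ B = ∀ v → A v ≡ true → B v ≡ true

  infixl 7 _∩ˢ_
  infixl 6 _∖_
  _∩ˢ_ : VSet → VSet → VSet
  (A ∩ˢ B) v = A v ∧ B v

  _∖_ : VSet → VSet → VSet
  (A ∖ B) v = A v ∧ not (B v)

  card : VSet → ℕ
  card A = ∑ (allFin n) (𝟙 ∘ A)

  sumOver : VSet → (Fin n → ℕ) → ℕ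
  sumOver A f = ∑ (allFin n) (λ v → 𝟙 (A v) * f v)

  ⊆-trans : ∀ {A B C} → A ⊆ˢ B → B ⊆ˢ C → A ⊆ˢ C
  ⊆-trans p q v a = q v (p v a)

  card-mono : ∀ {A B} → A ⊆ˢ B → card A ≤ card B
  card-mono p = ∑-mono (allFin n) (λ v → 𝟙-cong-≤ (p v))

  card≤n : ∀ A → card A ≤ n
  card≤n A = subst (card A ≤_) (trans (∑-allFin-const n 1) (*-identityʳ n)) (∑-mono (allFin n) (λ v → 𝟙≤1 (A v)))

  𝟙-∖ : ∀ {A B} → B ⊆ˢ A → ∀ v → 𝟙 (A v) ≡ 𝟙 (B v) + 𝟙 ((A ∖ B) v)
  𝟙-∖ {A} {B} p v with A v | B v | p v
  ... | true | true | _ = refl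
  ... | true | false | _ = refl
  ... | false | false | _ = refl
  ... | false | true | q with q refl
  ... | ()

  card-∖ : ∀ {A B} → B ⊆ˢ A → card A ≡ card B + card (A ∖ B)
  card-∖ p = trans (∑-cong (allFin n) (𝟙-∖ p)) (∑-+ (allFin n) _ _)

  sumOver-∖ : ∀ {A B} f → B ⊆ˢ A → sumOver A f ≡ sumOver B f + sumOver (A ∖ B) f
  sumOver-∖ {A} {B} f p = trans
    (∑-cong (allFin n) λ v → trans (cong (_* f v) (𝟙-∖ p v)) (*-distribʳ-+ (f v) (𝟙 (B v)) _))
    (∑-+ (allFin n) _ _)

  sumOver-mono : ∀ A {f g} → (∀ v → A v ≡ true → f v ≤ g v) → sumOver A f ≤ sumOver A g
  sumOver-mono A p = ∑-mono (allFin n) λ v → 𝟙*-mono (A v) (p v)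

  sumOver-⊆ : ∀ {A B} f → A ⊆ˢ B → sumOver A f ≤ sumOver B f
  sumOver-⊆ f p = ∑-mono (allFin n) λ v → *-monoˡ-≤ (f v) (𝟙-cong-≤ (p v))

  sumOver-const : ∀ A c → sumOver A (λ _ → c) ≡ card A * c
  sumOver-const A c = ∑-*ʳ (allFin n) c (𝟙 ∘ A)

  sumOver-≤ : ∀ A f c → (∀ v → A v ≡ true → f v ≤ c) → sumOver A f ≤ card A * c
  sumOver-≤ A f c p = subst (sumOver A f ≤_) (sumOver-const A c) (sumOver-mono A p)

  sumOver-≥ : ∀ A f c → (∀ v → A v ≡ true → c ≤ f v) → card A * c ≤ sumOver A f
  sumOver-≥ A f c p = subst (_≤ sumOver A f) (sumOver-const A c) (sumOver-mono A p)

  sumOver-*ˡ : ∀ A c f → sumOver A (λ v → c * f v) ≡ c * sumOver A f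
  sumOver-*ˡ A c f = trans (∑-cong (allFin n) λ v → swap (𝟙 (A v)) c (f v)) (∑-*ˡ (allFin n) c _)
    where
    swap : ∀ x y z → x * (y * z) ≡ y * (x * z)
    swap = solve-∀

  sumOver-+ : ∀ A f g → sumOver A (λ v → f v + g v) ≡ sumOver A f + sumOver A g
  sumOver-+ A f g = trans (∑-cong (allFin n) λ v → *-distribˡ-+ (𝟙 (A v)) (f v) (g v)) (∑-+ (allFin n) _ _)

  level : VSet → ℕ → (Fin n → ℕ) → VSet
  level A t f = A ∩ˢ (λ v → t ≤ᵇ f v)

  level-≥ : ∀ {A t f} v → level A t f v ≡ true → t ≤ f v
  level-≥ {t = t} {f} v p = ≤ᵇ-sound t (f v) (∧-elimʳ p)

  -- Members of the level set contribute at most `M` each, all others less than `t`. It serves as a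
  -- lower bound on the level set when the average of `f` exceeds `t`.
  markov : ∀ A f t M → (∀ v → A v ≡ true → f v ≤ M) →
    sumOver A f ≤ card (level A t f) * M + card A * t
  markov A f t M bound = begin
    sumOver A f ≤⟨ ∑-mono (allFin n) pointwise ⟩
    ∑ (allFin n) (λ v → 𝟙 (level A t f v) * M + 𝟙 (A v) * t)
      ≡⟨ ∑-+ (allFin n) _ _ ⟩
    sumOver (level A t f) (λ _ → M) + sumOver A (λ _ → t)
      ≡⟨ cong₂ _+_ (sumOver-const (level A t f) M) (sumOver-const A t) ⟩
    card (level A t f) * M + card A * t ∎
    where
    open ≤-Reasoning
    pointwise : ∀ v → 𝟙 (A v) * f v ≤ 𝟙 (A v ∧ (t ≤ᵇ f v)) * M + 𝟙 (A v) * t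
    pointwise v with A v in eqA | t ≤ᵇ f v in eqt
    ... | false | _ = z≤n
    ... | true | true = ≤-trans (*-monoʳ-≤ 1 (bound v eqA)) (m≤m+n (1 * M) (1 * t))
    ... | true | false = *-monoʳ-≤ 1 (<⇒≤ (≤ᵇ-false t (f v) eqt))

  nonempty : ∀ A → 0 < card A → (∀ v → A v ≡ true → ⊥) → ⊥
  nonempty A pos none = <⇒≱ pos (subst (_≤ 0) refl
    (≤-trans (∑-mono (allFin n) λ v → 𝟙-cong-≤ (λ a → ⊥-elim (none v a))) (≤-reflexive (∑-zero (allFin n)))))

  single : Fin n → VSet
  single v u = u == v

  card-single : ∀ v → card (single v) ≡ 1
  card-single v = trans (∑-cong (allFin n) λ u → sym (*-identityʳ (𝟙 (u == v)))) (∑-pick v (λ _ → 1))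

  single-⊆ : ∀ {A v} → A v ≡ true → single v ⊆ˢ A
  single-⊆ {A} {v} a u p = subst (λ x → A x ≡ true) (sym (==-sound u v p)) a

  truncate : ∀ A k → k ≤ card A → ((B : VSet) → B ⊆ˢ A → card B ≡ k → ⊥) → ⊥
  truncate A k k≤ = go (card A ∸ k) A k≤ (m∸n+n≡m k≤)
    where
    go : ∀ d A → k ≤ card A → d + k ≡ card A → ((B : VSet) → B ⊆ˢ A → card B ≡ k → ⊥) → ⊥
    go zero A _ eq cont = cont A (λ _ a → a) (sym eq)
    go (suc d) A _ eq cont = nonempty A (subst (0 <_) eq z<s) λ v a →
      let eq′ : d + k ≡ card (A ∖ single v)
          eq′ = suc-injective (trans eq (trans (card-∖ (single-⊆ {A} a)) (cong (_+ card (A ∖ single v)) (card-single v))))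
      in go d (A ∖ single v) (subst (k ≤_) eq′ (m≤n+m k d)) eq′ λ B sub → cont B (λ u b → ∧-elimˡ (sub u b))

-- Lower-regular pairs by density increment

Additive : ∀ {n} → (VSet {n} → ℕ) → Set
Additive {n} f = ∀ (A B : VSet {n}) → B ⊆ˢ A → f A ≡ f B + f (A ∖ B)

-- Halving brings an oversized set below two thirds of A; one half inherits f < g.
halve : ∀ {n} (f g : VSet {n} → ℕ) → Additive f → Additive g → ∀ s → 1 ≤ s → ∀ A A′ → A′ ⊆ˢ A →
  3 * s ≤ card A → card A ≤ s * card A′ → f A′ < g A′ →
  (∀ A₁ → A₁ ⊆ˢ A → card A ≤ 3 * s * card A₁ → 3 * card A₁ ≤ 2 * card A → f A₁ < g A₁ → ⊥) → ⊥
halve f g f-add g-add s 1≤s A A′ A′⊆A 3s≤A A≤sA′ f<g cont with 3 * card A′ ≤? 2 * card A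
... | yes small = cont A′ A′⊆A (≤-trans A≤sA′ (*-monoˡ-≤ (card A′) (m≤m+n s _))) small f<g
... | no _ = truncate A′ j (⌊n/2⌋≤n a) step
  where
  a = card A′
  j = ⌊ a /2⌋
  k = ⌈ a /2⌉
  j+k : j + k ≡ a
  j+k = ⌊n/2⌋+⌈n/2⌉≡n a
  j≤k : j ≤ k
  j≤k = ⌊n/2⌋≤⌈n/2⌉ a
  k≤1+j : k ≤ suc j
  k≤1+j = ⌊n/2⌋-mono (n≤1+n (suc a))
  -- The size hypothesis on `A` keeps the smaller half nonempty, so `k ≤ 2j` and each half has at
  -- least a third of `A′`. This is the factor 3 in `3 * s`.
  3≤a : 3 ≤ a
  3≤a = cancelˡ-≤ s 1≤s (≤-trans (≤-reflexive (*-comm s 3)) (≤-trans 3s≤A A≤sA′))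
  1≤j : 1 ≤ j
  1≤j = ⌊n/2⌋-mono {2} (≤-trans (n≤1+n 2) 3≤a)
  k≤2j : k ≤ 2 * j
  k≤2j = ≤-trans k≤1+j (subst (_≤ 2 * j) (+-comm j 1) (+-monoʳ-≤ j (≤-trans 1≤j (≤-reflexive (sym (+-identityʳ j))))))
  a≤3j : a ≤ 3 * j
  a≤3j = subst (_≤ 3 * j) j+k (+-monoʳ-≤ j k≤2j)
  a≤3k : a ≤ 3 * k
  a≤3k = subst (_≤ 3 * k) j+k (+-mono-≤ j≤k (m≤m+n k _))
  dilate : ∀ {x} → a ≤ 3 * x → card A ≤ 3 * s * x
  dilate {x} p = ≤-trans A≤sA′ (≤-trans (*-monoʳ-≤ s p) (≤-reflexive (assoc s x)))
    where
    assoc : ∀ s x → s * (3 * x) ≡ 3 * s * x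
    assoc = solve-∀
  2a≤2A : 2 * a ≤ 2 * card A
  2a≤2A = *-monoʳ-≤ 2 (card-mono A′⊆A)
  3j≤2A : 3 * j ≤ 2 * card A
  3j≤2A = ≤-trans (lin (3 * j) (2 * a) k j≤k (subst (λ x → 3 * j + k + k ≡ 2 * x + j) j+k (eq j k))) 2a≤2A
    where
    eq : ∀ j k → 3 * j + k + k ≡ 2 * (j + k) + j
    eq = solve-∀
  3k≤2A : 3 * k ≤ 2 * card A
  3k≤2A = ≤-trans (lin (3 * k) (2 * a) 0 k≤2j (subst (λ x → 3 * k + 2 * j + 0 ≡ 2 * x + k) j+k (eq j k))) 2a≤2A
    where
    eq : ∀ j k → 3 * k + 2 * j + 0 ≡ 2 * (j + k) + k
    eq = solve-∀
  step : ∀ B → B ⊆ˢ A′ → card B ≡ j → ⊥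
  step B B⊆A′ |B| with f B <? g B
  ... | yes lt = cont B (⊆-trans B⊆A′ A′⊆A) (subst (λ x → card A ≤ 3 * s * x) (sym |B|) (dilate a≤3j))
                   (subst (λ x → 3 * x ≤ 2 * card A) (sym |B|) 3j≤2A) lt
  ... | no ¬lt = cont (A′ ∖ B) (λ v p → A′⊆A v (∧-elimˡ p)) (subst (λ x → card A ≤ 3 * s * x) (sym |A′∖B|) (dilate a≤3k))
                   (subst (λ x → 3 * x ≤ 2 * card A) (sym |A′∖B|) 3k≤2A)
                   (+-cancelˡ-< (f B) _ _ (begin-strict
                     f B + f (A′ ∖ B) ≡⟨ sym (f-add A′ B B⊆A′) ⟩
                     f A′ <⟨ f<g ⟩
                     g A′ ≡⟨ g-add A′ B B⊆A′ ⟩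
                     g B + g (A′ ∖ B) ≤⟨ +-monoˡ-≤ _ (≮⇒≥ ¬lt) ⟩
                     f B + g (A′ ∖ B) ∎))
    where
    open ≤-Reasoning
    |A′∖B| : card (A′ ∖ B) ≡ k
    |A′∖B| = +-cancelˡ-≡ j _ _ (trans (cong (_+ card (A′ ∖ B)) (sym |B|)) (trans (sym (card-∖ B⊆A′)) (sym j+k)))

-- Three rectangles tile the pair; if the two outer ones have density below (P+1)/Q, the remaining
-- corner cannot lose h = σ² units of density.
no-increment : ∀ P Q σ a₁ a₂ b₁ b₂ x y z →
  P * ((a₁ + a₂) * (b₁ + b₂)) ≤ Q * (x + (y + z)) →
  a₁ + a₂ ≤ σ * a₁ → b₁ + b₂ ≤ σ * b₁ →
  Q * x + σ * σ * (a₁ * b₁) < P * (a₁ * b₁) →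
  Q * y < suc P * (a₁ * b₂) → Q * z < suc P * (a₂ * (b₁ + b₂)) → ⊥
no-increment P Q σ a₁ a₂ b₁ b₂ x y z dense ra rb fx fy fz = <⇒≱ (s≤s (≤-trans (m≤m+n _ _) (m≤n+m _ 2)))
  -- The multiples of `P` cancel and leave `σ²a₁b₁ + a₁b₁ + 3 ≤ ab` for the whole sides `a`, `b`,
  -- although `ab ≤ σ²a₁b₁`. This is why the loss is `σ²`.
  (lin (3 + σ * σ * (a₁ * b₁) + (a₁ * b₁)) (σ * σ * (a₁ * b₁)) 0
    (+-mono-≤ (+-mono-≤ dense (+-mono-≤ fx (+-mono-≤ fy fz))) (*-mono-≤ ra rb))
    (eq P Q σ a₁ a₂ b₁ b₂ x y z))
  where
  eq : ∀ P Q σ a₁ a₂ b₁ b₂ x y z →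
    3 + σ * σ * (a₁ * b₁) + a₁ * b₁ + (Q * (x + (y + z)) + (P * (a₁ * b₁) + ((1 + P) * (a₁ * b₂) + (1 + P) * (a₂ * (b₁ + b₂)))) + (σ * a₁) * (σ * b₁)) + 0
    ≡ σ * σ * (a₁ * b₁) + (P * ((a₁ + a₂) * (b₁ + b₂)) + ((1 + (Q * x + σ * σ * (a₁ * b₁))) + ((1 + Q * y) + (1 + Q * z))) + (a₁ + a₂) * (b₁ + b₂))
  eq = solve-∀

-- Each density increment keeps at least a `1/(3s)` share of both sides, and `fuel` bounds the
-- number of increments.
shrink : ℕ → ℕ → ℕ
shrink s fuel = (3 * s) ^ fuel

module Pairs {n : ℕ} (adj : Fin n → Fin n → Bool) (adj-sym : ∀ u v → adj u v ≡ adj v u) where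

  N : VSet → Fin n → ℕ
  N B v = sumOver B (λ u → 𝟙 (adj v u))

  e : VSet → VSet → ℕ
  e A B = sumOver A (N B)

  N-card : ∀ B v → N B v ≡ card (B ∩ˢ adj v)
  N-card B v = ∑-cong (allFin n) λ u → sym (𝟙-∧ (B u) (adj v u))

  N≤card : ∀ B v → N B v ≤ card B
  N≤card B v = subst (_≤ card B) (sym (N-card B v)) (card-mono {A = B ∩ˢ adj v} (λ u → ∧-elimˡ))

  e≤ : ∀ A B → e A B ≤ card A * card B
  e≤ A B = sumOver-≤ A (N B) (card B) (λ v _ → N≤card B v)

  e-sym : ∀ A B → e A B ≡ e B A
  e-sym A B = begin
    ∑ (allFin n) (λ v → 𝟙 (A v) * ∑ (allFin n) (λ u → 𝟙 (B u) * 𝟙 (adj v u)))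
      ≡⟨ ∑-cong (allFin n) (λ v → sym (∑-*ˡ (allFin n) (𝟙 (A v)) _)) ⟩
    ∑ (allFin n) (λ v → ∑ (allFin n) (λ u → 𝟙 (A v) * (𝟙 (B u) * 𝟙 (adj v u))))
      ≡⟨ ∑-swap (allFin n) (allFin n) _ ⟩
    ∑ (allFin n) (λ u → ∑ (allFin n) (λ v → 𝟙 (A v) * (𝟙 (B u) * 𝟙 (adj v u))))
      ≡⟨ ∑-cong (allFin n) (λ u → trans (∑-cong (allFin n) (λ v →
           trans (cong (λ b → 𝟙 (A v) * (𝟙 (B u) * 𝟙 b)) (adj-sym v u)) (swap (𝟙 (A v)) (𝟙 (B u)) _)))
           (∑-*ˡ (allFin n) (𝟙 (B u)) _)) ⟩
    ∑ (allFin n) (λ u → 𝟙 (B u) * ∑ (allFin n) (λ v → 𝟙 (A v) * 𝟙 (adj u v))) ∎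
    where
    open ≡-Reasoning
    swap : ∀ x y z → x * (y * z) ≡ y * (x * z)
    swap = solve-∀

  e-∖ˡ : ∀ B → Additive {n} (λ A → e A B)
  e-∖ˡ B A A₁ p = sumOver-∖ (N B) p

  e-∖ʳ : ∀ A → Additive (e A)
  e-∖ʳ A B B₁ p = trans (e-sym A B) (trans (e-∖ˡ A B B₁ p) (cong₂ _+_ (e-sym B₁ A) (e-sym (B ∖ B₁) A)))

  e-⊆ : ∀ {A A′ B B′} → A′ ⊆ˢ A → B′ ⊆ˢ B → e A′ B′ ≤ e A B
  e-⊆ {A} {A′} {B} {B′} p q = ≤-trans (sumOver-⊆ (N B′) p) (sumOver-mono A (λ v _ → sumOver-⊆ _ q))

  -- One-sided regularity: subsets with at least a `1/s` share have density at least `(P - h)/Q`.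
  -- Cliques are built from lower bounds on densities only.
  Reg : (P Q s h : ℕ) → VSet → VSet → Set
  Reg P Q s h A B = ∀ A′ B′ → A′ ⊆ˢ A → B′ ⊆ˢ B →
    card A ≤ s * card A′ → card B ≤ s * card B′ →
    P * (card A′ * card B′) ≤ Q * e A′ B′ + h * (card A′ * card B′)

  private
    linear : ∀ c {B : VSet {n}} → Additive {n} (λ A → c * (card A * card B))
    linear c {B} A A₁ p = trans (cong (λ x → c * (x * card B)) (card-∖ p)) (eq c (card A₁) (card (A ∖ A₁)) (card B))
      where
      eq : ∀ c x y b → c * ((x + y) * b) ≡ c * (x * b) + c * (y * b)
      eq = solve-∀

    defect : ∀ Q h {B} → Additive {n} (λ A → Q * e A B + h * (card A * card B))
    defect Q h {B} A A₁ p = trans (cong₂ _+_ (cong (Q *_) (e-∖ˡ B A A₁ p)) (linear h {B} A A₁ p))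
      (eq Q (e A₁ B) (e (A ∖ A₁) B) _ _)
      where
      eq : ∀ Q x y u v → Q * (x + y) + (u + v) ≡ Q * x + u + (Q * y + v)
      eq = solve-∀

  -- Density increment: as long as some large sub-pair is too sparse, an adjacent one is denser by 1/Q.
  regularise : ∀ s P₀ Q → 1 ≤ s → ∀ fuel P → P₀ ≤ P → Q < P + fuel → ∀ A B →
    3 * s * shrink s fuel ≤ card A → 3 * s * shrink s fuel ≤ card B →
    P * (card A * card B) ≤ Q * e A B →
    (∀ A₁ B₁ → A₁ ⊆ˢ A → B₁ ⊆ˢ B →
      card A ≤ shrink s fuel * card A₁ → card B ≤ shrink s fuel * card B₁ →
      P₀ * (card A₁ * card B₁) ≤ Q * e A₁ B₁ →
      Reg P₀ Q s (3 * s * (3 * s)) A₁ B₁ → ⊥) → ⊥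
  regularise s P₀ Q 1≤s zero P P₀≤P Q<P A B bigA bigB dense cont =
    <⇒≱ (*-monoˡ-< (card A * card B) {{>-nonZero pos}} (subst (Q <_) (+-identityʳ P) Q<P))
      (≤-trans dense (*-monoʳ-≤ Q (e≤ A B)))
    where
    1≤size : ∀ {x} → 3 * s * 1 ≤ x → 1 ≤ x
    1≤size p = ≤-trans (1≤m*n (1≤m*n {3} z<s 1≤s) z<s) p
    pos : 0 < card A * card B
    pos = 1≤m*n (1≤size bigA) (1≤size bigB)
  regularise s P₀ Q 1≤s (suc fuel) P P₀≤P Q<P A B bigA bigB dense cont =
    -- The pair itself is offered to `cont`. If its regularity fails on some sub-pair, `regular`
    -- recurses on a denser pair, and `cont` is called there instead.
    cont A B (λ _ a → a) (λ _ b → b) (≤-mulˡ _ 1≤shrink) (≤-mulˡ _ 1≤shrink)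
      (≤-trans (*-monoˡ-≤ _ P₀≤P) dense) regular
    where
    σ = 3 * s
    h = σ * σ
    1≤σ : 1 ≤ σ
    1≤σ = 1≤m*n {3} z<s 1≤s
    1≤shrink : 1 ≤ σ ^ suc fuel
    1≤shrink = 1≤m^n (suc fuel) 1≤σ
    3s≤ : ∀ {x} → σ * σ ^ suc fuel ≤ x → σ ≤ x
    3s≤ {x} p = ≤-trans (subst (_≤ σ * σ ^ suc fuel) (*-identityʳ σ) (*-monoʳ-≤ σ 1≤shrink)) p
    shrunk : ∀ {x y} → σ * σ ^ suc fuel ≤ x → x ≤ σ * y → σ * σ ^ fuel ≤ y
    shrunk p q = cancelˡ-≤ σ 1≤σ (≤-trans p q)
    descend : ∀ A′ B′ → A′ ⊆ˢ A → B′ ⊆ˢ B → card A ≤ σ * card A′ → card B ≤ σ * card B′ →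
      suc P * (card A′ * card B′) ≤ Q * e A′ B′ → ⊥
    descend A′ B′ pA pB rA rB dense′ =
      regularise s P₀ Q 1≤s fuel (suc P) (≤-trans P₀≤P (n≤1+n P)) (subst (Q <_) (+-suc P fuel) Q<P) A′ B′
        (shrunk bigA rA) (shrunk bigB rB) dense′
        λ A₁ B₁ qA qB tA tB → cont A₁ B₁ (⊆-trans qA pA) (⊆-trans qB pB) (compose rA tA) (compose rB tB)
      where
      compose : ∀ {x y z} → x ≤ σ * y → y ≤ σ ^ fuel * z → x ≤ σ ^ suc fuel * z
      compose {y = y} {z} p q = ≤-trans p (subst (σ * y ≤_) (sym (*-assoc σ (σ ^ fuel) z)) (*-monoʳ-≤ σ q))
    rest : ∀ x y z → x ≡ y + z → 3 * y ≤ 2 * x → x ≤ σ * z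
    rest x y z refl p = ≤-trans (lin (y + z) (3 * z) 0 p (eq y z)) (*-monoˡ-≤ z (subst (_≤ σ) (*-identityʳ 3) (*-monoʳ-≤ 3 1≤s)))
      where
      eq : ∀ y z → y + z + 2 * (y + z) + 0 ≡ 3 * z + 3 * y
      eq = solve-∀
    corner : ∀ A₁ B₁ → A₁ ⊆ˢ A → B₁ ⊆ˢ B → card A ≤ σ * card A₁ → card B ≤ σ * card B₁ →
      3 * card A₁ ≤ 2 * card A → 3 * card B₁ ≤ 2 * card B →
      Q * e A₁ B₁ + h * (card A₁ * card B₁) < P * (card A₁ * card B₁) → ⊥
    corner A₁ B₁ pA pB rA rB tA tB sparse
      with suc P * (card A₁ * card (B ∖ B₁)) ≤? Q * e A₁ (B ∖ B₁)
         | suc P * (card (A ∖ A₁) * card B) ≤? Q * e (A ∖ A₁) B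
    ... | yes d | _ = descend A₁ (B ∖ B₁) pA (λ v → ∧-elimˡ) rA (rest _ _ _ (card-∖ pB) tB) d
    ... | no _ | yes d = descend (A ∖ A₁) B (λ v → ∧-elimˡ) (λ _ b → b) (rest _ _ _ (card-∖ pA) tA)
                           (≤-mulˡ _ 1≤σ) d
    ... | no ¬d | no ¬d′ = no-increment P Q σ (card A₁) (card (A ∖ A₁)) (card B₁) (card (B ∖ B₁))
        (e A₁ B₁) (e A₁ (B ∖ B₁)) (e (A ∖ A₁) B)
        (subst (P * ((card A₁ + card (A ∖ A₁)) * (card B₁ + card (B ∖ B₁))) ≤_)
          (cong (Q *_) (trans (e-∖ˡ B A A₁ pA) (trans (cong (_+ e (A ∖ A₁) B) (e-∖ʳ A₁ B B₁ pB)) (+-assoc (e A₁ B₁) _ _))))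
          (subst (_≤ Q * e A B) (cong (P *_) (cong₂ _*_ (card-∖ pA) (card-∖ pB))) dense))
        (subst (_≤ σ * card A₁) (card-∖ pA) rA) (subst (_≤ σ * card B₁) (card-∖ pB) rB)
        sparse (≰⇒> ¬d)
        (subst (Q * e (A ∖ A₁) B <_) (cong (λ x → suc P * (card (A ∖ A₁) * x)) (card-∖ pB)) (≰⇒> ¬d′))
    regular : Reg P₀ Q s h A B
    regular A′ B′ pA pB rA rB with P * (card A′ * card B′) ≤? Q * e A′ B′ + h * (card A′ * card B′)
    ... | yes p = ≤-trans (*-monoˡ-≤ _ P₀≤P) p
    -- The sparse sub-pair is trimmed on each side in turn to at most two thirds of `A` and `B`, so
    -- that the complements used in `corner` are still large.
    ... | no ¬p = ⊥-elim (halve _ _ (defect Q h {B′}) (linear P {B′}) s 1≤s A A′ pA (3s≤ bigA) rA (≰⇒> ¬p)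
        λ A₁ qA uA tA sparse → halve (λ X → Q * e A₁ X + h * (card A₁ * card X)) (λ X → P * (card A₁ * card X))
          (flip-add (λ X Y → Q * e X Y + h * (card X * card Y)) (λ X Y → cong₂ _+_ (cong (Q *_) (e-sym X Y)) (cong (h *_) (*-comm (card X) (card Y)))) (defect Q h {A₁}))
          (flip-add (λ X Y → P * (card X * card Y)) (λ X Y → cong (P *_) (*-comm (card X) (card Y))) (linear P {A₁}))
          s 1≤s B B′ pB (3s≤ bigB) rB sparse
          λ B₁ qB uB tB → corner A₁ B₁ qA qB uA uB tA tB)
      where
      flip-add : ∀ (φ : VSet → VSet → ℕ) → (∀ X Y → φ X Y ≡ φ Y X) → ∀ {A₁} → Additive {n} (λ X → φ X A₁) → Additive (φ A₁)
      flip-add φ φ-sym {A₁} add X Y p = trans (φ-sym A₁ X) (trans (add X Y p) (cong₂ _+_ (φ-sym Y A₁) (φ-sym (X ∖ Y) A₁)))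

-- Triangles in large sets, and dependent random choice

card≤∖+∩ : ∀ {n} (A B : VSet {n}) → card A ≤ card (A ∖ B) + card (A ∩ˢ B)
card≤∖+∩ {n} A B = ≤-trans (∑-mono (allFin n) λ v → pointwise (A v) (B v)) (≤-reflexive (∑-+ (allFin n) _ _))
  where
  pointwise : ∀ a b → 𝟙 a ≤ 𝟙 (a ∧ not b) + 𝟙 (a ∧ b)
  pointwise false b = z≤n
  pointwise true true = ≤-refl
  pointwise true false = ≤-refl

module Ramsey {n : ℕ} (adj : Fin n → Fin n → Bool) (adj-sym : ∀ u v → adj u v ≡ adj v u)
  (adj-irrefl : ∀ v → adj v v ≡ false) where

  Indep : VSet → Set
  Indep S = ∀ u v → S u ≡ true → S v ≡ true → adj u v ≡ false

  TriangleFree : VSet → Set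
  TriangleFree U = ∀ x y z → U x ≡ true → U y ≡ true → U z ≡ true →
    adj x y ≡ true → adj x z ≡ true → adj y z ≡ true → ⊥

  module _ (s : ℕ) (α≤s : ∀ S → Indep S → card S ≤ s) where

    -- Without triangles the neighbours of `v` in `U` form an independent set, so picking `v` and
    -- discarding its neighbourhood costs at most `s + 1` vertices.
    greedy : ∀ j U → TriangleFree U → j * suc s ≤ card U →
      (∀ I → I ⊆ˢ U → Indep I → j ≤ card I → ⊥) → ⊥
    greedy zero U tf le cont = cont (λ _ → false) (λ _ ()) (λ _ _ ()) z≤n
    greedy (suc j) U tf le cont = nonempty U (≤-trans z<s le) step
      where
      step : ∀ v → U v ≡ true → ⊥
      step v v∈U = greedy j U₂ (λ x y z p q r → tf x y z (U₂⊆U x p) (U₂⊆U y q) (U₂⊆U z r))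
        (+-cancelˡ-≤ (suc s) _ _ big) extend
        where
        U₁ = U ∖ single v
        U₂ = U₁ ∖ adj v
        U₂⊆U : U₂ ⊆ˢ U
        U₂⊆U u p = ∧-elimˡ (∧-elimˡ p)
        nbrs-indep : Indep (U₁ ∩ˢ adj v)
        nbrs-indep x y p q = ≢true⇒≡false λ xy →
          tf v x y v∈U (∧-elimˡ (∧-elimˡ p)) (∧-elimˡ (∧-elimˡ q)) (∧-elimʳ {U₁ x} p) (∧-elimʳ {U₁ y} q) xy
        big : suc s + j * suc s ≤ suc s + card U₂
        big = begin
          suc s + j * suc s ≤⟨ le ⟩
          card U ≡⟨ card-∖ (single-⊆ {A = U} v∈U) ⟩
          card (single v) + card U₁ ≡⟨ cong (_+ card U₁) (card-single v) ⟩
          1 + card U₁ ≤⟨ s≤s (card≤∖+∩ U₁ (adj v)) ⟩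
          1 + (card U₂ + card (U₁ ∩ˢ adj v)) ≤⟨ s≤s (+-monoʳ-≤ (card U₂) (α≤s _ nbrs-indep)) ⟩
          1 + (card U₂ + s) ≡⟨ cong suc (+-comm (card U₂) s) ⟩
          suc s + card U₂ ∎
          where open ≤-Reasoning
        extend : ∀ I → I ⊆ˢ U₂ → Indep I → j ≤ card I → ⊥
        extend I I⊆ ind j≤ = cont I⁺ I⁺⊆ I⁺-indep (begin
          1 + j ≡⟨ +-comm 1 j ⟩
          j + 1 ≤⟨ +-mono-≤ j≤ (≤-reflexive (sym (card-single v))) ⟩
          card I + card (single v) ≡⟨ sym (∑-+ (allFin n) _ _) ⟩
          ∑ (allFin n) (λ u → 𝟙 (I u) + 𝟙 (u == v)) ≤⟨ ∑-mono (allFin n) pointwise ⟩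
          card I⁺ ∎)
          where
          open ≤-Reasoning
          I⁺ : VSet
          I⁺ u = I u ∨ (u == v)
          v∉I : I v ≡ true → ⊥
          v∉I p with ∧-elimʳ {U v} (∧-elimˡ (I⊆ v p))
          ... | q rewrite ==-refl v with q
          ... | ()
          pointwise : ∀ u → 𝟙 (I u) + 𝟙 (u == v) ≤ 𝟙 (I⁺ u)
          pointwise u with I u in eqI | u == v in eqv
          ... | false | b = ≤-refl
          ... | true | false = ≤-refl
          ... | true | true = ⊥-elim (v∉I (subst (λ x → I x ≡ true) (==-sound u v eqv) eqI))
          cases : ∀ u → I⁺ u ≡ true → (I u ≡ true) ⊎ (u ≡ v)
          cases u p with I u | u == v in eqv
          ... | true | _ = inj₁ refl
          ... | false | true = inj₂ (==-sound u v eqv)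
          I⁺⊆ : I⁺ ⊆ˢ U
          I⁺⊆ u p with cases u p
          ... | inj₁ q = U₂⊆U u (I⊆ u q)
          ... | inj₂ refl = v∈U
          far : ∀ u → I u ≡ true → adj v u ≡ false
          far u p with adj v u | ∧-elimʳ {U₁ u} (I⊆ u p)
          ... | false | _ = refl
          I⁺-indep : Indep I⁺
          I⁺-indep x y p q with cases x p | cases y q
          ... | inj₁ a | inj₁ b = ind x y a b
          ... | inj₁ a | inj₂ refl = trans (adj-sym x v) (far x a)
          ... | inj₂ refl | inj₁ b = far y b
          ... | inj₂ refl | inj₂ refl = adj-irrefl v

    triangle-exists : ∀ U → suc s * suc s ≤ card U → TriangleFree U → ⊥
    triangle-exists U le tf = greedy (suc s) U tf le λ I _ ind big → <⇒≱ big (α≤s I ind)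

-- Dependent random choice, derandomised: points of Ω are fixed one at a time, keeping large a set U
-- of vertices related to all of them, while the triples with small common neighbourhood die out.
module DRC {n : ℕ} {Ω : Set} (ωs : List Ω) (w : Ω → ℕ) (F : Fin n → Ω → Bool) where

  W : ℕ
  W = ∑ ωs w

  deg : Fin n → ℕ
  deg v = ∑ ωs (λ ω → w ω * 𝟙 (F v ω))

  Triple : Set
  Triple = Fin n × (Fin n × Fin n)

  codeg : Triple → ℕ
  codeg (x , y , z) = ∑ ωs (λ ω → w ω * (𝟙 (F x ω) * (𝟙 (F y ω) * 𝟙 (F z ω))))

  pairs : List (Fin n × Fin n)
  pairs = cartesianProduct (allFin n) (allFin n)

  triples : List Triple
  triples = cartesianProduct (allFin n) pairs

  inside : VSet → Triple → ℕ
  inside U (x , y , z) = 𝟙 (U x) * (𝟙 (U y) * 𝟙 (U z))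

  inside≤1 : ∀ U τ → inside U τ ≤ 1
  inside≤1 U (x , y , z) = *-mono-≤ (𝟙≤1 (U x)) (*-mono-≤ (𝟙≤1 (U y)) (𝟙≤1 (U z)))

  deg≤W : ∀ v → deg v ≤ W
  deg≤W v = ∑-mono ωs λ ω → ≤-trans (*-monoʳ-≤ (w ω) (𝟙≤1 (F v ω))) (≤-reflexive (*-identityʳ (w ω)))

  module _ (bad : Triple → Bool) where

    #bad : VSet → ℕ
    #bad U = ∑ triples (λ τ → 𝟙 (bad τ) * inside U τ)

    restrict : VSet → Ω → VSet
    restrict U ω = U ∩ˢ (λ v → F v ω)

    ∑-card-restrict : ∀ U → ∑ ωs (λ ω → w ω * card (restrict U ω)) ≡ sumOver U deg
    ∑-card-restrict U = begin
      ∑ ωs (λ ω → w ω * card (restrict U ω))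
        ≡⟨ ∑-cong ωs (λ ω → sym (∑-*ˡ (allFin n) (w ω) _)) ⟩
      ∑ ωs (λ ω → ∑ (allFin n) (λ v → w ω * 𝟙 (U v ∧ F v ω)))
        ≡⟨ ∑-swap ωs (allFin n) _ ⟩
      ∑ (allFin n) (λ v → ∑ ωs (λ ω → w ω * 𝟙 (U v ∧ F v ω)))
        ≡⟨ ∑-cong (allFin n) (λ v → trans (∑-cong ωs (λ ω →
             trans (cong (w ω *_) (𝟙-∧ (U v) (F v ω))) (swap (w ω) (𝟙 (U v)) _))) (∑-*ˡ ωs (𝟙 (U v)) _)) ⟩
      sumOver U deg ∎
      where
      open ≡-Reasoning
      swap : ∀ x y z → x * (y * z) ≡ y * (x * z)
      swap = solve-∀

    ∑-#bad-restrict : ∀ U → ∑ ωs (λ ω → w ω * #bad (restrict U ω)) ≡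
      ∑ triples (λ τ → 𝟙 (bad τ) * inside U τ * codeg τ)
    ∑-#bad-restrict U = begin
      ∑ ωs (λ ω → w ω * #bad (restrict U ω))
        ≡⟨ ∑-cong ωs (λ ω → sym (∑-*ˡ triples (w ω) _)) ⟩
      ∑ ωs (λ ω → ∑ triples (λ τ → w ω * (𝟙 (bad τ) * inside (restrict U ω) τ)))
        ≡⟨ ∑-swap ωs triples _ ⟩
      ∑ triples (λ τ → ∑ ωs (λ ω → w ω * (𝟙 (bad τ) * inside (restrict U ω) τ)))
        ≡⟨ ∑-cong triples (λ { (x , y , z) → trans (∑-cong ωs (λ ω → split x y z ω))
             (∑-*ˡ ωs (𝟙 (bad (x , y , z)) * inside U (x , y , z)) _) }) ⟩
      ∑ triples (λ τ → 𝟙 (bad τ) * inside U τ * codeg τ) ∎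
      where
      open ≡-Reasoning
      shuffle : ∀ w b u f u′ f′ u″ f″ → w * (b * (u * f * (u′ * f′ * (u″ * f″)))) ≡
        b * (u * (u′ * u″)) * (w * (f * (f′ * f″)))
      shuffle = solve-∀
      split : ∀ x y z ω → w ω * (𝟙 (bad (x , y , z)) * inside (restrict U ω) (x , y , z)) ≡
        𝟙 (bad (x , y , z)) * inside U (x , y , z) * (w ω * (𝟙 (F x ω) * (𝟙 (F y ω) * 𝟙 (F z ω))))
      split x y z ω rewrite 𝟙-∧ (U x) (F x ω) | 𝟙-∧ (U y) (F y ω) | 𝟙-∧ (U z) (F z ω) =
        shuffle (w ω) (𝟙 (bad (x , y , z))) (𝟙 (U x)) _ (𝟙 (U y)) _ (𝟙 (U z)) _

    -- A weighted random `ω` keeps on average at least a `1/C` share of `U` and at most a `1/C′`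
    -- share of its bad triples. The potential is `card U / C^j - #bad U / C′^j ≥ ℓ` multiplied by
    -- `(C C′)^j`; averaging preserves it in every round.
    select : ∀ C C′ ℓ → 1 ≤ C → 1 ≤ C′ → 0 < W → (∀ τ → bad τ ≡ true → C′ * codeg τ ≤ W) →
      ∀ j U → (∀ v → U v ≡ true → W ≤ C * deg v) →
      C ^ j * #bad U + ℓ * (C * C′) ^ j ≤ C′ ^ j * card U →
      (∀ U′ → U′ ⊆ˢ U → #bad U′ + ℓ ≤ card U′ → ⊥) → ⊥
    select C C′ ℓ 1≤C 1≤C′ 0<W few zero U rich pot cont =
      cont U (λ _ u → u) (subst (_≤ card U) (cong₂ _+_ (+-identityʳ _) (*-identityʳ ℓ)) (≤-trans pot (≤-reflexive (+-identityʳ _))))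
    select C C′ ℓ 1≤C 1≤C′ 0<W few (suc j) U rich pot cont =
      ∑-average ωs w (λ ω → C′ ^ j * card (restrict U ω)) (λ ω → C ^ j * #bad (restrict U ω) + ℓ * (C * C′) ^ j)
        0<W (cancelˡ-≤ (C * C′) (1≤m*n 1≤C 1≤C′) scaled)
        λ ω le → select C C′ ℓ 1≤C 1≤C′ 0<W few j (restrict U ω) (λ v p → rich v (∧-elimˡ p)) le
          λ U′ sub → cont U′ (λ v p → ∧-elimˡ (sub v p))
      where
      open ≤-Reasoning
      S = ∑ triples (λ τ → 𝟙 (bad τ) * inside U τ * codeg τ)
      sumG : ∑ ωs (λ ω → w ω * (C ^ j * #bad (restrict U ω) + ℓ * (C * C′) ^ j)) ≡ C ^ j * S + ℓ * (C * C′) ^ j * W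
      sumG = trans (∑-cong ωs (λ ω → eq (w ω) (C ^ j) (#bad (restrict U ω)) (ℓ * (C * C′) ^ j)))
        (trans (∑-+ ωs _ _) (cong₂ _+_ (trans (∑-*ˡ ωs (C ^ j) _) (cong (C ^ j *_) (∑-#bad-restrict U)))
          (∑-*ˡ ωs (ℓ * (C * C′) ^ j) w)))
        where
        eq : ∀ w c b l → w * (c * b + l) ≡ c * (w * b) + l * w
        eq = solve-∀
      sumF : ∑ ωs (λ ω → w ω * (C′ ^ j * card (restrict U ω))) ≡ C′ ^ j * sumOver U deg
      sumF = trans (∑-cong ωs (λ ω → eq (w ω) (C′ ^ j) (card (restrict U ω))))
        (trans (∑-*ˡ ωs (C′ ^ j) _) (cong (C′ ^ j *_) (∑-card-restrict U)))
        where
        eq : ∀ w c b → w * (c * b) ≡ c * (w * b)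
        eq = solve-∀
      badness : C′ * S ≤ W * #bad U
      badness = begin
        C′ * S ≡⟨ sym (∑-*ˡ triples C′ _) ⟩
        ∑ triples (λ τ → C′ * (𝟙 (bad τ) * inside U τ * codeg τ)) ≤⟨ ∑-mono triples pointwise ⟩
        ∑ triples (λ τ → W * (𝟙 (bad τ) * inside U τ)) ≡⟨ ∑-*ˡ triples W _ ⟩
        W * #bad U ∎
        where
        eq₁ : ∀ c b i d → c * (b * i * d) ≡ b * (i * (c * d))
        eq₁ = solve-∀
        eq₂ : ∀ w b i → b * (i * w) ≡ w * (b * i)
        eq₂ = solve-∀
        pointwise : ∀ τ → C′ * (𝟙 (bad τ) * inside U τ * codeg τ) ≤ W * (𝟙 (bad τ) * inside U τ)
        pointwise τ = begin
          C′ * (𝟙 (bad τ) * inside U τ * codeg τ) ≡⟨ eq₁ C′ (𝟙 (bad τ)) (inside U τ) (codeg τ) ⟩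
          𝟙 (bad τ) * (inside U τ * (C′ * codeg τ)) ≤⟨ 𝟙*-mono (bad τ) (λ b → *-monoʳ-≤ (inside U τ) (few τ b)) ⟩
          𝟙 (bad τ) * (inside U τ * W) ≡⟨ eq₂ W (𝟙 (bad τ)) (inside U τ) ⟩
          W * (𝟙 (bad τ) * inside U τ) ∎
      richness : card U * W ≤ C * sumOver U deg
      richness = subst (card U * W ≤_) (sumOver-*ˡ U C deg) (sumOver-≥ U (λ v → C * deg v) W rich)
      scaled : C * C′ * ∑ ωs (λ ω → w ω * (C ^ j * #bad (restrict U ω) + ℓ * (C * C′) ^ j)) ≤
               C * C′ * ∑ ωs (λ ω → w ω * (C′ ^ j * card (restrict U ω)))
      scaled = begin
        C * C′ * ∑ ωs (λ ω → w ω * (C ^ j * #bad (restrict U ω) + ℓ * (C * C′) ^ j)) ≡⟨ cong (C * C′ *_) sumG ⟩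
        C * C′ * (C ^ j * S + ℓ * (C * C′) ^ j * W) ≡⟨ eq₁ C C′ (C ^ j) S ℓ _ W ⟩
        C * C ^ j * (C′ * S) + ℓ * (C * C′ * (C * C′) ^ j) * W ≤⟨ +-monoˡ-≤ _ (*-monoʳ-≤ (C * C ^ j) badness) ⟩
        C * C ^ j * (W * #bad U) + ℓ * (C * C′ * (C * C′) ^ j) * W ≡⟨ eq₂ (C * C ^ j) W (#bad U) (ℓ * (C * C′ * (C * C′) ^ j)) ⟩
        W * (C ^ suc j * #bad U + ℓ * (C * C′) ^ suc j) ≤⟨ *-monoʳ-≤ W pot ⟩
        W * (C′ ^ suc j * card U) ≡⟨ eq₃ W (C′ ^ suc j) (card U) ⟩
        C′ ^ suc j * (card U * W) ≤⟨ *-monoʳ-≤ (C′ ^ suc j) richness ⟩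
        C′ ^ suc j * (C * sumOver U deg) ≡⟨ eq₄ C C′ (C′ ^ j) (sumOver U deg) ⟩
        C * C′ * (C′ ^ j * sumOver U deg) ≡⟨ cong (C * C′ *_) (sym sumF) ⟩
        C * C′ * ∑ ωs (λ ω → w ω * (C′ ^ j * card (restrict U ω))) ∎
        where
        eq₁ : ∀ c d x s l y w → c * d * (x * s + l * y * w) ≡ c * x * (d * s) + l * (c * d * y) * w
        eq₁ = solve-∀
        eq₂ : ∀ x w b y → x * (w * b) + y * w ≡ w * (x * b + y)
        eq₂ = solve-∀
        eq₃ : ∀ w x u → w * (x * u) ≡ x * (u * w)
        eq₃ = solve-∀
        eq₄ : ∀ c d x s → d * x * (c * s) ≡ c * d * (x * s)
        eq₄ = solve-∀

  -- Vertices of degree below `W/2c` go first; at least a `1/2c` share of `U` stays. After `j`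
  -- rounds of `select` fewer bad triples than vertices remain, with a margin of `ℓ`, and one vertex
  -- is deleted from each.
  drc : ∀ c C C′ ℓ j → 1 ≤ c → 2 * c ≤ C → 1 ≤ C′ → 0 < W → ∀ U →
    card U * W ≤ c * sumOver U deg →
    (∀ x → card U ≤ 2 * c * x → C ^ j * (n * (n * n)) + ℓ * (C * C′) ^ j ≤ C′ ^ j * x) →
    (∀ U′ → U′ ⊆ˢ U → ℓ ≤ card U′ →
      (∀ x y z → U′ x ≡ true → U′ y ≡ true → U′ z ≡ true → W ≤ C′ * codeg (x , y , z)) → ⊥) → ⊥
  drc c C C′ ℓ j 1≤c 2c≤C 1≤C′ 0<W U dense params cont =
    select bad C C′ ℓ 1≤C 1≤C′ 0<W (λ τ b → <⇒≤ (bad-sound τ b)) j U₁ rich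
      (≤-trans (+-monoˡ-≤ _ (*-monoʳ-≤ (C ^ j) #bad≤n³)) (params (card U₁) U≤2cU₁)) clean
    where
    1≤C : 1 ≤ C
    1≤C = ≤-trans (1≤m*n {2} z<s 1≤c) 2c≤C
    bad : Triple → Bool
    bad τ = not (W ≤ᵇ C′ * codeg τ)
    bad-sound : ∀ τ → bad τ ≡ true → C′ * codeg τ < W
    bad-sound τ p with W ≤ᵇ C′ * codeg τ in eq
    ... | false = ≤ᵇ-false W (C′ * codeg τ) eq
    U₁ : VSet
    U₁ = level U W (λ v → 2 * c * deg v)
    rich : ∀ v → U₁ v ≡ true → W ≤ C * deg v
    rich v p = ≤-trans (level-≥ {A = U} {W} {λ v → 2 * c * deg v} v p) (*-monoˡ-≤ (deg v) 2c≤C)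
    U≤2cU₁ : card U ≤ 2 * c * card U₁
    U≤2cU₁ = cancelˡ-≤ W 0<W (lin (W * card U) (W * (2 * c * card U₁)) 0
      (+-mono-≤ (*-monoʳ-≤ 2 dense)
        (subst (_≤ card U₁ * (2 * c * W) + card U * W) (sumOver-*ˡ U (2 * c) deg)
          (markov U (λ v → 2 * c * deg v) W (2 * c * W) (λ v _ → *-monoʳ-≤ (2 * c) (deg≤W v)))))
      (eq W c (card U) (card U₁) (sumOver U deg)))
      where
      eq : ∀ W c u u₁ d → W * u + (2 * (c * d) + (u₁ * (2 * c * W) + u * W)) + 0 ≡
        W * (2 * c * u₁) + (2 * (u * W) + 2 * c * d)
      eq = solve-∀
    #bad≤n³ : #bad bad U₁ ≤ n * (n * n)
    #bad≤n³ = begin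
      #bad bad U₁ ≤⟨ ∑-mono triples (λ τ → *-mono-≤ (𝟙≤1 (bad τ)) (inside≤1 U₁ τ)) ⟩
      ∑ triples (λ _ → 1) ≡⟨ ∑-× (allFin n) pairs _ ⟩
      ∑ (allFin n) (λ _ → ∑ pairs (λ _ → 1)) ≡⟨ ∑-allFin-const n _ ⟩
      n * ∑ pairs (λ _ → 1) ≡⟨ cong (n *_) (trans (∑-× (allFin n) (allFin n) _)
                                              (trans (∑-allFin-const n _) (cong (n *_) (trans (∑-allFin-const n 1) (*-identityʳ n))))) ⟩
      n * (n * n) ∎
      where open ≤-Reasoning
    clean : ∀ U′ → U′ ⊆ˢ U₁ → #bad bad U′ + ℓ ≤ card U′ → ⊥
    clean U′ U′⊆ le = cont U″ (λ v p → ∧-elimˡ (U′⊆ v (∧-elimˡ p))) ℓ≤ good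
      where
      -- `β x` counts the bad triples starting at `x`. Dropping every `x` with `β x > 0` removes at
      -- most `#bad U′` vertices.
      β : Fin n → ℕ
      β x = ∑ pairs (λ yz → 𝟙 (bad (x , yz)) * inside U′ (x , yz))
      U″ : VSet
      U″ x = U′ x ∧ (β x ≤ᵇ 0)
      ℓ≤ : ℓ ≤ card U″
      ℓ≤ = +-cancelˡ-≤ (#bad bad U′) _ _ (begin
        #bad bad U′ + ℓ ≤⟨ le ⟩
        card U′ ≤⟨ ∑-mono (allFin n) pointwise ⟩
        ∑ (allFin n) (λ x → β x + 𝟙 (U″ x)) ≡⟨ ∑-+ (allFin n) _ _ ⟩
        ∑ (allFin n) β + card U″ ≡⟨ cong (_+ card U″) (sym (∑-× (allFin n) pairs _)) ⟩
        #bad bad U′ + card U″ ∎)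
        where
        open ≤-Reasoning
        split : ∀ b k → 𝟙 b ≤ k + 𝟙 (b ∧ (k ≤ᵇ 0))
        split false k = z≤n
        split true zero = ≤-refl
        split true (suc k) = s≤s z≤n
        pointwise : ∀ x → 𝟙 (U′ x) ≤ β x + 𝟙 (U″ x)
        pointwise x = split (U′ x) (β x)
      good : ∀ x y z → U″ x ≡ true → U″ y ≡ true → U″ z ≡ true → W ≤ C′ * codeg (x , y , z)
      good x y z px py pz with W ≤ᵇ C′ * codeg (x , y , z) in eq
      ... | true = ≤ᵇ-sound W _ eq
      ... | false = ⊥-elim (1≢0 term)
        where
        1≢0 : 1 ≡ 0 → ⊥
        1≢0 ()
        β≡0 : β x ≡ 0
        β≡0 = n≤0⇒n≡0 (≤ᵇ-sound (β x) 0 (∧-elimʳ {U′ x} px))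
        term : 1 ≡ 0
        term = trans
          (sym (trans (cong (λ b → 𝟙 (not b) * inside U′ (x , y , z)) eq)
            (trans (+-identityʳ _) (cong₂ _*_ (cong 𝟙 (∧-elimˡ {U′ x} px))
              (cong₂ _*_ (cong 𝟙 (∧-elimˡ {U′ y} py)) (cong 𝟙 (∧-elimˡ {U′ z} pz)))))))
          (∑≡0 _ (∑≡0 _ (trans (sym (∑-× (allFin n) (allFin n) _)) β≡0) y) z)

-- Clique building

private
  swap₃ : ∀ x y z → x * (y * z) ≡ y * (x * z)
  swap₃ = solve-∀

-- The loss of dependent random choice at density 1/c; with C = 2^(2c) and C^j ≈ n^(1/10), the exponent 41
-- outweighs the n³ triples.
opaque
  M : ℕ → ℕ
  M c = (2 ^ (2 * c)) ^ 41

  M-def : ∀ c → M c ≡ (2 ^ (2 * c)) ^ 41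
  M-def c = refl

module Cliques {n : ℕ} (adj : Fin n → Fin n → Bool) (adj-sym : ∀ u v → adj u v ≡ adj v u) where

  open Pairs adj adj-sym

  -- With lists, joining cliques is concatenation; distinctness of the entries follows from
  -- irreflexivity when `list⇒clique` returns to `HasClique`.
  Clique : List (Fin n) → Set
  Clique = AllPairs (λ u v → adj u v ≡ true)

  _⊑_ : List (Fin n) → VSet → Set
  l ⊑ A = All (λ v → A v ≡ true) l

  common : List (Fin n) → VSet
  common [] v = true
  common (t ∷ l) v = adj t v ∧ common l v

  ⊑-mono : ∀ {A B l} → A ⊆ˢ B → l ⊑ A → l ⊑ B
  ⊑-mono A⊆B = All.map (λ {v} → A⊆B v)

  Clique-++ : ∀ {l l′} → Clique l → Clique l′ → l′ ⊑ common l → Clique (l ++ l′)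
  Clique-++ [] d p = d
  Clique-++ {t ∷ l} (c ∷ cs) d p = All.++⁺ c (All.map ∧-elimˡ p) ∷ Clique-++ cs d (All.map (λ {v} → ∧-elimʳ {adj t v}) p)

  -- `FiveIn` and `Choice` are the only forms in which the independence number enters the search for
  -- a K₁₃.
  FiveIn : ℕ → Set
  FiveIn K = ∀ A → n ≤ K * card A → (∀ l → length l ≡ 5 → Clique l → l ⊑ A → ⊥) → ⊥

  -- The outcome of dependent random choice for a relation of density `1/c`. It is polymorphic in
  -- `Ω` because vertices, edges and triangles all take that place; the last two are encoded as 0/1
  -- weights on pairs and triples.
  Choice : ℕ → ℕ → Set₁
  Choice K c = ∀ {Ω : Set} (ωs : List Ω) w F U → let open DRC ωs w F in
    0 < W → n ≤ K * card U → card U * W ≤ c * sumOver U deg →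
    (∀ x y z → Clique (x ∷ y ∷ z ∷ []) → (x ∷ y ∷ z ∷ []) ⊑ U → W ≤ M c * codeg (x , y , z) → ⊥) → ⊥

  wt₂ : VSet → VSet → Fin n × Fin n → ℕ
  wt₂ Y Z (y , z) = 𝟙 (Y y) * (𝟙 (Z z) * 𝟙 (adj y z))

  wt₃ : VSet → VSet → VSet → Fin n × (Fin n × Fin n) → ℕ
  wt₃ X Y Z (x , y , z) = 𝟙 (X x) * (𝟙 (adj x y) * 𝟙 (adj x z)) * wt₂ Y Z (y , z)

  V : List (Fin n)
  V = allFin n

  V² : List (Fin n × Fin n)
  V² = cartesianProduct V V

  V³ : List (Fin n × (Fin n × Fin n))
  V³ = cartesianProduct V V²

  ∑-V³ : ∀ f → ∑ V³ f ≡ ∑ V (λ x → ∑ V (λ y → ∑ V (λ z → f (x , y , z))))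
  ∑-V³ f = trans (∑-× V V² f) (∑-cong V λ x → ∑-× V V _)

  e≡∑ : ∀ Y Z → e Y Z ≡ ∑ V² (wt₂ Y Z)
  e≡∑ Y Z = sym (trans (∑-× V V _) (∑-cong V λ y → ∑-*ˡ V (𝟙 (Y y)) _))

  tri : VSet → VSet → VSet → ℕ
  tri X Y Z = ∑ V³ (wt₃ X Y Z)

  e-∩ : ∀ Y Z S → e (Y ∩ˢ S) (Z ∩ˢ S) ≡ ∑ V² (λ yz → wt₂ Y Z yz * (𝟙 (S (proj₁ yz)) * 𝟙 (S (proj₂ yz))))
  e-∩ Y Z S = trans (e≡∑ (Y ∩ˢ S) (Z ∩ˢ S)) (∑-cong V² λ { (y , z) → pointwise y z })
    where
    shuffle : ∀ a s b t c → a * s * (b * t * c) ≡ a * (b * c) * (s * t)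
    shuffle = solve-∀
    pointwise : ∀ y z → wt₂ (Y ∩ˢ S) (Z ∩ˢ S) (y , z) ≡ wt₂ Y Z (y , z) * (𝟙 (S y) * 𝟙 (S z))
    pointwise y z rewrite 𝟙-∧ (Y y) (S y) | 𝟙-∧ (Z z) (S z) = shuffle (𝟙 (Y y)) _ (𝟙 (Z z)) _ _

  tri-∩ : ∀ X Y Z S → tri (X ∩ˢ S) (Y ∩ˢ S) (Z ∩ˢ S) ≡
    ∑ V³ (λ { (x , y , z) → wt₃ X Y Z (x , y , z) * (𝟙 (S x) * (𝟙 (S y) * 𝟙 (S z))) })
  tri-∩ X Y Z S = ∑-cong V³ λ { (x , y , z) → pointwise x y z }
    where
    shuffle : ∀ d a s b t c u h → d * u * h * (a * s * (b * t * c)) ≡ d * h * (a * (b * c)) * (u * (s * t))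
    shuffle = solve-∀
    pointwise : ∀ x y z → wt₃ (X ∩ˢ S) (Y ∩ˢ S) (Z ∩ˢ S) (x , y , z) ≡ wt₃ X Y Z (x , y , z) * (𝟙 (S x) * (𝟙 (S y) * 𝟙 (S z)))
    pointwise x y z rewrite 𝟙-∧ (X x) (S x) | 𝟙-∧ (Y y) (S y) | 𝟙-∧ (Z z) (S z) =
      shuffle (𝟙 (X x)) (𝟙 (Y y)) _ (𝟙 (Z z)) _ _ _ (𝟙 (adj x y) * 𝟙 (adj x z))

  tri-first : ∀ X Y Z → tri X Y Z ≡ sumOver X (λ x → e (Y ∩ˢ adj x) (Z ∩ˢ adj x))
  tri-first X Y Z = trans (∑-× V V² _) (∑-cong V λ x → sym (trans (cong (𝟙 (X x) *_) (e-∩ Y Z (adj x)))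
    (trans (sym (∑-*ˡ V² (𝟙 (X x)) _)) (∑-cong V² λ { (y , z) → shuffle (𝟙 (X x)) (wt₂ Y Z (y , z)) _ }))))
    where
    shuffle : ∀ a w b → a * (w * b) ≡ a * b * w
    shuffle = solve-∀

  tri-rotate : ∀ X Y Z → tri X Y Z ≡ tri Z X Y
  tri-rotate X Y Z = begin
    tri X Y Z ≡⟨ ∑-V³ _ ⟩
    ∑ V (λ x → ∑ V (λ y → ∑ V (λ z → wt₃ X Y Z (x , y , z)))) ≡⟨ ∑-cong V (λ x → ∑-swap V V _) ⟩
    ∑ V (λ x → ∑ V (λ z → ∑ V (λ y → wt₃ X Y Z (x , y , z)))) ≡⟨ ∑-swap V V _ ⟩
    ∑ V (λ z → ∑ V (λ x → ∑ V (λ y → wt₃ X Y Z (x , y , z))))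
      ≡⟨ ∑-cong V (λ z → ∑-cong V λ x → ∑-cong V λ y → pointwise x y z) ⟩
    ∑ V (λ z → ∑ V (λ x → ∑ V (λ y → wt₃ Z X Y (z , x , y)))) ≡⟨ sym (∑-V³ _) ⟩
    tri Z X Y ∎
    where
    open ≡-Reasoning
    shuffle : ∀ a b c p q r → a * (p * q) * (b * (c * r)) ≡ c * (q * r) * (a * (b * p))
    shuffle = solve-∀
    pointwise : ∀ x y z → wt₃ X Y Z (x , y , z) ≡ wt₃ Z X Y (z , x , y)
    pointwise x y z rewrite adj-sym z x | adj-sym z y =
      shuffle (𝟙 (X x)) (𝟙 (Y y)) (𝟙 (Z z)) (𝟙 (adj x y)) (𝟙 (adj x z)) (𝟙 (adj y z))

  tri≤ : ∀ X Y Z → tri X Y Z ≤ card X * e Y Z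
  tri≤ X Y Z = subst (_≤ card X * e Y Z) (sym (tri-first X Y Z))
    (sumOver-≤ X _ _ λ x _ → e-⊆ {Y} {Y ∩ˢ adj x} {Z} {Z ∩ˢ adj x} (λ v → ∧-elimˡ) (λ v → ∧-elimˡ))

  tri≤³ : ∀ X Y Z → tri X Y Z ≤ card X * (card Y * card Z)
  tri≤³ X Y Z = ≤-trans (tri≤ X Y Z) (*-monoʳ-≤ (card X) (e≤ Y Z))

  private
    𝟙-common₃ : ∀ t₁ t₂ t₃ v → 𝟙 (common (t₁ ∷ t₂ ∷ t₃ ∷ []) v) ≡ 𝟙 (adj t₁ v) * (𝟙 (adj t₂ v) * 𝟙 (adj t₃ v))
    𝟙-common₃ t₁ t₂ t₃ v = trans (𝟙-∧ (adj t₁ v) _) (cong (𝟙 (adj t₁ v) *_)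
      (trans (𝟙-∧ (adj t₂ v) _) (cong (𝟙 (adj t₂ v) *_) (trans (𝟙-∧ (adj t₃ v) true) (*-identityʳ _)))))

  average-bound : ∀ d t c S w → 0 < d → d * t ≤ c * S → S ≤ d * w → t ≤ c * w
  average-bound d t c S w 0<d p q = cancelˡ-≤ d 0<d (≤-trans p (≤-trans (*-monoʳ-≤ c q) (≤-reflexive (swap₃ c d w))))

  pos-of : ∀ K x → 0 < n → n ≤ K * x → 0 < x
  pos-of K x 0<n p = factor-pos K x (≤-trans 0<n p)

  -- `t` is the size of the full box and `W` the weight inside it. No degree exceeds `W`, so density
  -- relative to `t` forces `t ≤ c * W`; changing the normalisation costs one factor `c`, hence
  -- `c * M c`.
  choice-weighted : ∀ K c → Choice K c → 0 < n → ∀ {Ω : Set} (ωs : List Ω) w F U t → let open DRC ωs w F in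
    n ≤ K * card U → 0 < t → W ≤ t → card U * t ≤ c * sumOver U deg →
    (∀ x y z → Clique (x ∷ y ∷ z ∷ []) → (x ∷ y ∷ z ∷ []) ⊑ U → t ≤ c * M c * codeg (x , y , z) → ⊥) → ⊥
  choice-weighted K c choice 0<n ωs w F U t big 0<t W≤t dense cont =
    choice ωs w F U (factor-pos c W (≤-trans 0<t t≤cW)) big (≤-trans (*-monoʳ-≤ (card U) W≤t) dense)
      λ x y z cl inU le → cont x y z cl inU (≤-trans t≤cW (≤-trans (*-monoʳ-≤ c le) (≤-reflexive (sym (*-assoc c (M c) _)))))
    where
    open DRC ωs w F
    t≤cW : t ≤ c * W
    t≤cW = average-bound (card U) t c (sumOver U deg) W (pos-of K _ 0<n big) dense (sumOver-≤ U deg W λ v _ → deg≤W v)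

  choice-tri : ∀ K c → Choice K c → 0 < n → ∀ X Y Z → n ≤ K * card X → 0 < card Y → 0 < card Z →
    card X * (card Y * card Z) ≤ c * tri X Y Z →
    (∀ x y z → let T = x ∷ y ∷ z ∷ [] in Clique T → T ⊑ X →
      card Y * card Z ≤ c * M c * e (Y ∩ˢ common T) (Z ∩ˢ common T) → ⊥) → ⊥
  choice-tri K c choice 0<n X Y Z bigX 0<Y 0<Z dense cont =
    choice-weighted K c choice 0<n V² (wt₂ Y Z) F X (card Y * card Z) bigX (1≤m*n 0<Y 0<Z) (subst (_≤ card Y * card Z) (e≡∑ Y Z) (e≤ Y Z))
      (subst (λ k → card X * (card Y * card Z) ≤ c * k) (trans (tri-first X Y Z) (∑-cong V λ x → cong (𝟙 (X x) *_) (sym (deg≡ x)))) dense)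
      λ x y z cl inX le → cont x y z cl inX (subst (λ k → card Y * card Z ≤ c * M c * k) (codeg≡ x y z) le)
    where
    F : Fin n → Fin n × Fin n → Bool
    F x (y , z) = adj x y ∧ adj x z
    deg≡ : ∀ x → DRC.deg V² (wt₂ Y Z) F x ≡ e (Y ∩ˢ adj x) (Z ∩ˢ adj x)
    deg≡ x = trans (∑-cong V² λ { (y , z) → cong (wt₂ Y Z (y , z) *_) (𝟙-∧ (adj x y) (adj x z)) }) (sym (e-∩ Y Z (adj x)))
    codeg≡ : ∀ t₁ t₂ t₃ → DRC.codeg V² (wt₂ Y Z) F (t₁ , t₂ , t₃) ≡
      e (Y ∩ˢ common (t₁ ∷ t₂ ∷ t₃ ∷ [])) (Z ∩ˢ common (t₁ ∷ t₂ ∷ t₃ ∷ []))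
    codeg≡ t₁ t₂ t₃ = trans (∑-cong V² λ { (y , z) → pointwise y z }) (sym (e-∩ Y Z (common (t₁ ∷ t₂ ∷ t₃ ∷ []))))
      where
      shuffle : ∀ a b c d f g → a * b * (c * d * (f * g)) ≡ a * (c * f) * (b * (d * g))
      shuffle = solve-∀
      pointwise : ∀ y z → wt₂ Y Z (y , z) * (𝟙 (F t₁ (y , z)) * (𝟙 (F t₂ (y , z)) * 𝟙 (F t₃ (y , z)))) ≡
        wt₂ Y Z (y , z) * (𝟙 (common (t₁ ∷ t₂ ∷ t₃ ∷ []) y) * 𝟙 (common (t₁ ∷ t₂ ∷ t₃ ∷ []) z))
      pointwise y z rewrite 𝟙-common₃ t₁ t₂ t₃ y | 𝟙-common₃ t₁ t₂ t₃ z
        | 𝟙-∧ (adj t₁ y) (adj t₁ z) | 𝟙-∧ (adj t₂ y) (adj t₂ z) | 𝟙-∧ (adj t₃ y) (adj t₃ z) =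
        cong (wt₂ Y Z (y , z) *_) (shuffle (𝟙 (adj t₁ y)) (𝟙 (adj t₁ z)) (𝟙 (adj t₂ y)) (𝟙 (adj t₂ z)) (𝟙 (adj t₃ y)) (𝟙 (adj t₃ z)))

  choice-quad : ∀ K c → Choice K c → 0 < n → ∀ D X Y Z → n ≤ K * card D → 0 < card X → 0 < card Y → 0 < card Z →
    card D * (card X * (card Y * card Z)) ≤ c * sumOver D (λ v → tri (X ∩ˢ adj v) (Y ∩ˢ adj v) (Z ∩ˢ adj v)) →
    (∀ x y z → let T = x ∷ y ∷ z ∷ [] in Clique T → T ⊑ D →
      card X * (card Y * card Z) ≤ c * M c * tri (X ∩ˢ common T) (Y ∩ˢ common T) (Z ∩ˢ common T) → ⊥) → ⊥
  choice-quad K c choice 0<n D X Y Z bigD 0<X 0<Y 0<Z dense cont =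
    choice-weighted K c choice 0<n V³ (wt₃ X Y Z) F D (card X * (card Y * card Z)) bigD (1≤m*n 0<X (1≤m*n 0<Y 0<Z)) (tri≤³ X Y Z)
      (subst (λ k → card D * (card X * (card Y * card Z)) ≤ c * k) (∑-cong V λ v → cong (𝟙 (D v) *_) (sym (deg≡ v))) dense)
      λ x y z cl inD le → cont x y z cl inD (subst (λ k → card X * (card Y * card Z) ≤ c * M c * k) (codeg≡ x y z) le)
    where
    F : Fin n → Fin n × (Fin n × Fin n) → Bool
    F v (x , y , z) = adj v x ∧ (adj v y ∧ adj v z)
    deg≡ : ∀ v → DRC.deg V³ (wt₃ X Y Z) F v ≡ tri (X ∩ˢ adj v) (Y ∩ˢ adj v) (Z ∩ˢ adj v)
    deg≡ v = trans (∑-cong V³ λ { (x , y , z) → cong (wt₃ X Y Z (x , y , z) *_)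
      (trans (𝟙-∧ (adj v x) _) (cong (𝟙 (adj v x) *_) (𝟙-∧ (adj v y) (adj v z)))) }) (sym (tri-∩ X Y Z (adj v)))
    codeg≡ : ∀ t₁ t₂ t₃ → let T = t₁ ∷ t₂ ∷ t₃ ∷ [] in DRC.codeg V³ (wt₃ X Y Z) F (t₁ , t₂ , t₃) ≡
      tri (X ∩ˢ common T) (Y ∩ˢ common T) (Z ∩ˢ common T)
    codeg≡ t₁ t₂ t₃ = trans (∑-cong V³ λ { (x , y , z) → pointwise x y z }) (sym (tri-∩ X Y Z (common (t₁ ∷ t₂ ∷ t₃ ∷ []))))
      where
      shuffle : ∀ a b c d f g h i j → a * (b * c) * (d * (f * g) * (h * (i * j))) ≡ a * (d * h) * (b * (f * i) * (c * (g * j)))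
      shuffle = solve-∀
      F≡ : ∀ t x y z → 𝟙 (F t (x , y , z)) ≡ 𝟙 (adj t x) * (𝟙 (adj t y) * 𝟙 (adj t z))
      F≡ t x y z = trans (𝟙-∧ (adj t x) _) (cong (𝟙 (adj t x) *_) (𝟙-∧ (adj t y) (adj t z)))
      pointwise : ∀ x y z → wt₃ X Y Z (x , y , z) * (𝟙 (F t₁ (x , y , z)) * (𝟙 (F t₂ (x , y , z)) * 𝟙 (F t₃ (x , y , z)))) ≡
        wt₃ X Y Z (x , y , z) * (𝟙 (common (t₁ ∷ t₂ ∷ t₃ ∷ []) x) * (𝟙 (common (t₁ ∷ t₂ ∷ t₃ ∷ []) y) * 𝟙 (common (t₁ ∷ t₂ ∷ t₃ ∷ []) z)))
      pointwise x y z rewrite 𝟙-common₃ t₁ t₂ t₃ x | 𝟙-common₃ t₁ t₂ t₃ y | 𝟙-common₃ t₁ t₂ t₃ z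
        | F≡ t₁ x y z | F≡ t₂ x y z | F≡ t₃ x y z =
        cong (wt₃ X Y Z (x , y , z) *_) (shuffle (𝟙 (adj t₁ x)) (𝟙 (adj t₁ y)) (𝟙 (adj t₁ z)) (𝟙 (adj t₂ x)) (𝟙 (adj t₂ y)) (𝟙 (adj t₂ z)) (𝟙 (adj t₃ x)) (𝟙 (adj t₃ y)) (𝟙 (adj t₃ z)))

  choice-pair : ∀ K c → Choice K c → 0 < n → ∀ Y Z → n ≤ K * card Y → 0 < card Z →
    card Y * card Z ≤ c * e Y Z →
    (∀ x y z → let T = x ∷ y ∷ z ∷ [] in Clique T → T ⊑ Y → card Z ≤ M c * card (Z ∩ˢ common T) → ⊥) → ⊥
  choice-pair K c choice 0<n Y Z bigY 0<Z dense cont =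
    choice V (𝟙 ∘ Z) adj Y 0<Z bigY dense λ x y z cl inY le → cont x y z cl inY
      (subst (λ k → card Z ≤ M c * k) (∑-cong V λ v → trans (cong (𝟙 (Z v) *_) (sym (𝟙-common₃ x y z v))) (sym (𝟙-∧ (Z v) _))) le)

-- Two configurations that force a K₁₃

cancel-dim : ∀ a a′ b c → 0 < b → a * b ≤ c * (a′ * b) → a ≤ c * a′
cancel-dim a a′ b c 0<b p = cancelˡ-≤ b 0<b (≤-trans (≤-reflexive (*-comm b a)) (≤-trans p (≤-reflexive (eq c a′ b))))
  where
  eq : ∀ c a b → c * (a * b) ≡ b * (c * a)
  eq = solve-∀

≤*-trans : ∀ x K a c b → x ≤ K * a → a ≤ c * b → x ≤ K * c * b
≤*-trans x K a c b p q = ≤-trans p (≤-trans (*-monoʳ-≤ K q) (≤-reflexive (sym (*-assoc K c b))))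

1≤M : ∀ c → 1 ≤ M c
1≤M c = subst (1 ≤_) (sym (M-def c)) (1≤m^n 41 (1≤m^n {2} (2 * c) z<s))

-- Constants of `dense-pair`. `P/Q` is `4/5 + 1/(2g)`, expanded by `h` so that the regularity loss
-- `h/Q` is only `1/(10g)`. `c₀` is the reciprocal triangle density found there, `m` the resulting
-- shrinkage of both sides of the dense pair, and `h = (3m)²` the loss of `regularise` for subsets
-- with a `1/m` share.
module DenseCase (r g : ℕ) where
  c₀ = 40 * r
  m = c₀ * M c₀
  h = 3 * m * (3 * m)
  P = (8 * g + 5) * h
  Q = 10 * g * h
  μ = shrink m (suc Q)

module Core {n : ℕ} (adj : Fin n → Fin n → Bool) (adj-sym : ∀ u v → adj u v ≡ adj v u)
  (0<n : 0 < n)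
  (no-K₁₃ : ∀ l → length l ≡ 13 → AllPairs (λ u v → adj u v ≡ true) l → ⊥) where

  open Pairs adj adj-sym
  open Cliques adj adj-sym

  PosReg : ℕ → ℕ → VSet → VSet → Set
  PosReg s r A B = ∀ A′ B′ → A′ ⊆ˢ A → B′ ⊆ˢ B → card A ≤ s * card A′ → card B ≤ s * card B′ →
    card A′ * card B′ ≤ r * e A′ B′

  -- Each round spends one class on a triangle and lowers the density of the rest from `1/c` to
  -- `1/(c M(c))`. The same number bounds the share kept of every remaining class, which yields the
  -- tower `c₁`, `c₂`, `c₃`. The last class supplies the K₅.
  many-K₄ : ∀ K c₁ → let c₂ = c₁ * M c₁ ; c₃ = c₂ * M c₂ in
    Choice K c₁ → Choice (K * c₂) c₂ → Choice (K * c₂ * c₃) c₃ → FiveIn (K * c₂ * c₃ * M c₃) →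
    ∀ D X Y Z → n ≤ K * card D → n ≤ K * card X → n ≤ K * card Y → n ≤ K * card Z →
    card D * (card X * (card Y * card Z)) ≤ c₁ * sumOver D (λ v → tri (X ∩ˢ adj v) (Y ∩ˢ adj v) (Z ∩ˢ adj v)) → ⊥
  many-K₄ K c₁ ch₁ ch₂ ch₃ five D X Y Z bigD bigX bigY bigZ dense =
    choice-quad K c₁ ch₁ 0<n D X Y Z bigD 0<X 0<Y 0<Z dense stage₁
    where
    c₂ = c₁ * M c₁
    c₃ = c₂ * M c₂
    0<X = pos-of K (card X) 0<n bigX
    0<Y = pos-of K (card Y) 0<n bigY
    0<Z = pos-of K (card Z) 0<n bigZ
    stage₁ : ∀ x y z → let T = x ∷ y ∷ z ∷ [] in Clique T → T ⊑ D →
      card X * (card Y * card Z) ≤ c₂ * tri (X ∩ˢ common T) (Y ∩ˢ common T) (Z ∩ˢ common T) → ⊥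
    stage₁ x y z (_ ∷ clT) _ le =
      choice-tri (K * c₂) c₂ ch₂ 0<n X₁ Y₁ Z₁ bigX₁ (pos-of (K * c₂) (card Y₁) 0<n bigY₁) (pos-of (K * c₂) (card Z₁) 0<n bigZ₁)
        (≤-trans (*-mono-≤ X₁≤X (*-mono-≤ Y₁≤Y Z₁≤Z)) le) stage₂
      where
      T : List (Fin n)
      T = x ∷ y ∷ z ∷ []
      X₁ = X ∩ˢ common T
      Y₁ = Y ∩ˢ common T
      Z₁ = Z ∩ˢ common T
      X₁≤X = card-mono {A = X₁} {X} (λ v → ∧-elimˡ)
      Y₁≤Y = card-mono {A = Y₁} {Y} (λ v → ∧-elimˡ)
      Z₁≤Z = card-mono {A = Z₁} {Z} (λ v → ∧-elimˡ)
      le′ : card X * (card Y * card Z) ≤ c₂ * (card X₁ * (card Y₁ * card Z₁))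
      le′ = ≤-trans le (*-monoʳ-≤ c₂ (tri≤³ X₁ Y₁ Z₁))
      rot₁ : ∀ x y z → y * (x * z) ≡ x * (y * z)
      rot₁ = solve-∀
      rot₂ : ∀ x y z → z * (x * y) ≡ x * (y * z)
      rot₂ = solve-∀
      bigX₁ : n ≤ K * c₂ * card X₁
      bigX₁ = ≤*-trans n K (card X) c₂ (card X₁) bigX (cancel-dim (card X) (card X₁) (card Y * card Z) c₂ (1≤m*n 0<Y 0<Z)
        (≤-trans le′ (*-monoʳ-≤ c₂ (*-monoʳ-≤ (card X₁) (*-mono-≤ Y₁≤Y Z₁≤Z)))))
      bigY₁ : n ≤ K * c₂ * card Y₁
      bigY₁ = ≤*-trans n K (card Y) c₂ (card Y₁) bigY (cancel-dim (card Y) (card Y₁) (card X * card Z) c₂ (1≤m*n 0<X 0<Z)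
        (≤-trans (≤-reflexive (rot₁ (card X) (card Y) (card Z))) (≤-trans le′ (*-monoʳ-≤ c₂
          (≤-trans (*-mono-≤ X₁≤X (*-monoʳ-≤ (card Y₁) Z₁≤Z)) (≤-reflexive (sym (rot₁ (card X) (card Y₁) (card Z)))))))))
      bigZ₁ : n ≤ K * c₂ * card Z₁
      bigZ₁ = ≤*-trans n K (card Z) c₂ (card Z₁) bigZ (cancel-dim (card Z) (card Z₁) (card X * card Y) c₂ (1≤m*n 0<X 0<Y)
        (≤-trans (≤-reflexive (rot₂ (card X) (card Y) (card Z))) (≤-trans le′ (*-monoʳ-≤ c₂
          (≤-trans (*-mono-≤ X₁≤X (*-monoˡ-≤ (card Z₁) Y₁≤Y)) (≤-reflexive (sym (rot₂ (card X) (card Y) (card Z₁)))))))))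
      stage₂ : ∀ x y z → let T = x ∷ y ∷ z ∷ [] in Clique T → T ⊑ X₁ →
        card Y₁ * card Z₁ ≤ c₃ * e (Y₁ ∩ˢ common T) (Z₁ ∩ˢ common T) → ⊥
      stage₂ x y z clT₂ T₂⊑ le₂ =
        choice-pair (K * c₂ * c₃) c₃ ch₃ 0<n Y₂ Z₂ bigY₂ (pos-of (K * c₂ * c₃) (card Z₂) 0<n bigZ₂)
          (≤-trans (*-mono-≤ Y₂≤Y₁ Z₂≤Z₁) le₂) stage₃
        where
        T₂ : List (Fin n)
        T₂ = x ∷ y ∷ z ∷ []
        Y₂ = Y₁ ∩ˢ common T₂
        Z₂ = Z₁ ∩ˢ common T₂
        Y₂≤Y₁ = card-mono {A = Y₂} {Y₁} (λ v → ∧-elimˡ)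
        Z₂≤Z₁ = card-mono {A = Z₂} {Z₁} (λ v → ∧-elimˡ)
        bigY₂ : n ≤ K * c₂ * c₃ * card Y₂
        bigY₂ = ≤*-trans n (K * c₂) (card Y₁) c₃ (card Y₂) bigY₁ (cancel-dim (card Y₁) (card Y₂) (card Z₁) c₃
          (pos-of (K * c₂) (card Z₁) 0<n bigZ₁) (≤-trans le₂ (*-monoʳ-≤ c₃ (≤-trans (e≤ Y₂ Z₂) (*-monoʳ-≤ (card Y₂) Z₂≤Z₁)))))
        bigZ₂ : n ≤ K * c₂ * c₃ * card Z₂
        bigZ₂ = ≤*-trans n (K * c₂) (card Z₁) c₃ (card Z₂) bigZ₁ (cancel-dim (card Z₁) (card Z₂) (card Y₁) c₃
          (pos-of (K * c₂) (card Y₁) 0<n bigY₁) (≤-trans (≤-reflexive (*-comm (card Z₁) (card Y₁))) (≤-trans le₂ (*-monoʳ-≤ c₃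
            (≤-trans (e≤ Y₂ Z₂) (≤-trans (*-monoˡ-≤ (card Z₂) Y₂≤Y₁) (≤-reflexive (*-comm (card Y₁) (card Z₂)))))))))
        stage₃ : ∀ x y z → let T = x ∷ y ∷ z ∷ [] in Clique T → T ⊑ Y₂ → card Z₂ ≤ M c₃ * card (Z₂ ∩ˢ common T) → ⊥
        stage₃ x y z clT₃ T₃⊑ le₃ = five (Z₂ ∩ˢ common T₃)
          (≤*-trans n (K * c₂ * c₃) (card Z₂) (M c₃) (card (Z₂ ∩ˢ common T₃)) bigZ₂ le₃) stage₄
          where
          T₃ : List (Fin n)
          T₃ = x ∷ y ∷ z ∷ []
          stage₄ : ∀ l → length l ≡ 5 → Clique l → l ⊑ (Z₂ ∩ˢ common T₃) → ⊥
          -- Only the last two vertices of `T` are used, as 14 is one more than required; `clT` is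
          -- already the clique on these two.
          stage₄ l |l| cl l⊑ = no-K₁₃ (_ ∷ _ ∷ (T₂ ++ (T₃ ++ l))) (cong (8 +_) |l|)
            (Clique-++ clT (Clique-++ clT₂ (Clique-++ clT₃ cl (⊑-mono (λ v → ∧-elimʳ {Z₂ v}) l⊑))
                (All.++⁺ (⊑-mono (λ v → ∧-elimʳ {Y₁ v}) T₃⊑) (⊑-mono (λ v p → ∧-elimʳ {Z₁ v} (∧-elimˡ p)) l⊑)))
              (All.++⁺ (⊑-mono (λ v p → tail v (∧-elimʳ {X v} p)) T₂⊑) (All.++⁺
                (⊑-mono (λ v p → tail v (∧-elimʳ {Y v} (∧-elimˡ p))) T₃⊑)
                (⊑-mono (λ v p → tail v (∧-elimʳ {Z v} (∧-elimˡ (∧-elimˡ p)))) l⊑))))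
            where
            tail : ∀ v → common T v ≡ true → common (Data.List.drop 1 T) v ≡ true
            tail v = ∧-elimʳ {adj _ v}

  -- Union bound over the non-neighbours of the vertices of `l`, written without subtraction. It is
  -- informative when the average density exceeds `1 - 1/length l`, which is 4/5 for five vertices.
  ∑N≤common : ∀ B l → ∑ l (N B) + card B ≤ length l * card B + card (B ∩ˢ common l)
  ∑N≤common B [] = card-mono {A = B} {B ∩ˢ common []} (λ v b → ∧-intro b refl)
  ∑N≤common B (v ∷ l) = lin _ _ 0 (+-mono-≤ (∑N≤common B l) step)
    (eq (N B v) (∑ l (N B)) (card B) (length l * card B) (card (B ∩ˢ common l)) (card (B ∩ˢ common (v ∷ l))))
    where
    eq : ∀ a s b k x y → a + s + b + (k + x + (b + y)) + 0 ≡ b + k + y + (s + b + (a + x))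
    eq = solve-∀
    pointwise : ∀ b a c → 𝟙 b * 𝟙 a + 𝟙 (b ∧ c) ≤ 𝟙 b + 𝟙 (b ∧ (a ∧ c))
    pointwise false a c = z≤n
    pointwise true false c = 𝟙≤1 c
    pointwise true true c = ≤-refl
    step : N B v + card (B ∩ˢ common l) ≤ card B + card (B ∩ˢ common (v ∷ l))
    step = begin
      N B v + card (B ∩ˢ common l) ≡⟨ sym (∑-+ V _ _) ⟩
      ∑ V (λ u → 𝟙 (B u) * 𝟙 (adj v u) + 𝟙 (B u ∧ common l u)) ≤⟨ ∑-mono V (λ u → pointwise (B u) (adj v u) (common l u)) ⟩
      ∑ V (λ u → 𝟙 (B u) + 𝟙 (B u ∧ (adj v u ∧ common l u))) ≡⟨ ∑-+ V _ _ ⟩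
      card B + card (B ∩ˢ common (v ∷ l)) ∎
      where open ≤-Reasoning

  ∑≥ : ∀ l (f : Fin n → ℕ) t → All (λ v → t ≤ f v) l → length l * t ≤ ∑ l f
  ∑≥ [] f t [] = z≤n
  ∑≥ (v ∷ l) f t (p ∷ ps) = +-mono-≤ p (∑≥ l f t ps)

  -- The triangle `T` in `Y` comes with large parts `A`, `B` of the dense pair in its common
  -- neighbourhood, at first only with positive density between them. Regularity of the pair,
  -- prepared beforehand for shares `1/m`, lifts this above 4/5 again, so that a K₅ of rich vertices
  -- in `A` leaves room for a second one in `B`.
  dense-pair : ∀ K g r s → 1 ≤ g → 1 ≤ r → let open DenseCase r g in
    2 * μ ≤ s → K * (3 * m * μ) ≤ n → Choice K c₀ → FiveIn (K * μ * m * (5 * g)) → FiveIn (K * μ * m * g) →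
    ∀ D X Y → n ≤ K * card D → n ≤ K * card X → n ≤ K * card Y → PosReg s r X Y →
    (∀ v → D v ≡ true → (8 * g + 5) * card X ≤ 10 * g * N X v) →
    (∀ v → D v ≡ true → card Y ≤ 2 * N Y v) → ⊥
  dense-pair K g r s 1≤g 1≤r 2μ≤s Kμ≤n choice five₁ five₂ D X Y bigD bigX bigY reg degX degY =
    regularise m P Q 1≤m (suc Q) P ≤-refl (m≤n+m (suc Q) P) D X (enough D bigD) (enough X bigX) denseDX main
    where
    open DenseCase r g
    1≤m : 1 ≤ m
    1≤m = 1≤m*n (1≤m*n {40} z<s 1≤r) (1≤M c₀)
    1≤h : 1 ≤ h
    1≤h = 1≤m*n (1≤m*n {3} z<s 1≤m) (1≤m*n {3} z<s 1≤m)
    1≤μ : 1 ≤ μ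
    1≤μ = 1≤m^n (suc Q) (1≤m*n {3} z<s 1≤m)
    1≤K : 1 ≤ K
    1≤K = pos-of (card D) K 0<n (≤-trans bigD (≤-reflexive (*-comm K (card D))))
    enough : ∀ A → n ≤ K * card A → 3 * m * μ ≤ card A
    enough A big = cancelˡ-≤ K 1≤K (≤-trans Kμ≤n big)
    denseDX : P * (card D * card X) ≤ Q * e D X
    denseDX = begin
      P * (card D * card X) ≡⟨ eq₁ (8 * g + 5) h (card D) (card X) ⟩
      h * (card D * ((8 * g + 5) * card X)) ≤⟨ *-monoʳ-≤ h (sumOver-≥ D _ _ degX) ⟩
      h * sumOver D (λ v → 10 * g * N X v) ≡⟨ cong (h *_) (sumOver-*ˡ D (10 * g) (N X)) ⟩
      h * (10 * g * e D X) ≡⟨ eq₂ h (10 * g) (e D X) ⟩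
      Q * e D X ∎
      where
      open ≤-Reasoning
      eq₁ : ∀ p h d x → p * h * (d * x) ≡ h * (d * (p * x))
      eq₁ = solve-∀
      eq₂ : ∀ h q e → h * (q * e) ≡ q * h * e
      eq₂ = solve-∀
    main : ∀ C X₁ → C ⊆ˢ D → X₁ ⊆ˢ X → card D ≤ μ * card C → card X ≤ μ * card X₁ →
      P * (card C * card X₁) ≤ Q * e C X₁ → Reg P Q m h C X₁ → ⊥
    main C X₁ C⊆D X₁⊆X D≤μC X≤μX₁ denseCX regCX =
      choice-tri K c₀ choice 0<n Y C X₁ bigY (pos-of (K * μ) c 0<n bigC) (pos-of (K * μ) x 0<n bigX₁) triangles finish
      where
      c = card C
      x = card X₁
      y = card Y
      bigC : n ≤ K * μ * c
      bigC = ≤*-trans n K (card D) μ c bigD D≤μC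
      bigX₁ : n ≤ K * μ * x
      bigX₁ = ≤*-trans n K (card X) μ x bigX X≤μX₁
      C₁ = level C x (λ v → 2 * N X₁ v)
      4cx≤5e : (8 * g + 5) * (c * x) ≤ 10 * g * e C X₁
      4cx≤5e = cancelˡ-≤ h 1≤h (≤-trans (≤-reflexive (eq (8 * g + 5) h (c * x)))
        (≤-trans denseCX (≤-reflexive (sym (eq (10 * g) h (e C X₁))))))
        where
        eq : ∀ p h z → h * (p * z) ≡ p * h * z
        eq = solve-∀
      -- Markov with threshold 1/2: the share is at least `4/5 - 1/2 = 3/10`.
      3c≤10C₁ : 3 * c ≤ 10 * card C₁
      3c≤10C₁ = cancelˡ-≤ (x * g) (1≤m*n (pos-of (K * μ) x 0<n bigX₁) 1≤g)
        (lin (x * g * (3 * c)) (x * g * (10 * card C₁)) (5 * c * x)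
          (+-mono-≤ 4cx≤5e (*-monoʳ-≤ (5 * g) (subst (_≤ card C₁ * (2 * x) + c * x) (sumOver-*ˡ C 2 (N X₁))
            (markov C (λ v → 2 * N X₁ v) x (2 * x) (λ v _ → *-monoʳ-≤ 2 (N≤card X₁ v))))))
          (eq g x c (card C₁) (e C X₁)))
        where
        eq : ∀ g x c k e → x * g * (3 * c) + (10 * g * e + 5 * g * (k * (2 * x) + c * x)) + 5 * c * x ≡
          x * g * (10 * k) + ((8 * g + 5) * (c * x) + 5 * g * (2 * e))
        eq = solve-∀
      local : ∀ v → C₁ v ≡ true → x * y ≤ 4 * r * e (X₁ ∩ˢ adj v) (Y ∩ˢ adj v)
      local v p = begin
        x * y ≤⟨ *-mono-≤ x≤ y≤ ⟩
        2 * card (X₁ ∩ˢ adj v) * (2 * card (Y ∩ˢ adj v)) ≡⟨ eq₁ (card (X₁ ∩ˢ adj v)) (card (Y ∩ˢ adj v)) ⟩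
        4 * (card (X₁ ∩ˢ adj v) * card (Y ∩ˢ adj v)) ≤⟨ *-monoʳ-≤ 4 (reg (X₁ ∩ˢ adj v) (Y ∩ˢ adj v)
                                                          (λ u q → X₁⊆X u (∧-elimˡ q)) (λ u → ∧-elimˡ) Xs Ys) ⟩
        4 * (r * e (X₁ ∩ˢ adj v) (Y ∩ˢ adj v)) ≡⟨ sym (*-assoc 4 r _) ⟩
        4 * r * e (X₁ ∩ˢ adj v) (Y ∩ˢ adj v) ∎
        where
        open ≤-Reasoning
        eq₁ : ∀ a b → 2 * a * (2 * b) ≡ 4 * (a * b)
        eq₁ = solve-∀
        eq₂ : ∀ μ a → μ * (2 * a) ≡ 2 * μ * a
        eq₂ = solve-∀
        x≤ : x ≤ 2 * card (X₁ ∩ˢ adj v)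
        x≤ = subst (λ k → x ≤ 2 * k) (N-card X₁ v) (level-≥ {A = C} {x} {λ v → 2 * N X₁ v} v p)
        y≤ : y ≤ 2 * card (Y ∩ˢ adj v)
        y≤ = subst (λ k → y ≤ 2 * k) (N-card Y v) (degY v (C⊆D v (∧-elimˡ p)))
        Xs : card X ≤ s * card (X₁ ∩ˢ adj v)
        Xs = ≤-trans X≤μX₁ (≤-trans (*-monoʳ-≤ μ x≤) (≤-trans (≤-reflexive (eq₂ μ _)) (*-monoˡ-≤ _ 2μ≤s)))
        Ys : y ≤ s * card (Y ∩ˢ adj v)
        Ys = ≤-trans y≤ (*-monoˡ-≤ _ (≤-trans (*-monoʳ-≤ 2 1≤μ) 2μ≤s))
      triangles : y * (c * x) ≤ c₀ * tri Y C X₁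
      triangles = begin
        y * (c * x) ≤⟨ m≤m+n _ _ ⟩
        y * (c * x) + 2 * (y * (c * x)) ≡⟨ eq₁ y c x ⟩
        3 * c * (x * y) ≤⟨ *-monoˡ-≤ (x * y) 3c≤10C₁ ⟩
        10 * card C₁ * (x * y) ≡⟨ *-assoc 10 (card C₁) _ ⟩
        10 * (card C₁ * (x * y)) ≤⟨ *-monoʳ-≤ 10 (sumOver-≥ C₁ _ _ local) ⟩
        10 * sumOver C₁ (λ v → 4 * r * e (X₁ ∩ˢ adj v) (Y ∩ˢ adj v)) ≡⟨ cong (10 *_) (sumOver-*ˡ C₁ (4 * r) _) ⟩
        10 * (4 * r * sumOver C₁ (λ v → e (X₁ ∩ˢ adj v) (Y ∩ˢ adj v))) ≤⟨ *-monoʳ-≤ 10 (*-monoʳ-≤ (4 * r) (sumOver-⊆ {A = C₁} {C} _ (λ v → ∧-elimˡ))) ⟩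
        10 * (4 * r * sumOver C (λ v → e (X₁ ∩ˢ adj v) (Y ∩ˢ adj v))) ≡⟨ eq₂ r _ ⟩
        c₀ * sumOver C (λ v → e (X₁ ∩ˢ adj v) (Y ∩ˢ adj v)) ≡⟨ cong (c₀ *_) (trans (sym (tri-first C X₁ Y)) (tri-rotate C X₁ Y)) ⟩
        c₀ * tri Y C X₁ ∎
        where
        open ≤-Reasoning
        eq₁ : ∀ y c x → y * (c * x) + 2 * (y * (c * x)) ≡ 3 * c * (x * y)
        eq₁ = solve-∀
        eq₂ : ∀ r z → 10 * (4 * r * z) ≡ 40 * r * z
        eq₂ = solve-∀
      finish : ∀ t₁ t₂ t₃ → let T = t₁ ∷ t₂ ∷ t₃ ∷ [] in Clique T → T ⊑ Y →
        c * x ≤ m * e (C ∩ˢ common T) (X₁ ∩ˢ common T) → ⊥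
      finish t₁ t₂ t₃ clT _ le = five₁ E (≤*-trans n (K * μ * m) a (5 * g) (card E)
          (≤*-trans n (K * μ) c m a bigC c≤ma) a≤5gE) first-K₅
        where
        T : List (Fin n)
        T = t₁ ∷ t₂ ∷ t₃ ∷ []
        A = C ∩ˢ common T
        B = X₁ ∩ˢ common T
        a = card A
        b = card B
        A⊆C : A ⊆ˢ C
        A⊆C v = ∧-elimˡ
        B⊆X₁ : B ⊆ˢ X₁
        B⊆X₁ v = ∧-elimˡ
        c≤ma : c ≤ m * a
        c≤ma = cancel-dim c a x m (pos-of (K * μ) x 0<n bigX₁)
          (≤-trans le (*-monoʳ-≤ m (≤-trans (e≤ A B) (*-monoʳ-≤ a (card-mono B⊆X₁)))))
        x≤mb : x ≤ m * b
        x≤mb = cancel-dim x b c m (pos-of (K * μ) c 0<n bigC)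
          (≤-trans (≤-reflexive (*-comm x c)) (≤-trans le (*-monoʳ-≤ m (≤-trans (e≤ A B)
            (≤-trans (*-monoˡ-≤ b (card-mono A⊆C)) (≤-reflexive (*-comm c b)))))))
        bigB : n ≤ K * μ * m * b
        bigB = ≤*-trans n (K * μ) x m b bigX₁ x≤mb
        0<b : 0 < b
        0<b = pos-of (K * μ * m) b 0<n bigB
        -- Regularity lowers `4/5 + 1/(2g)` by `1/(10g)` to `4/5 + 2/(5g)`.
        denseAB : (8 * g + 4) * (a * b) ≤ 10 * g * e A B
        denseAB = cancelˡ-≤ h 1≤h (lin (h * ((8 * g + 4) * (a * b))) (h * (10 * g * e A B)) 0
          (regCX A B A⊆C B⊆X₁ c≤ma x≤mb) (eq g h (a * b) (e A B)))
          where
          eq : ∀ g h z e → h * ((8 * g + 4) * z) + (10 * g * h * e + h * z) + 0 ≡ h * (10 * g * e) + (8 * g + 5) * h * z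
          eq = solve-∀
        -- Half of the surplus `2/(5g)` goes into the threshold `4/5 + 1/(5g)`; the other half makes
        -- `E` a `1/(5g)` share of `A`.
        E = level A ((4 * g + 1) * b) (λ v → 5 * g * N B v)
        a≤5gE : a ≤ 5 * g * card E
        a≤5gE = cancelˡ-≤ (2 * b) (1≤m*n {2} z<s 0<b)
          (lin (2 * b * a) (2 * b * (5 * g * card E)) 0
            (+-mono-≤ denseAB (*-monoʳ-≤ 2 (subst (_≤ card E * (5 * g * b) + a * ((4 * g + 1) * b)) (sumOver-*ˡ A (5 * g) (N B))
              (markov A (λ v → 5 * g * N B v) ((4 * g + 1) * b) (5 * g * b) (λ v _ → *-monoʳ-≤ (5 * g) (N≤card B v))))))
            (eq g a b (card E) (e A B)))
          where
          eq : ∀ g a b k e → 2 * b * a + (10 * g * e + 2 * (k * (5 * g * b) + a * ((4 * g + 1) * b))) + 0 ≡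
            2 * b * (5 * g * k) + ((8 * g + 4) * (a * b) + 2 * (5 * g * e))
          eq = solve-∀
        first-K₅ : ∀ l → length l ≡ 5 → Clique l → l ⊑ E → ⊥
        first-K₅ l |l| cl l⊑E = five₂ (B ∩ˢ common l) (≤*-trans n (K * μ * m) b g (card (B ∩ˢ common l)) bigB b≤gk) second-K₅
          where
          k = card (B ∩ˢ common l)
          -- Five vertices of `E` each miss at most `1/5 - 1/(5g)` of `B`, so a `1/g` share of `B`
          -- is adjacent to all of them.
          b≤gk : b ≤ g * k
          b≤gk = cancelˡ-≤ 5 z<s (lin (5 * b) (5 * (g * k)) 0
            (+-mono-≤ degs (*-monoʳ-≤ (5 * g) (subst (λ j → ∑ l (N B) + b ≤ j * b + k) |l| (∑N≤common B l))))
            (eq g b k (∑ l (N B))))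
            where
            eq : ∀ g b k S → 5 * b + (5 * g * S + 5 * g * (5 * b + k)) + 0 ≡ 5 * (g * k) + (5 * ((4 * g + 1) * b) + 5 * g * (S + b))
            eq = solve-∀
            degs : 5 * ((4 * g + 1) * b) ≤ 5 * g * ∑ l (N B)
            degs = subst (λ j → j * ((4 * g + 1) * b) ≤ 5 * g * ∑ l (N B)) |l|
              (subst (length l * ((4 * g + 1) * b) ≤_) (∑-*ˡ l (5 * g) (N B))
                (∑≥ l (λ v → 5 * g * N B v) ((4 * g + 1) * b) (All.map (λ {v} → level-≥ {A = A} {(4 * g + 1) * b} {λ v → 5 * g * N B v} v) l⊑E)))
          second-K₅ : ∀ l′ → length l′ ≡ 5 → Clique l′ → l′ ⊑ (B ∩ˢ common l) → ⊥
          second-K₅ l′ |l′| cl′ l′⊑ = no-K₁₃ (T ++ (l ++ l′))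
            (cong (3 +_) (trans (Data.List.Properties.length-++ l) (cong₂ _+_ |l| |l′|)))
            (Clique-++ clT (Clique-++ cl cl′ (⊑-mono (λ v → ∧-elimʳ {B v}) l′⊑))
              (All.++⁺ (⊑-mono (λ v p → ∧-elimʳ {C v} (∧-elimˡ p)) l⊑E) (⊑-mono (λ v p → ∧-elimʳ {X₁ v} (∧-elimˡ p)) l′⊑)))

-- Heavy pairs of densities and the hierarchy of constants

μ₊ : ℕ → ℕ → ℕ
μ₊ s r = shrink s (suc (2 * (3 * s * (3 * s)) * r))

1≤μ₊ : ∀ s r → 1 ≤ s → 1 ≤ μ₊ s r
1≤μ₊ s r 1≤s = 1≤m^n (suc (2 * (3 * s * (3 * s)) * r)) (1≤m*n {3} z<s 1≤s)

pigeonhole : ∀ {n} (D : VSet {n}) (Ss : List (VSet {n})) → 0 < length Ss →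
  (∀ v → D v ≡ true → Any (λ S → S v ≡ true) Ss) →
  All (λ S → card D ≤ length Ss * card S → ⊥) Ss → ⊥
pigeonhole {n} D Ss nonnil cover small = <⇒≱ (strict (length Ss) Ss small nonnil) (*-monoʳ-≤ (length Ss) D≤∑)
  where
  strict : ∀ k (Ts : List (VSet {n})) → All (λ S → card D ≤ k * card S → ⊥) Ts → 0 < length Ts → k * ∑ Ts card < length Ts * card D
  strict k (S ∷ []) (p ∷ []) _ = ≤-trans (s≤s (≤-reflexive (cong (k *_) (+-identityʳ (card S)))))
    (≤-trans (≰⇒> p) (≤-reflexive (sym (+-identityʳ (card D)))))
  strict k (S ∷ S′ ∷ Ts) (p ∷ ps) _ = subst (_< length (S ∷ S′ ∷ Ts) * card D) (sym (*-distribˡ-+ k (card S) _))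
    (+-mono-≤-< (<⇒≤ (≰⇒> p)) (strict k (S′ ∷ Ts) ps z<s))
  hit : ∀ v Ts → Any (λ S → S v ≡ true) Ts → 1 ≤ ∑ Ts (λ S → 𝟙 (S v))
  hit v (S ∷ Ts) (here p) = ≤-trans (≤-reflexive (sym (cong 𝟙 p))) (m≤m+n _ _)
  hit v (S ∷ Ts) (there q) = ≤-trans (hit v Ts q) (m≤n+m _ _)
  D≤∑ : card D ≤ ∑ Ss card
  D≤∑ = ≤-trans (∑-mono (allFin n) pointwise) (≤-reflexive (∑-swap (allFin n) Ss (λ v S → 𝟙 (S v))))
    where
    pointwise : ∀ v → 𝟙 (D v) ≤ ∑ Ss (λ S → 𝟙 (S v))
    pointwise v with D v in eq
    ... | false = z≤n
    ... | true = hit v Ss (cover v eq)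

-- Densities β/y and ζ/z, cleared of denominators: both are at least 1/2 and one is at least 4/5 + 1/2g.
TwoHeavy : (g y z β ζ : ℕ) → Set
TwoHeavy g y z β ζ = (y ≤ 2 * β × z ≤ 2 * ζ) × ((8 * g + 5) * y ≤ 10 * g * β ⊎ (8 * g + 5) * z ≤ 10 * g * ζ)

-- The hypothesis says `β/y + ζ/z ≥ 8/5 + 1/g`. Neither term exceeds 1, so each is above 1/2, and
-- the larger one is at least half the sum.
two-heavy : ∀ g y z β ζ → 1 ≤ g → 0 < y → 0 < z → β ≤ y → ζ ≤ z →
  (8 * g + 5) * (y * z) ≤ 5 * g * (β * z + ζ * y) → TwoHeavy g y z β ζ
two-heavy g y z β ζ 1≤g 0<y 0<z β≤y ζ≤z heavy = (half y z β ζ 0<z ζ≤z heavy ,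
  half z y ζ β 0<y β≤y (subst₂ _≤_ (cong ((8 * g + 5) *_) (*-comm y z)) (cong (5 * g *_) (+-comm (β * z) (ζ * y))) heavy)) , one
  where
  half : ∀ y z β ζ → 0 < z → ζ ≤ z → (8 * g + 5) * (y * z) ≤ 5 * g * (β * z + ζ * y) → y ≤ 2 * β
  half y z β ζ 0<z ζ≤z heavy = cancelˡ-≤ (5 * g * z) (1≤m*n (1≤m*n {5} z<s 1≤g) 0<z)
    (lin (5 * g * z * y) (5 * g * z * (2 * β)) (g * (y * z) + 10 * (y * z))
      (+-mono-≤ (*-monoʳ-≤ 2 heavy) (*-monoʳ-≤ (10 * g * y) ζ≤z)) (eq g y z β ζ))
    where
    eq : ∀ g y z β ζ → 5 * g * z * y + (2 * (5 * g * (β * z + ζ * y)) + 10 * g * y * z) + (g * (y * z) + 10 * (y * z)) ≡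
      5 * g * z * (2 * β) + (2 * ((8 * g + 5) * (y * z)) + 10 * g * y * ζ)
    eq = solve-∀
  one : (8 * g + 5) * y ≤ 10 * g * β ⊎ (8 * g + 5) * z ≤ 10 * g * ζ
  one with (8 * g + 5) * y ≤? 10 * g * β | (8 * g + 5) * z ≤? 10 * g * ζ
  ... | yes p | _ = inj₁ p
  ... | no _ | yes q = inj₂ q
  ... | no ¬p | no ¬q = ⊥-elim (<⇒≱ (+-mono-<-≤ (*-monoˡ-< z {{>-nonZero 0<z}} (≰⇒> ¬p)) (*-monoˡ-≤ y (<⇒≤ (≰⇒> ¬q))))
    (lin _ _ 0 (*-monoʳ-≤ 2 heavy) (eq g y z β ζ)))
    where
    eq : ∀ g y z β ζ → (8 * g + 5) * y * z + (8 * g + 5) * z * y + 2 * (5 * g * (β * z + ζ * y)) + 0 ≡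
      10 * g * β * z + 10 * g * ζ * y + 2 * ((8 * g + 5) * (y * z))
    eq = solve-∀

-- Three densities with sum at least `8/5 + 2/g`, one of them below `1/g`, leave `8/5 + 1/g` for the
-- other two, the input of `two-heavy`.
drop-light : ∀ g x y z α β ζ → 0 < x → g * α < x →
  (8 * g + 10) * (x * (y * z)) ≤ 5 * g * (α * (y * z) + (β * (x * z) + ζ * (x * y))) →
  (8 * g + 5) * (y * z) ≤ 5 * g * (β * z + ζ * y)
drop-light g x y z α β ζ 0<x light heavy = cancelˡ-≤ x 0<x (lin _ _ 0 (+-mono-≤ heavy (*-monoʳ-≤ (5 * (y * z)) (<⇒≤ light))) (eq g x y z α β ζ))
  where
  eq : ∀ g x y z α β ζ → x * ((8 * g + 5) * (y * z)) + (5 * g * (α * (y * z) + (β * (x * z) + ζ * (x * y))) + 5 * (y * z) * x) + 0 ≡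
    x * (5 * g * (β * z + ζ * y)) + ((8 * g + 10) * (x * (y * z)) + 5 * (y * z) * (g * α))
  eq = solve-∀

-- Opaque copies, since the iterated exponentials must not be unfolded.
opaque
  μ⁺ : ℕ → ℕ → ℕ
  μ⁺ = μ₊

  1≤μ⁺ : ∀ s r → 1 ≤ s → 1 ≤ μ⁺ s r
  1≤μ⁺ = 1≤μ₊

  τ : ℕ → ℕ → ℕ
  τ g r = g * (g * g) * (8 * (r * (r * r)))

-- `P₀/Q₀ = 8/15 + 1/g` is the minimum degree. `s` has to serve `dense-pair` (`2μᴰ`) and
-- `many-triangles` with `r = 60` (`120g`). The pair regularised second later loses `μ₃` on one
-- side, so it starts with `s₂ = s μ₃`; the first one loses `μ₂` and `μ₃` on its two sides, so it
-- starts with `s₁ = s μ₂ μ₃`.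
module Constants (g : ℕ) where
  opaque
    c₀ mᴰ μᴰ : ℕ
    c₀ = DenseCase.c₀ 60 g
    mᴰ = DenseCase.m 60 g
    μᴰ = DenseCase.μ 60 g
  P₀ = 8 * g + 15
  Q₀ = 15 * g
  opaque
    s : ℕ
    s = 2 * μᴰ + 120 * g

    2μᴰ≤s : 2 * μᴰ ≤ s
    2μᴰ≤s = m≤m+n (2 * μᴰ) (120 * g)

    120g≤s : 120 * g ≤ s
    120g≤s = m≤n+m (120 * g) (2 * μᴰ)
  μ₃ = μ⁺ s 30
  opaque
    s₂ : ℕ
    s₂ = s * μ₃

    sμ₃≤s₂ : s * μ₃ ≤ s₂
    sμ₃≤s₂ = ≤-refl
  μ₂ = μ⁺ s₂ 30
  opaque
    s₁ : ℕ
    s₁ = s * (μ₂ * μ₃)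

    sμ₂μ₃≤s₁ : s * (μ₂ * μ₃) ≤ s₁
    sμ₂μ₃≤s₁ = ≤-refl
  μ₁ = μ⁺ s₁ 2
  -- Denominators of sizes relative to `n`: `Q₀` for the set `A` of large minimum degree, 60 for `C`
  -- in `min-degree`, `3g` for `D` in `three-sets`, and 7 for the pigeonhole over seven classes.
  KX = Q₀ * μ₁ * μ₂
  KY = Q₀ * μ₁ * μ₃
  KZ = Q₀ * 60 * μ₂ * μ₃
  KD = Q₀ * (3 * g) * 7
  opaque
    K : ℕ
    K = KX + (KY + (KZ + KD))

    KX≤K : KX ≤ K
    KX≤K = m≤m+n KX (KY + (KZ + KD))

    KY≤K : KY ≤ K
    KY≤K = ≤-trans (m≤m+n KY (KZ + KD)) (m≤n+m (KY + (KZ + KD)) KX)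

    KZ≤K : KZ ≤ K
    KZ≤K = ≤-trans (m≤m+n KZ KD) (≤-trans (m≤n+m (KZ + KD) KY) (m≤n+m (KY + (KZ + KD)) KX))

    KD≤K : KD ≤ K
    KD≤K = ≤-trans (m≤n+m KD KZ) (≤-trans (m≤n+m (KZ + KD) KY) (m≤n+m (KY + (KZ + KD)) KX))
  c₁ = τ g 60
  c₂ = c₁ * M c₁
  c₃ = c₂ * M c₂

  -- Everything that `b` has to dominate. As `b ≤ n`, the list also provides the sizes needed by the
  -- regularisation steps.
  thresholds : List ℕ
  thresholds =
    P₀ ∷ Q₀ * (3 * s₁ * μ₁) ∷ Q₀ * 60 * (3 * s₂ * μ₂) ∷ Q₀ * μ₁ * (3 * s₂ * μ₂) ∷
    Q₀ * 60 * μ₂ * (3 * s * μ₃) ∷ Q₀ * μ₁ * (3 * s * μ₃) ∷ K * (3 * mᴰ * μᴰ) ∷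
    K ∷ c₀ ∷ K * μᴰ * mᴰ * (5 * g) ∷ K * μᴰ * mᴰ * g ∷
    c₁ ∷ K * c₂ ∷ c₂ ∷ K * c₂ * c₃ ∷ c₃ ∷ K * c₂ * c₃ * M c₃ ∷ []

-- Regular pairs of positive density and the triangles they contain

module Main {n : ℕ} (adj : Fin n → Fin n → Bool) (adj-sym : ∀ u v → adj u v ≡ adj v u)
  (0<n : 0 < n)
  (no-K₁₃ : ∀ l → length l ≡ 13 → AllPairs (λ u v → adj u v ≡ true) l → ⊥) where

  open Pairs adj adj-sym
  open Cliques adj adj-sym
  open Core adj adj-sym 0<n no-K₁₃

  PosReg-sym : ∀ {s r A B} → PosReg s r A B → PosReg s r B A
  PosReg-sym {r = r} reg B′ A′ p q b a = ≤-trans (≤-reflexive (*-comm (card B′) (card A′)))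
    (≤-trans (reg A′ B′ q p a b) (≤-reflexive (cong (r *_) (e-sym A′ B′))))

  PosReg-sub : ∀ {s s′ r r′ A B A₁ B₁} μ ν → s′ * μ ≤ s → s′ * ν ≤ s → r ≤ r′ → A₁ ⊆ˢ A → B₁ ⊆ˢ B →
    card A ≤ μ * card A₁ → card B ≤ ν * card B₁ → PosReg s r A B → PosReg s′ r′ A₁ B₁
  PosReg-sub {s} {s′} {r} {r′} {A} {B} {A₁} {B₁} μ ν s′μ s′ν r≤r′ A₁⊆A B₁⊆B rA rB reg A′ B′ p q a b =
    ≤-trans (reg A′ B′ (⊆-trans p A₁⊆A) (⊆-trans q B₁⊆B) (scale (card A) (card A₁) (card A′) μ s′μ rA a) (scale (card B) (card B₁) (card B′) ν s′ν rB b))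
      (*-monoˡ-≤ (e A′ B′) r≤r′)
    where
    scale : ∀ x y z μ → s′ * μ ≤ s → x ≤ μ * y → y ≤ s′ * z → x ≤ s * z
    scale x y z μ le p q = ≤-trans (≤-trans p (*-monoʳ-≤ μ q)) (≤-trans (≤-reflexive (eq μ s′ z)) (*-monoˡ-≤ z le))
      where
      eq : ∀ a b c → a * (b * c) ≡ b * a * c
      eq = solve-∀

  -- Density `1/r` is written as `2h/(2hr)`, so that the loss `h` merely halves it. The fuel
  -- `2hr + 1` explains the exponent in `μ₊`.
  positive : ∀ s r → 1 ≤ s → ∀ A B → 3 * s * μ₊ s r ≤ card A → 3 * s * μ₊ s r ≤ card B →
    card A * card B ≤ r * e A B →
    (∀ A₁ B₁ → A₁ ⊆ˢ A → B₁ ⊆ˢ B → card A ≤ μ₊ s r * card A₁ → card B ≤ μ₊ s r * card B₁ →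
      PosReg s (2 * r) A₁ B₁ → ⊥) → ⊥
  positive s r 1≤s A B bigA bigB dense cont =
    regularise s (2 * h) (2 * h * r) 1≤s (suc (2 * h * r)) (2 * h) ≤-refl (m≤n+m (suc (2 * h * r)) (2 * h)) A B bigA bigB
      (≤-trans (*-monoʳ-≤ (2 * h) dense) (≤-reflexive (sym (*-assoc (2 * h) r _))))
      λ A₁ B₁ p q a b _ reg → cont A₁ B₁ p q a b λ A′ B′ p′ q′ a′ b′ →
        cancelˡ-≤ h (1≤m*n (1≤m*n {3} z<s 1≤s) (1≤m*n {3} z<s 1≤s))
          (lin _ _ 0 (reg A′ B′ p′ q′ a′ b′) (eq h r (card A′ * card B′) (e A′ B′)))
    where
    h = 3 * s * (3 * s)
    eq : ∀ h r z e → h * z + (2 * h * r * e + h * z) + 0 ≡ h * (2 * r * e) + 2 * h * z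
    eq = solve-∀

  -- If the vertices with at most `card Y′ / 2r` neighbours were a `1/s` share of `X`, regularity
  -- would give them density `1/r`, twice what they have. By `4g ≤ s` a smaller share is at most a
  -- quarter of `X′`.
  few-poor : ∀ s r g → 4 * g ≤ s → 1 ≤ g → ∀ X Y X′ Y′ → PosReg s r X Y → X′ ⊆ˢ X → Y′ ⊆ˢ Y →
    0 < card X → 0 < card Y′ → card X ≤ g * card X′ → card Y ≤ s * card Y′ →
    4 * card (X′ ∖ level X′ (card Y′) (λ v → 2 * r * N Y′ v)) ≤ card X′
  few-poor s r g 4g≤s 1≤g X Y X′ Y′ reg X′⊆X Y′⊆Y 0<X 0<Y′ X≤gX′ Y≤sY′ with card X ≤? s * card (X′ ∖ level X′ (card Y′) (λ v → 2 * r * N Y′ v))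
  ... | yes large = ⊥-elim (<⇒≱ pos (lin _ 0 0 (+-mono-≤ (*-monoʳ-≤ 2 regular) sparse) (eq r (card bad * card Y′) (e bad Y′))))
    where
    bad = X′ ∖ level X′ (card Y′) (λ v → 2 * r * N Y′ v)
    regular : card bad * card Y′ ≤ r * e bad Y′
    regular = reg bad Y′ (λ v p → X′⊆X v (∧-elimˡ p)) Y′⊆Y large Y≤sY′
    poor : ∀ v → bad v ≡ true → 2 * r * N Y′ v ≤ card Y′
    poor v p with X′ v | card Y′ ≤ᵇ 2 * r * N Y′ v in eq
    ... | true | false = <⇒≤ (≤ᵇ-false (card Y′) _ eq)
    sparse : 2 * r * e bad Y′ ≤ card bad * card Y′
    sparse = subst (_≤ card bad * card Y′) (sumOver-*ˡ bad (2 * r) (N Y′)) (sumOver-≤ bad (λ v → 2 * r * N Y′ v) (card Y′) poor)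
    pos : 0 < card bad * card Y′
    pos = 1≤m*n (factor-pos s (card bad) (≤-trans 0<X large)) 0<Y′
    eq : ∀ r z e → z + (2 * (r * e) + z) + 0 ≡ 0 + (2 * z + 2 * r * e)
    eq = solve-∀
  ... | no small = cancelˡ-≤ g 1≤g (≤-trans (≤-reflexive (eq g _)) (≤-trans (*-monoˡ-≤ _ 4g≤s) (≤-trans (<⇒≤ (≰⇒> small)) X≤gX′)))
    where
    eq : ∀ g z → g * (4 * z) ≡ 4 * g * z
    eq = solve-∀

  -- At most two quarters of `X′` are poor towards `Y′` or `Z′`, so half of it is rich towards both.
  -- The factors are `g³` for the sizes of the subsets, 2 for that half, `4r²` for the two
  -- neighbourhoods and `r` for the density between them.
  many-triangles : ∀ s r g → 4 * g ≤ s → 2 * r * g ≤ s → 1 ≤ g → 1 ≤ r → ∀ X Y Z X′ Y′ Z′ →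
    PosReg s r X Y → PosReg s r X Z → PosReg s r Y Z → X′ ⊆ˢ X → Y′ ⊆ˢ Y → Z′ ⊆ˢ Z →
    0 < card X → 0 < card Y → 0 < card Z →
    card X ≤ g * card X′ → card Y ≤ g * card Y′ → card Z ≤ g * card Z′ →
    card X * (card Y * card Z) ≤ g * (g * g) * (8 * (r * (r * r))) * tri X′ Y′ Z′
  many-triangles s r g 4g≤s 2rg≤s 1≤g 1≤r X Y Z X′ Y′ Z′ regXY regXZ regYZ X′⊆X Y′⊆Y Z′⊆Z 0<X 0<Y 0<Z gX gY gZ = begin
    card X * (card Y * card Z) ≤⟨ *-mono-≤ gX (*-mono-≤ gY gZ) ⟩
    g * x * (g * y * (g * z)) ≡⟨ eq₁ g x y z ⟩
    g * (g * g) * (x * (y * z)) ≤⟨ *-monoʳ-≤ (g * (g * g)) (*-monoˡ-≤ (y * z) x≤2G) ⟩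
    g * (g * g) * (2 * card G * (y * z)) ≡⟨ eq₂ (g * (g * g)) (card G) (y * z) ⟩
    g * (g * g) * 2 * (card G * (y * z)) ≤⟨ *-monoʳ-≤ (g * (g * g) * 2) (sumOver-≥ G _ _ local) ⟩
    g * (g * g) * 2 * sumOver G (λ v → 4 * (r * (r * r)) * e (Y′ ∩ˢ adj v) (Z′ ∩ˢ adj v))
      ≡⟨ cong (g * (g * g) * 2 *_) (sumOver-*ˡ G (4 * (r * (r * r))) _) ⟩
    g * (g * g) * 2 * (4 * (r * (r * r)) * sumOver G (λ v → e (Y′ ∩ˢ adj v) (Z′ ∩ˢ adj v)))
      ≤⟨ *-monoʳ-≤ (g * (g * g) * 2) (*-monoʳ-≤ (4 * (r * (r * r))) (sumOver-⊆ {A = G} {X′} _ λ v p → ∧-elimˡ (∧-elimˡ p))) ⟩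
    g * (g * g) * 2 * (4 * (r * (r * r)) * sumOver X′ (λ v → e (Y′ ∩ˢ adj v) (Z′ ∩ˢ adj v)))
      ≡⟨ eq₃ (g * (g * g)) (r * (r * r)) _ ⟩
    g * (g * g) * (8 * (r * (r * r))) * sumOver X′ (λ v → e (Y′ ∩ˢ adj v) (Z′ ∩ˢ adj v))
      ≡⟨ cong (g * (g * g) * (8 * (r * (r * r))) *_) (sym (tri-first X′ Y′ Z′)) ⟩
    g * (g * g) * (8 * (r * (r * r))) * tri X′ Y′ Z′ ∎
    where
    open ≤-Reasoning
    x = card X′
    y = card Y′
    z = card Z′
    LY = level X′ y (λ v → 2 * r * N Y′ v)
    LZ = level X′ z (λ v → 2 * r * N Z′ v)
    G = LY ∩ˢ LZ
    g≤s : g ≤ s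
    g≤s = ≤-trans (m≤m+n g _) 4g≤s
    eq₁ : ∀ g x y z → g * x * (g * y * (g * z)) ≡ g * (g * g) * (x * (y * z))
    eq₁ = solve-∀
    eq₂ : ∀ a k w → a * (2 * k * w) ≡ a * 2 * (k * w)
    eq₂ = solve-∀
    eq₃ : ∀ a b w → a * 2 * (4 * b * w) ≡ a * (8 * b) * w
    eq₃ = solve-∀
    fewY : 4 * card (X′ ∖ LY) ≤ x
    fewY = few-poor s r g 4g≤s 1≤g X Y X′ Y′ regXY X′⊆X Y′⊆Y 0<X (factor-pos g y (≤-trans 0<Y gY)) gX (≤-trans gY (*-monoˡ-≤ y g≤s))
    fewZ : 4 * card (X′ ∖ LZ) ≤ x
    fewZ = few-poor s r g 4g≤s 1≤g X Z X′ Z′ regXZ X′⊆X Z′⊆Z 0<X (factor-pos g z (≤-trans 0<Z gZ)) gX (≤-trans gZ (*-monoˡ-≤ z g≤s))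
    x≤ : x ≤ card G + (card (X′ ∖ LY) + card (X′ ∖ LZ))
    x≤ = ≤-trans (∑-mono V λ v → pointwise (X′ v) (y ≤ᵇ 2 * r * N Y′ v) (z ≤ᵇ 2 * r * N Z′ v))
      (≤-reflexive (trans (∑-+ V _ _) (cong (card G +_) (∑-+ V _ _))))
      where
      pointwise : ∀ a b c → 𝟙 a ≤ 𝟙 ((a ∧ b) ∧ (a ∧ c)) + (𝟙 (a ∧ not (a ∧ b)) + 𝟙 (a ∧ not (a ∧ c)))
      pointwise false b c = z≤n
      pointwise true true true = ≤-refl
      pointwise true true false = ≤-refl
      pointwise true false c = s≤s z≤n
    x≤2G : x ≤ 2 * card G
    x≤2G = cancelˡ-≤ 2 z<s (lin (2 * x) (2 * (2 * card G)) 0 (+-mono-≤ (*-monoʳ-≤ 4 x≤) (+-mono-≤ fewY fewZ))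
      (eq x (card G) (card (X′ ∖ LY)) (card (X′ ∖ LZ))))
      where
      eq : ∀ x k a b → 2 * x + (4 * (k + (a + b)) + (x + x)) + 0 ≡ 2 * (2 * k) + (4 * x + (4 * a + 4 * b))
      eq = solve-∀
    local : ∀ v → G v ≡ true → y * z ≤ 4 * (r * (r * r)) * e (Y′ ∩ˢ adj v) (Z′ ∩ˢ adj v)
    local v p = begin
      y * z ≤⟨ *-mono-≤ y≤ z≤ ⟩
      2 * r * card Yv * (2 * r * card Zv) ≡⟨ eq₄ r (card Yv) (card Zv) ⟩
      4 * (r * r) * (card Yv * card Zv) ≤⟨ *-monoʳ-≤ (4 * (r * r)) (regYZ Yv Zv (λ u q → Y′⊆Y u (∧-elimˡ q)) (λ u q → Z′⊆Z u (∧-elimˡ q))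
                                                     (big (card Y) y (card Yv) gY y≤) (big (card Z) z (card Zv) gZ z≤)) ⟩
      4 * (r * r) * (r * e Yv Zv) ≡⟨ eq₅ r (e Yv Zv) ⟩
      4 * (r * (r * r)) * e Yv Zv ∎
      where
      Yv = Y′ ∩ˢ adj v
      Zv = Z′ ∩ˢ adj v
      y≤ : y ≤ 2 * r * card Yv
      y≤ = subst (λ k → y ≤ 2 * r * k) (N-card Y′ v) (level-≥ {A = X′} {y} {λ v → 2 * r * N Y′ v} v (∧-elimˡ p))
      z≤ : z ≤ 2 * r * card Zv
      z≤ = subst (λ k → z ≤ 2 * r * k) (N-card Z′ v) (level-≥ {A = X′} {z} {λ v → 2 * r * N Z′ v} v (∧-elimʳ {LY v} p))
      eq₄ : ∀ r a b → 2 * r * a * (2 * r * b) ≡ 4 * (r * r) * (a * b)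
      eq₄ = solve-∀
      eq₅ : ∀ r e → 4 * (r * r) * (r * e) ≡ 4 * (r * (r * r)) * e
      eq₅ = solve-∀
      big : ∀ b y w → b ≤ g * y → y ≤ 2 * r * w → b ≤ s * w
      big b y w p q = ≤-trans p (≤-trans (*-monoʳ-≤ g q) (≤-trans (≤-reflexive (eq g r w)) (*-monoˡ-≤ w 2rg≤s)))
        where
        eq : ∀ g r w → g * (2 * r * w) ≡ 2 * r * g * w
        eq = solve-∀

  opaque
    unfolding μ⁺ τ Constants.c₀

    positive⁺ : ∀ s r → 1 ≤ s → ∀ A B → 3 * s * μ⁺ s r ≤ card A → 3 * s * μ⁺ s r ≤ card B →
      card A * card B ≤ r * e A B →
      (∀ A₁ B₁ → A₁ ⊆ˢ A → B₁ ⊆ˢ B → card A ≤ μ⁺ s r * card A₁ → card B ≤ μ⁺ s r * card B₁ →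
        PosReg s (2 * r) A₁ B₁ → ⊥) → ⊥
    positive⁺ = positive

    many-triangles⁺ : ∀ s r g → 4 * g ≤ s → 2 * r * g ≤ s → 1 ≤ g → 1 ≤ r → ∀ X Y Z X′ Y′ Z′ →
      PosReg s r X Y → PosReg s r X Z → PosReg s r Y Z → X′ ⊆ˢ X → Y′ ⊆ˢ Y → Z′ ⊆ˢ Z →
      0 < card X → 0 < card Y → 0 < card Z →
      card X ≤ g * card X′ → card Y ≤ g * card Y′ → card Z ≤ g * card Z′ →
      card X * (card Y * card Z) ≤ τ g r * tri X′ Y′ Z′
    many-triangles⁺ = many-triangles

    dense-pair⁺ : ∀ K g s → 1 ≤ g → let open Constants g using (c₀; mᴰ; μᴰ) in
      2 * μᴰ ≤ s → K * (3 * mᴰ * μᴰ) ≤ n → Choice K c₀ → FiveIn (K * μᴰ * mᴰ * (5 * g)) → FiveIn (K * μᴰ * mᴰ * g) →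
      ∀ D X Y → n ≤ K * card D → n ≤ K * card X → n ≤ K * card Y → PosReg s 60 X Y →
      (∀ v → D v ≡ true → (8 * g + 5) * card X ≤ 10 * g * N X v) →
      (∀ v → D v ≡ true → card Y ≤ 2 * N Y v) → ⊥
    dense-pair⁺ K g s 1≤g = dense-pair K g 60 s 1≤g z<s

-- Polynomial identities behind the linear certificates

private
  degree-sum-id : ∀ p m x → p * (m * x) ≡ x * (p * m)
  degree-sum-id = solve-∀

  three-max-id : ∀ g x y z → 5 * g * (y * z * x + (x * z * y + x * y * z)) ≡ 15 * g * (x * (y * z))
  three-max-id = solve-∀

  three-markov-id : ∀ g x y z m d p q r → 15 * (x * (y * z)) * m + (y * z * (15 * g * p) + (x * z * (15 * g * q) + (x * y * (15 * g * r) +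
    3 * (d * (15 * g * (x * (y * z))) + m * ((8 * g + 10) * (x * (y * z))))))) + 0 ≡
    15 * (x * (y * z)) * (3 * g * d) + (y * z * ((8 * g + 15) * (m * x)) + (x * z * ((8 * g + 15) * (m * y)) +
    (x * y * ((8 * g + 15) * (m * z)) + 3 * (5 * g * (y * z * p + (x * z * q + x * y * r))))))
  three-markov-id = solve-∀

  profile-x-id : ∀ g x y z a b c → 5 * g * (y * z * a + (x * z * b + x * y * c)) ≡ 5 * g * (a * (y * z) + (b * (x * z) + c * (x * y)))
  profile-x-id = solve-∀

  swap-y-id : ∀ g x y z → (8 * g + 10) * (y * (x * z)) ≡ (8 * g + 10) * (x * (y * z))
  swap-y-id = solve-∀

  profile-y-id : ∀ g x y z a b c → 5 * g * (y * z * a + (x * z * b + x * y * c)) ≡ 5 * g * (b * (x * z) + (a * (y * z) + c * (y * x)))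
  profile-y-id = solve-∀

  swap-z-id : ∀ g x y z → (8 * g + 10) * (z * (x * y)) ≡ (8 * g + 10) * (x * (y * z))
  swap-z-id = solve-∀

  profile-z-id : ∀ g x y z a b c → 5 * g * (y * z * a + (x * z * b + x * y * c)) ≡ 5 * g * (c * (x * y) + (a * (z * y) + b * (z * x)))
  profile-z-id = solve-∀

  half-dense-id : ∀ g z e → 15 * g * z + 2 * (15 * g * e) + (g * z + 30 * z) ≡ 15 * g * (2 * e) + 2 * ((8 * g + 15) * z)
  half-dense-id = solve-∀

  two-max-id : ∀ x y → 30 * (y * x + x * y) ≡ 60 * (x * y)
  two-max-id = solve-∀

  two-markov-id : ∀ g x y m c p q → g * (x * y) * m + (2 * y * (15 * g * p) + (2 * x * (15 * g * q) +
    g * (c * (60 * (x * y)) + m * (31 * (x * y))))) + 60 * (m * (x * y)) ≡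
    g * (x * y) * (60 * c) + (2 * y * ((8 * g + 15) * (m * x)) + (2 * x * ((8 * g + 15) * (m * y)) + g * (30 * (y * p + x * q))))
  two-markov-id = solve-∀

  half-id : ∀ x y p q → y * x + (30 * (y * p + x * q) + 30 * x * y) + 0 ≡ y * (30 * p) + (31 * (x * y) + 30 * x * q)
  half-id = solve-∀

  big-id : ∀ P Q m n e → n * n + (Q * e + P * n + (Q * (m * m) + (n * n + n * n))) + (12 * (n * n) + P * (m * m) + P * m) ≡
    0 + (P * (m * m) + 15 * (n * n) + P * m + (Q * e + (P * n + Q * m * m)))
  big-id = solve-∀

  remove-id : ∀ x y → x + (x + y) ≡ y + 2 * x
  remove-id = solve-∀

  peel-id : ∀ P Q k n e f d → P * (k * k) + 15 * (n * n) + P * k + (Q * e + P * n + (Q * (f + 2 * d) + 2 * (P * (1 + k)))) + 0 ≡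
    Q * f + P * n + (P * ((1 + k) * (1 + k)) + 15 * (n * n) + P * (1 + k) + (Q * e + 2 * (Q * d)))
  peel-id = solve-∀

private
  full-id : ∀ P n E → P * (n * n) + 15 * (n * n) + P * n + E + 0 ≡ E + P * n + (P + 15) * (n * n)
  full-id = solve-∀

-- How one vertex sees three sets

Heavy : (g x α y β : ℕ) → Set
Heavy g x α y β = (8 * g + 5) * x ≤ 10 * g * α × y ≤ 2 * β

-- In a two-letter constructor the first letter names the set seen with density at least
-- `4/5 + 1/(2g)`, the second the one seen with density at least 1/2.
data Profile (g x y z α β ζ : ℕ) : Set where
  spreads : x ≤ g * α → y ≤ g * β → z ≤ g * ζ → Profile g x y z α β ζ
  xy : Heavy g x α y β → Profile g x y z α β ζ
  yx : Heavy g y β x α → Profile g x y z α β ζ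
  xz : Heavy g x α z ζ → Profile g x y z α β ζ
  zx : Heavy g z ζ x α → Profile g x y z α β ζ
  yz : Heavy g y β z ζ → Profile g x y z α β ζ
  zy : Heavy g z ζ y β → Profile g x y z α β ζ

classify : ∀ g x y z α β ζ → 1 ≤ g → 0 < x → 0 < y → 0 < z → α ≤ x → β ≤ y → ζ ≤ z →
  (8 * g + 10) * (x * (y * z)) ≤ 5 * g * (y * z * α + (x * z * β + x * y * ζ)) → Profile g x y z α β ζ
classify g x y z α β ζ 1≤g 0<x 0<y 0<z α≤x β≤y ζ≤z dense with x ≤? g * α | y ≤? g * β | z ≤? g * ζ
... | yes p | yes q | yes r = spreads p q r
... | no ¬p | _ | _ = choose (two-heavy g y z β ζ 1≤g 0<y 0<z β≤y ζ≤z
        (drop-light g x y z α β ζ 0<x (≰⇒> ¬p) (≤-trans dense (≤-reflexive (profile-x-id g x y z α β ζ)))))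
  where
  choose : TwoHeavy g y z β ζ → Profile g x y z α β ζ
  choose ((hy , hz) , inj₁ h) = yz (h , hz)
  choose ((hy , hz) , inj₂ h) = zy (h , hy)
... | yes _ | no ¬q | _ = choose (two-heavy g x z α ζ 1≤g 0<x 0<z α≤x ζ≤z
        (drop-light g y x z β α ζ 0<y (≰⇒> ¬q) (≤-trans (≤-reflexive (swap-y-id g x y z)) (≤-trans dense (≤-reflexive (profile-y-id g x y z α β ζ))))))
  where
  choose : TwoHeavy g x z α ζ → Profile g x y z α β ζ
  choose ((hx , hz) , inj₁ h) = xz (h , hz)
  choose ((hx , hz) , inj₂ h) = zx (h , hx)
... | yes _ | yes _ | no ¬r = choose (two-heavy g x y α β 1≤g 0<x 0<y α≤x β≤y
        (drop-light g z x y ζ α β 0<z (≰⇒> ¬r) (≤-trans (≤-reflexive (swap-z-id g x y z)) (≤-trans dense (≤-reflexive (profile-z-id g x y z α β ζ))))))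
  where
  choose : TwoHeavy g x y α β → Profile g x y z α β ζ
  choose ((hx , hy) , inj₁ h) = xy (h , hy)
  choose ((hx , hy) , inj₂ h) = yx (h , hx)

-- Minimum degree, three regular sets and the edge bound

module MinDegree (g : ℕ) (1≤g : 1 ≤ g) {n : ℕ} (adj : Fin n → Fin n → Bool) (adj-sym : ∀ u v → adj u v ≡ adj v u)
  (0<n : 0 < n)
  (no-K₁₃ : ∀ l → length l ≡ 13 → AllPairs (λ u v → adj u v ≡ true) l → ⊥)
  (b : ℕ) (b≤n : b ≤ n)
  (five : ∀ k → k ≤ b → Cliques.FiveIn adj adj-sym k)
  (choice : ∀ k c → k ≤ b → c ≤ b → Cliques.Choice adj adj-sym k c) where

  open Pairs adj adj-sym
  open Cliques adj adj-sym
  open Core adj adj-sym 0<n no-K₁₃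
  open Main adj adj-sym 0<n no-K₁₃
  open Constants g

  widen : ∀ {k k′ x} → k ≤ k′ → n ≤ k * x → n ≤ k′ * x
  widen {x = x} le p = ≤-trans p (*-monoˡ-≤ x le)

  module _ (A : VSet {n}) (bigA : n ≤ Q₀ * card A) (degA : ∀ v → A v ≡ true → P₀ * card A ≤ Q₀ * N A v) where

    m : ℕ
    m = card A

    1≤s : 1 ≤ s
    1≤s = ≤-trans (1≤m*n {120} z<s 1≤g) 120g≤s

    enough : ∀ k t x → k * t ≤ b → n ≤ k * x → t ≤ x
    enough zero t x p q = ⊥-elim (<⇒≱ 0<n q)
    enough (suc k) t x p q = *-cancelˡ-≤ (suc k) (≤-trans p (≤-trans b≤n q))

    degree-sum : ∀ X → X ⊆ˢ A → P₀ * (m * card X) ≤ Q₀ * sumOver A (N X)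
    degree-sum X X⊆A = begin
      P₀ * (m * card X) ≡⟨ degree-sum-id P₀ m (card X) ⟩
      card X * (P₀ * m) ≤⟨ sumOver-≥ X _ _ (λ v p → degA v (X⊆A v p)) ⟩
      sumOver X (λ v → Q₀ * N A v) ≡⟨ sumOver-*ˡ X Q₀ (N A) ⟩
      Q₀ * e X A ≡⟨ cong (Q₀ *_) (e-sym X A) ⟩
      Q₀ * e A X ∎
      where
      open ≤-Reasoning

    three-sets : K * (3 * mᴰ * μᴰ) ≤ b → K ≤ b → c₀ ≤ b → K * μᴰ * mᴰ * (5 * g) ≤ b → K * μᴰ * mᴰ * g ≤ b →
      c₁ ≤ b → K * c₂ ≤ b → c₂ ≤ b → K * c₂ * c₃ ≤ b → c₃ ≤ b → K * c₂ * c₃ * M c₃ ≤ b →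
      ∀ X Y Z → X ⊆ˢ A → Y ⊆ˢ A → Z ⊆ˢ A → n ≤ K * card X → n ≤ K * card Y → n ≤ K * card Z →
      PosReg s 60 X Y → PosReg s 60 X Z → PosReg s 60 Y Z → ⊥
    three-sets t₆ tK tc₀ tf₁ tf₂ tc₁ tKc₂ tc₂ tKc₃ tc₃ tf₃ X Y Z X⊆A Y⊆A Z⊆A bigX bigY bigZ regXY regXZ regYZ =
      pigeonhole D classes z<s cover
        (caseA ∷
         caseB X Y bigX bigY regXY ∷ caseB Y X bigY bigX (PosReg-sym {s} {60} {X} {Y} regXY) ∷
         caseB X Z bigX bigZ regXZ ∷ caseB Z X bigZ bigX (PosReg-sym {s} {60} {X} {Z} regXZ) ∷
         caseB Y Z bigY bigZ regYZ ∷ caseB Z Y bigZ bigY (PosReg-sym {s} {60} {Y} {Z} regYZ) ∷ [])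
      where
      x′ = card X
      y′ = card Y
      z′ = card Z
      0<x = pos-of K x′ 0<n bigX
      0<y = pos-of K y′ 0<n bigY
      0<z = pos-of K z′ 0<n bigZ
      0<xyz : 0 < x′ * (y′ * z′)
      0<xyz = 1≤m*n 0<x (1≤m*n 0<y 0<z)
      F : Fin n → ℕ
      F v = 5 * g * (y′ * z′ * N X v + (x′ * z′ * N Y v + x′ * y′ * N Z v))
      ∑F : sumOver A F ≡ 5 * g * (y′ * z′ * e A X + (x′ * z′ * e A Y + x′ * y′ * e A Z))
      ∑F = trans (sumOver-*ˡ A (5 * g) _) (cong (5 * g *_) (trans (sumOver-+ A (λ v → y′ * z′ * N X v) _)
        (cong₂ _+_ (sumOver-*ˡ A (y′ * z′) (N X)) (trans (sumOver-+ A (λ v → x′ * z′ * N Y v) (λ v → x′ * y′ * N Z v))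
          (cong₂ _+_ (sumOver-*ˡ A (x′ * z′) (N Y)) (sumOver-*ˡ A (x′ * y′) (N Z)))))))
      -- `F` is the sum of the three densities times `5g x′y′z′`. The sum averages at least
      -- `8/5 + 3/g` and the threshold is `8/5 + 2/g`; the surplus `1/g` against the maximum 3 makes
      -- `D` a `1/(3g)` share of `A`.
      t = (8 * g + 10) * (x′ * (y′ * z′))
      D = level A t F
      boundF : ∀ v → A v ≡ true → F v ≤ 15 * g * (x′ * (y′ * z′))
      boundF v _ = ≤-trans (*-monoʳ-≤ (5 * g) (+-mono-≤ (*-monoʳ-≤ (y′ * z′) (N≤card X v))
          (+-mono-≤ (*-monoʳ-≤ (x′ * z′) (N≤card Y v)) (*-monoʳ-≤ (x′ * y′) (N≤card Z v))))) (≤-reflexive (three-max-id g x′ y′ z′))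
      m≤3gD : m ≤ 3 * g * card D
      m≤3gD = cancelˡ-≤ (15 * (x′ * (y′ * z′))) (1≤m*n {15} z<s 0<xyz)
        (lin (15 * (x′ * (y′ * z′)) * m) (15 * (x′ * (y′ * z′)) * (3 * g * card D)) 0
          (+-mono-≤ (*-monoʳ-≤ (y′ * z′) (degree-sum X X⊆A)) (+-mono-≤ (*-monoʳ-≤ (x′ * z′) (degree-sum Y Y⊆A))
            (+-mono-≤ (*-monoʳ-≤ (x′ * y′) (degree-sum Z Z⊆A))
            (*-monoʳ-≤ 3 (subst (_≤ card D * (15 * g * (x′ * (y′ * z′))) + m * t) ∑F (markov A F t (15 * g * (x′ * (y′ * z′))) boundF))))))
          (three-markov-id g x′ y′ z′ m (card D) (e A X) (e A Y) (e A Z)))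
      bigS : ∀ S → card D ≤ 7 * card S → n ≤ K * card S
      bigS S le = widen {x = card S} KD≤K
        (≤*-trans n (Q₀ * (3 * g)) (card D) 7 (card S) (≤*-trans n Q₀ m (3 * g) (card D) bigA m≤3gD) le)
      spread : VSet
      spread v = D v ∧ ((x′ ≤ᵇ g * N X v) ∧ ((y′ ≤ᵇ g * N Y v) ∧ (z′ ≤ᵇ g * N Z v)))
      heavy : VSet → VSet → VSet
      heavy X Y v = ((8 * g + 5) * card X ≤ᵇ 10 * g * N X v) ∧ (card Y ≤ᵇ 2 * N Y v)
      classes : List (VSet {n})
      classes = spread ∷ heavy X Y ∷ heavy Y X ∷ heavy X Z ∷ heavy Z X ∷ heavy Y Z ∷ heavy Z Y ∷ []
      caseA : card D ≤ 7 * card spread → ⊥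
      caseA le = many-K₄ K c₁ (choice K c₁ tK tc₁) (choice (K * c₂) c₂ tKc₂ tc₂) (choice (K * c₂ * c₃) c₃ tKc₃ tc₃)
        (five (K * c₂ * c₃ * M c₃) tf₃) spread X Y Z (bigS spread le) bigX bigY bigZ
        (subst (card spread * (x′ * (y′ * z′)) ≤_) (sumOver-*ˡ spread c₁ _) (sumOver-≥ spread _ _ local))
        where
        local : ∀ v → spread v ≡ true → x′ * (y′ * z′) ≤ c₁ * tri (X ∩ˢ adj v) (Y ∩ˢ adj v) (Z ∩ˢ adj v)
        local v p = many-triangles⁺ s 60 g (≤-trans (*-monoˡ-≤ g (m≤m+n 4 116)) 120g≤s) 120g≤s 1≤g z<s X Y Z
          (X ∩ˢ adj v) (Y ∩ˢ adj v) (Z ∩ˢ adj v) regXY regXZ regYZ (λ u → ∧-elimˡ) (λ u → ∧-elimˡ) (λ u → ∧-elimˡ)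
          0<x 0<y 0<z
          (subst (λ k → x′ ≤ g * k) (N-card X v) (≤ᵇ-sound x′ _ (∧-elimˡ q)))
          (subst (λ k → y′ ≤ g * k) (N-card Y v) (≤ᵇ-sound y′ _ (∧-elimˡ (∧-elimʳ {x′ ≤ᵇ g * N X v} q))))
          (subst (λ k → z′ ≤ g * k) (N-card Z v) (≤ᵇ-sound z′ _ (∧-elimʳ {y′ ≤ᵇ g * N Y v} (∧-elimʳ {x′ ≤ᵇ g * N X v} q))))
          where
          q = ∧-elimʳ {D v} p
      caseB : ∀ X Y → n ≤ K * card X → n ≤ K * card Y → PosReg s 60 X Y → card D ≤ 7 * card (heavy X Y) → ⊥
      caseB X Y bigX bigY reg le = dense-pair⁺ K g s 1≤g 2μᴰ≤s (≤-trans t₆ b≤n)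
        (choice K c₀ tK tc₀) (five _ tf₁) (five _ tf₂) (heavy X Y) X Y (bigS (heavy X Y) le) bigX bigY reg
        (λ v p → ≤ᵇ-sound ((8 * g + 5) * card X) _ (∧-elimˡ p))
        (λ v p → ≤ᵇ-sound (card Y) _ (∧-elimʳ {(8 * g + 5) * card X ≤ᵇ 10 * g * N X v} p))
      cover : ∀ v → D v ≡ true → Any (λ S → S v ≡ true) classes
      cover v d = assign (classify g x′ y′ z′ (N X v) (N Y v) (N Z v) 1≤g 0<x 0<y 0<z (N≤card X v) (N≤card Y v) (N≤card Z v)
          (level-≥ {A = A} {t} {F} v d))
        where
        is-heavy : ∀ X Y → Heavy g (card X) (N X v) (card Y) (N Y v) → heavy X Y v ≡ true
        is-heavy X Y (p , q) = ∧-intro (≤ᵇ-true {(8 * g + 5) * card X} {10 * g * N X v} p) (≤ᵇ-true {card Y} {2 * N Y v} q)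
        assign : Profile g x′ y′ z′ (N X v) (N Y v) (N Z v) → Any (λ S → S v ≡ true) classes
        assign (spreads p q r) = here (∧-intro d (∧-intro (≤ᵇ-true {x′} {g * N X v} p) (∧-intro (≤ᵇ-true {y′} {g * N Y v} q) (≤ᵇ-true {z′} {g * N Z v} r))))
        assign (xy h) = there (here (is-heavy X Y h))
        assign (yx h) = there (there (here (is-heavy Y X h)))
        assign (xz h) = there (there (there (here (is-heavy X Z h))))
        assign (zx h) = there (there (there (there (here (is-heavy Z X h)))))
        assign (yz h) = there (there (there (there (there (here (is-heavy Y Z h))))))
        assign (zy h) = there (there (there (there (there (there (here (is-heavy Z Y h)))))))

    -- `X₀` and `Y₀` come from regularising `A` against itself. The third set is cut from the
    -- vertices seeing both with positive density and made regular first with `X₀`, then with `Y₀`;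
    -- each step shrinks members of earlier pairs, so the parameters decrease from `s₁` to `s`.
    min-degree : All (_≤ b) thresholds → ⊥
    min-degree (_ ∷ t₁ ∷ t₂ ∷ t₃ ∷ t₄ ∷ t₅ ∷ t₆ ∷ tK ∷ tc₀ ∷ tf₁ ∷ tf₂ ∷ tc₁ ∷ tKc₂ ∷ tc₂ ∷ tKc₃ ∷ tc₃ ∷ tf₃ ∷ []) =
      positive⁺ s₁ 2 1≤s₁ A A (enough Q₀ _ (card A) t₁ bigA) (enough Q₀ _ (card A) t₁ bigA) denseAA step₁
      where
      1≤μ₃ = 1≤μ⁺ s 30 1≤s
      1≤s₂ : 1 ≤ s₂
      1≤s₂ = ≤-trans (1≤m*n 1≤s 1≤μ₃) sμ₃≤s₂
      1≤μ₂ = 1≤μ⁺ s₂ 30 1≤s₂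
      1≤s₁ : 1 ≤ s₁
      1≤s₁ = ≤-trans (1≤m*n 1≤s (1≤m*n 1≤μ₂ 1≤μ₃)) sμ₂μ₃≤s₁
      denseAA : m * m ≤ 2 * e A A
      denseAA = cancelˡ-≤ Q₀ (1≤m*n {15} z<s 1≤g) (lin (Q₀ * (m * m)) (Q₀ * (2 * e A A)) (g * (m * m) + 30 * (m * m))
        (*-monoʳ-≤ 2 (degree-sum A (λ _ a → a))) (half-dense-id g (m * m) (e A A)))
      step₁ : ∀ X₀ Y₀ → X₀ ⊆ˢ A → Y₀ ⊆ˢ A → m ≤ μ₁ * card X₀ → m ≤ μ₁ * card Y₀ → PosReg s₁ 4 X₀ Y₀ → ⊥
      step₁ X₀ Y₀ X₀⊆A Y₀⊆A mX mY regXY =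
        positive⁺ s₂ 30 1≤s₂ C X₀ (enough (Q₀ * 60) _ (card C) t₂ bigC) (enough (Q₀ * μ₁) _ x t₃ bigX₀) denseCX step₂
        where
        x = card X₀
        y = card Y₀
        bigX₀ : n ≤ Q₀ * μ₁ * x
        bigX₀ = ≤*-trans n Q₀ m μ₁ x bigA mX
        bigY₀ : n ≤ Q₀ * μ₁ * y
        bigY₀ = ≤*-trans n Q₀ m μ₁ y bigA mY
        0<xy : 0 < x * y
        0<xy = 1≤m*n (pos-of (Q₀ * μ₁) x 0<n bigX₀) (pos-of (Q₀ * μ₁) y 0<n bigY₀)
        f : Fin n → ℕ
        f v = 30 * (y * N X₀ v + x * N Y₀ v)
        ∑f : sumOver A f ≡ 30 * (y * e A X₀ + x * e A Y₀)
        ∑f = trans (sumOver-*ˡ A 30 _) (cong (30 *_) (trans (sumOver-+ A (λ v → y * N X₀ v) (λ v → x * N Y₀ v))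
          (cong₂ _+_ (sumOver-*ˡ A y (N X₀)) (sumOver-*ˡ A x (N Y₀)))))
        -- The two densities sum to at least 32/30 on average. Where the sum reaches 31/30, each is
        -- at least 1/30 because the other is at most 1; the surplus 1/30 against the maximum 2
        -- gives the share 1/60.
        C = level A (31 * (x * y)) f
        bound : ∀ v → A v ≡ true → f v ≤ 60 * (x * y)
        bound v _ = ≤-trans (*-monoʳ-≤ 30 (+-mono-≤ (*-monoʳ-≤ y (N≤card X₀ v)) (*-monoʳ-≤ x (N≤card Y₀ v)))) (≤-reflexive (two-max-id x y))
        m≤60C : m ≤ 60 * card C
        m≤60C = cancelˡ-≤ (g * (x * y)) (1≤m*n 1≤g 0<xy) (lin (g * (x * y) * m) (g * (x * y) * (60 * card C)) (60 * (m * (x * y)))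
          (+-mono-≤ (*-monoʳ-≤ (2 * y) (degree-sum X₀ X₀⊆A)) (+-mono-≤ (*-monoʳ-≤ (2 * x) (degree-sum Y₀ Y₀⊆A))
            (*-monoʳ-≤ g (subst (_≤ card C * (60 * (x * y)) + m * (31 * (x * y))) ∑f (markov A f (31 * (x * y)) (60 * (x * y)) bound)))))
          (two-markov-id g x y m (card C) (e A X₀) (e A Y₀)))
        bigC : n ≤ Q₀ * 60 * card C
        bigC = ≤*-trans n Q₀ m 60 (card C) bigA m≤60C
        half : ∀ x y p q → 0 < y → q ≤ y → 31 * (x * y) ≤ 30 * (y * p + x * q) → x ≤ 30 * p
        half x y p q 0<y q≤y le = cancelˡ-≤ y 0<y (lin (y * x) (y * (30 * p)) 0 (+-mono-≤ le (*-monoʳ-≤ (30 * x) q≤y)) (half-id x y p q))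
        C⇒f : ∀ v → C v ≡ true → 31 * (x * y) ≤ f v
        C⇒f v = level-≥ {A = A} {31 * (x * y)} {f} v
        denseCX : card C * x ≤ 30 * e C X₀
        denseCX = subst (card C * x ≤_) (sumOver-*ˡ C 30 (N X₀)) (sumOver-≥ C _ _ λ v p →
          half x y (N X₀ v) (N Y₀ v) (pos-of (Q₀ * μ₁) y 0<n bigY₀) (N≤card Y₀ v) (C⇒f v p))
        step₂ : ∀ C₁ X₁ → C₁ ⊆ˢ C → X₁ ⊆ˢ X₀ → card C ≤ μ₂ * card C₁ → x ≤ μ₂ * card X₁ → PosReg s₂ 60 C₁ X₁ → ⊥
        step₂ C₁ X₁ C₁⊆C X₁⊆X₀ cC₁ xX₁ regCX =
          positive⁺ s 30 1≤s C₁ Y₀ (enough (Q₀ * 60 * μ₂) _ (card C₁) t₄ bigC₁) (enough (Q₀ * μ₁) _ y t₅ bigY₀) denseCY step₃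
          where
          bigC₁ : n ≤ Q₀ * 60 * μ₂ * card C₁
          bigC₁ = ≤*-trans n (Q₀ * 60) (card C) μ₂ (card C₁) bigC cC₁
          denseCY : card C₁ * y ≤ 30 * e C₁ Y₀
          denseCY = subst (card C₁ * y ≤_) (sumOver-*ˡ C₁ 30 (N Y₀)) (sumOver-≥ C₁ _ _ λ v p →
            half y x (N Y₀ v) (N X₀ v) (pos-of (Q₀ * μ₁) x 0<n bigX₀) (N≤card X₀ v)
              (subst₂ _≤_ (cong (31 *_) (*-comm x y)) (cong (30 *_) (+-comm (y * N X₀ v) (x * N Y₀ v))) (C⇒f v (C₁⊆C v p))))
          step₃ : ∀ Z Y₁ → Z ⊆ˢ C₁ → Y₁ ⊆ˢ Y₀ → card C₁ ≤ μ₃ * card Z → y ≤ μ₃ * card Y₁ → PosReg s 60 Z Y₁ → ⊥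
          step₃ Z Y₁ Z⊆C₁ Y₁⊆Y₀ cZ yY₁ regZY =
            three-sets t₆ tK tc₀ tf₁ tf₂ tc₁ tKc₂ tc₂ tKc₃ tc₃ tf₃ X₁ Y₁ Z (⊆-trans X₁⊆X₀ X₀⊆A) (⊆-trans Y₁⊆Y₀ Y₀⊆A) (λ v p → ∧-elimˡ (C₁⊆C v (Z⊆C₁ v p)))
              (widen {x = card X₁} KX≤K (≤*-trans n (Q₀ * μ₁) x μ₂ (card X₁) bigX₀ xX₁))
              (widen {x = card Y₁} KY≤K (≤*-trans n (Q₀ * μ₁) y μ₃ (card Y₁) bigY₀ yY₁))
              (widen {x = card Z} KZ≤K (≤*-trans n (Q₀ * 60 * μ₂) (card C₁) μ₃ (card Z) bigC₁ cZ))
              (PosReg-sub {s₁} {s} {4} {60} {X₀} {Y₀} {X₁} {Y₁} μ₂ μ₃ (≤-trans (*-monoʳ-≤ s (≤-trans (≤-reflexive (sym (*-identityʳ μ₂))) (*-monoʳ-≤ μ₂ 1≤μ₃))) sμ₂μ₃≤s₁)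
                (≤-trans (*-monoʳ-≤ s (≤-mulˡ μ₃ 1≤μ₂)) sμ₂μ₃≤s₁) (m≤m+n 4 56) X₁⊆X₀ Y₁⊆Y₀ xX₁ yY₁ regXY)
              (PosReg-sym {s} {60} {Z} {X₁} (PosReg-sub {s₂} {s} {60} {60} {C₁} {X₁} {Z} {X₁} μ₃ 1 sμ₃≤s₂ (≤-trans (*-monoʳ-≤ s 1≤μ₃) sμ₃≤s₂) ≤-refl Z⊆C₁ (λ _ p → p) cZ (≤-reflexive (sym (+-identityʳ (card X₁)))) regCX))
              (PosReg-sym {s} {60} {Z} {Y₁} regZY)

  private
    -- The peeling invariant. For `m = n` it is `(P₀ + 15) n² ≤ Q₀ e`, density `8/15 + 2/g`. The
    -- surplus `15 n²` keeps the surviving set linear, and `P₀ (n - m)` pays, per deletion, for the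
    -- gap between `2m` and `m² - (m-1)²`.
    Dense : ℕ → VSet → Set
    Dense m A = P₀ * (m * m) + 15 * (n * n) + P₀ * m ≤ Q₀ * e A A + P₀ * n

    -- If `Q₀ m < n`, then `Q₀ e ≤ Q₀ m² ≤ n²` and `P₀ n ≤ n²`, too little to cover `15 n²`.
    dense-big : P₀ ≤ b → ∀ A → Dense (card A) A → n ≤ Q₀ * card A
    dense-big P₀≤b A inv with n ≤? Q₀ * card A
    ... | yes p = p
    ... | no ¬p = ⊥-elim (<⇒≱ (1≤m*n 0<n 0<n) (lin (n * n) 0 (12 * (n * n) + P₀ * (card A * card A) + P₀ * card A)
        (+-mono-≤ inv (+-mono-≤ (*-monoʳ-≤ Q₀ (e≤ A A)) (+-mono-≤ (*-monoˡ-≤ n (≤-trans P₀≤b b≤n))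
          (≤-trans (*-monoʳ-≤ (Q₀ * card A) (card≤n A)) (*-monoˡ-≤ n (<⇒≤ (≰⇒> ¬p)))))))
        (big-id P₀ Q₀ (card A) n (e A A))))

    card-remove : ∀ (A : VSet {n}) v → A v ≡ true → card A ≡ suc (card (A ∖ single v))
    card-remove A v a = trans (card-∖ (single-⊆ {A = A} a)) (cong (_+ card (A ∖ single v)) (card-single v))

    e-remove : ∀ A v → A v ≡ true → e A A ≤ e (A ∖ single v) (A ∖ single v) + 2 * N A v
    e-remove A v a = begin
      e A A ≡⟨ e-∖ˡ A A (single v) (single-⊆ {A = A} a) ⟩
      e (single v) A + e A′ A ≡⟨ cong₂ _+_ (e-single A) (e-∖ʳ A′ A (single v) (single-⊆ {A = A} a)) ⟩
      N A v + (e A′ (single v) + e A′ A′) ≤⟨ +-monoʳ-≤ (N A v) (+-monoˡ-≤ (e A′ A′) (≤-trans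
                                             (≤-reflexive (trans (e-sym A′ (single v)) (e-single A′)))
                                             (sumOver-⊆ {A = A′} {A} _ (λ u → ∧-elimˡ)))) ⟩
      N A v + (N A v + e A′ A′) ≡⟨ remove-id (N A v) (e A′ A′) ⟩
      e A′ A′ + 2 * N A v ∎
      where
      open ≤-Reasoning
      A′ = A ∖ single v
      e-single : ∀ B → e (single v) B ≡ N B v
      e-single B = ∑-pick v (N B)

  -- Low-degree vertices are deleted one by one; the linear terms absorb the losses exactly.
  peel : All (_≤ b) thresholds → ∀ m A → card A ≡ m → Dense m A → ⊥
  peel ts@(P₀≤b ∷ _) zero A |A| inv =
    min-degree A (dense-big P₀≤b A (subst (λ j → Dense j A) (sym |A|) inv)) (λ v a → ⊥-elim (0≢1+n (trans (sym |A|) (card-remove A v a)))) ts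
  peel ts@(P₀≤b ∷ _) (suc k) A |A| inv =
    min-degree A (dense-big P₀≤b A (subst (λ j → Dense j A) (sym |A|) inv)) deg ts
    where
    deg : ∀ v → A v ≡ true → P₀ * card A ≤ Q₀ * N A v
    deg v a with P₀ * card A ≤? Q₀ * N A v
    ... | yes p = p
    ... | no ¬p = ⊥-elim (peel ts k (A ∖ single v) (suc-injective (trans (sym (card-remove A v a)) |A|)) (lin _ _ 0
          (+-mono-≤ inv (+-mono-≤ (*-monoʳ-≤ Q₀ (e-remove A v a)) (*-monoʳ-≤ 2 (<⇒≤ low))))
          (peel-id P₀ Q₀ k n (e A A) (e (A ∖ single v) (A ∖ single v)) (N A v))))
      where
      low : Q₀ * N A v < P₀ * suc k
      low = subst (λ j → Q₀ * N A v < P₀ * j) |A| (≰⇒> ¬p)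

  full : VSet {n}
  full _ = true

  edge-bound : All (_≤ b) thresholds → Q₀ * e full full < (P₀ + 15) * (n * n)
  edge-bound ts with (P₀ + 15) * (n * n) ≤? Q₀ * e full full
  ... | no ¬p = ≰⇒> ¬p
  ... | yes p = ⊥-elim (peel ts n full |full| (lin _ _ 0 p (full-id P₀ n (Q₀ * e full full))))
    where
    |full| : card full ≡ n
    |full| = trans (∑-allFin-const n 1) (*-identityʳ n)

-- Independence numbers and Q(5,n)

card-lookup : ∀ {n} (S : Subset n) → card (lookup S) ≡ ∣ S ∣
card-lookup [] = refl
card-lookup {suc n} (true ∷ S) = trans (∑-suc n (𝟙 ∘ lookup (true ∷ S))) (cong suc (card-lookup S))
card-lookup {suc n} (false ∷ S) = trans (∑-suc n (𝟙 ∘ lookup (false ∷ S))) (card-lookup S)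

card-tabulate : ∀ {n} (A : VSet {n}) → ∣ tabulateᵛ A ∣ ≡ card A
card-tabulate {n} A = trans (sym (card-lookup (tabulateᵛ A))) (∑-cong (allFin n) λ v → cong 𝟙 (lookup∘tabulate A v))

IndepSet : ∀ {n} → Graph n → VSet {n} → Set
IndepSet G S = ∀ u v → S u ≡ true → S v ≡ true → adj G u v ≡ false

indep-lookup : ∀ {n} (G : Graph n) S → Independent G S → IndepSet G (lookup S)
indep-lookup G S ind u v p q = ind u v (lookup⇒[]= u S p) (lookup⇒[]= v S q)

α-bound : ∀ {n} (G : Graph n) a → IsIndepNumber G a → ∀ S → IndepSet G S → card S ≤ a
α-bound G a (_ , max) S ind = subst (_≤ a) (card-tabulate S) (max (tabulateᵛ S) λ u v p q →
  ind u v (member u p) (member v q))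
  where
  member : ∀ u → u ∈ tabulateᵛ S → S u ≡ true
  member u p = trans (sym (lookup∘tabulate S u)) ([]=⇒lookup p)

-- Descends from an upper bound until some independent set attains it. `IsQ` speaks only of graphs
-- with a given independence number, so `Q-bound` needs one for its graph.
indep-number-exists : ∀ {n} (H : Graph n) B → (∀ S → Independent H S → ∣ S ∣ ≤ B) →
  (∀ a → a ≤ B → IsIndepNumber H a → ⊥) → ⊥
indep-number-exists {n} H zero bound cont =
  cont 0 z≤n ((tabulateᵛ (λ _ → false) , ind , trans (card-tabulate {n} (λ _ → false)) (∑-zero (allFin n))) , bound)
  where
  ind : Independent H (tabulateᵛ (λ _ → false))
  ind u v p q with trans (sym (lookup∘tabulate (λ _ → false) u)) ([]=⇒lookup p)
  ... | ()
indep-number-exists H (suc B) bound cont =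
  indep-number-exists H B smaller λ a a≤B → cont a (≤-trans a≤B (n≤1+n B))
  where
  smaller : ∀ S → Independent H S → ∣ S ∣ ≤ B
  smaller S ind with ∣ S ∣ ≤? B
  ... | yes p = p
  ... | no ¬p = ⊥-elim (cont (suc B) ≤-refl ((S , ind , ≤-antisym (bound S ind) (≰⇒> ¬p)) , bound))

Q-bound : ∀ {n t q} → IsQ t n q → (H : Graph n) → CliqueFree t H → ∀ B → (∀ S → IndepSet H S → card S ≤ B) → q ≤ B
Q-bound {q = q} (_ , least) H free B bound with q ≤? B
... | yes p = p
... | no ¬p = ⊥-elim (indep-number-exists H B
        (λ S ind → subst (_≤ B) (card-lookup S) (bound (lookup S) (indep-lookup H S ind)))
        λ a a≤B isα → ¬p (≤-trans (least H a free isα) a≤B))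

clique⇒list : ∀ {m n} t (adj : Fin n → Fin n → Bool) (f : Fin t → Fin m) (φ : Fin m → Fin n) →
  (∀ i j → i ≢ j → adj (φ (f i)) (φ (f j)) ≡ true) → AllPairs (λ u v → adj u v ≡ true) (tabulate (φ ∘ f))
clique⇒list t adj f φ p = pairs-tabulate⁺ λ {i} {j} → p i j

list⇒clique : ∀ {n} (G : Graph n) l → AllPairs (λ u v → adj G u v ≡ true) l → HasClique (length l) G
list⇒clique G l cl = Data.List.lookup l , injective , λ i j i≢j → adjacent l cl i j i≢j
  where
  adjacent : ∀ l → AllPairs (λ u v → adj G u v ≡ true) l → ∀ i j → i ≢ j →
    adj G (Data.List.lookup l i) (Data.List.lookup l j) ≡ true
  adjacent (x ∷ l) (p ∷ ps) fzero fzero i≢j = ⊥-elim (i≢j refl)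
  adjacent (x ∷ l) (p ∷ ps) fzero (fsuc j) i≢j = All.lookup p (∈-lookup {xs = l} j)
  adjacent (x ∷ l) (p ∷ ps) (fsuc i) fzero i≢j = trans (Graph.sym G _ _) (All.lookup p (∈-lookup {xs = l} i))
  adjacent (x ∷ l) (p ∷ ps) (fsuc i) (fsuc j) i≢j = adjacent l ps i j λ { refl → i≢j refl }
  injective : ∀ {i j} → Data.List.lookup l i ≡ Data.List.lookup l j → i ≡ j
  injective {i} {j} eq with i ≟ᶠ j
  ... | yes p = p
  ... | no ¬p with trans (sym (adjacent l cl i j ¬p)) (trans (cong (adj G _) (sym eq)) (Graph.irrefl G _))
  ... | ()

no-list : ∀ {n} t (G : Graph n) → CliqueFree t G → ∀ l → length l ≡ t → AllPairs (λ u v → adj G u v ≡ true) l → ⊥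
no-list t G free l refl cl = free (list⇒clique G l cl)

card≤1 : ∀ {n} (C : VSet {n}) → (∀ u v → C u ≡ true → C v ≡ true → u ≡ v) → card C ≤ 1
card≤1 C unique with card C ≤? 1
... | yes p = p
... | no ¬p = ⊥-elim (nonempty C (≤-trans z<s (≰⇒> ¬p)) λ u u∈C →
    nonempty (C ∖ single u) (+-cancelˡ-≤ 1 _ _ (subst (2 ≤_) (trans (card-∖ (single-⊆ {A = C} u∈C)) (cong (_+ card (C ∖ single u)) (card-single u))) (≰⇒> ¬p)))
      λ v p → distinct u v u∈C p)
  where
  distinct : ∀ u v → C u ≡ true → (C ∖ single u) v ≡ true → ⊥
  distinct u v u∈C p with unique u v u∈C (∧-elimˡ p)
  ... | refl with trans (sym (∧-elimʳ {C u} p)) (cong not (==-refl u))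
  ... | ()

image : ∀ {m n} (P : VSet {m}) (φ : Fin m → Fin n) → (∀ u v → P u ≡ true → P v ≡ true → φ u ≡ φ v → u ≡ v) →
  Σ (VSet {n}) λ I → card I ≡ card P × (∀ w → I w ≡ true → (∀ u → P u ≡ true → φ u ≡ w → ⊥) → ⊥) ×
    (∀ u → P u ≡ true → I (φ u) ≡ true)
image {m} {n} P φ inj = I , card≡ , extract , member
  where
  fibre : Fin n → VSet
  fibre w u = P u ∧ (w == φ u)
  I : VSet
  I w = 1 ≤ᵇ card (fibre w)
  fibre⇒≡ : ∀ w u → fibre w u ≡ true → φ u ≡ w
  fibre⇒≡ w u p = sym (==-sound w (φ u) (∧-elimʳ {P u} p))
  fibre≤1 : ∀ w → card (fibre w) ≤ 1
  fibre≤1 w = card≤1 (fibre w) λ u v p q →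
    inj u v (∧-elimˡ p) (∧-elimˡ q) (trans (fibre⇒≡ w u p) (sym (fibre⇒≡ w v q)))
  threshold : ∀ k → k ≤ 1 → 𝟙 (1 ≤ᵇ k) ≡ k
  threshold zero _ = refl
  threshold (suc zero) _ = refl
  threshold (suc (suc k)) (s≤s ())
  card≡ : card I ≡ card P
  card≡ = trans (∑-cong (allFin n) (λ w → trans (threshold _ (fibre≤1 w)) (∑-cong (allFin m) λ u → trans (𝟙-∧ (P u) (w == φ u)) (*-comm (𝟙 (P u)) _))))
    (trans (∑-swap (allFin n) (allFin m) _) (∑-cong (allFin m) λ u → ∑-pick (φ u) (λ _ → 𝟙 (P u))))
  member : ∀ u → P u ≡ true → I (φ u) ≡ true
  member u p = ≤ᵇ-true {1} (≤-trans (≤-reflexive (sym (card-single u)))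
    (card-mono {A = single u} {fibre (φ u)} λ v q → subst (λ x → fibre (φ u) x ≡ true) (sym (==-sound v u q)) (∧-intro p (==-refl (φ u)))))
  extract : ∀ w → I w ≡ true → (∀ u → P u ≡ true → φ u ≡ w → ⊥) → ⊥
  extract w p none = nonempty (fibre w) (≤ᵇ-sound 1 _ p) λ u q → none u (∧-elimˡ q) (fibre⇒≡ w u q)

enumerate : ∀ {n} (A : VSet {n}) → Σ ℕ λ k → k ≡ card A ×
  Σ (Fin k → Fin n) λ ψ → (∀ i j → ψ i ≡ ψ j → i ≡ j) × (∀ i → A (ψ i) ≡ true)
enumerate {zero} A = 0 , refl , (λ ()) , (λ ()) , λ ()
enumerate {suc n} A with enumerate (A ∘ fsuc) | A fzero in eq
... | k , k≡ , ψ , inj , mem | false =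
  k , trans k≡ (sym (∑-tabulate fsuc (𝟙 ∘ A))) , fsuc ∘ ψ , (λ i j p → inj i j (fsuc-injective p)) , mem
... | k , k≡ , ψ , inj , mem | true =
  suc k , cong suc (trans k≡ (sym (∑-tabulate fsuc (𝟙 ∘ A)))) , ψ⁺ , inj⁺ , mem⁺
  where
  ψ⁺ : Fin (suc k) → Fin (suc n)
  ψ⁺ fzero = fzero
  ψ⁺ (fsuc i) = fsuc (ψ i)
  inj⁺ : ∀ i j → ψ⁺ i ≡ ψ⁺ j → i ≡ j
  inj⁺ fzero fzero p = refl
  inj⁺ (fsuc i) (fsuc j) p = cong fsuc (inj i j (fsuc-injective p))
  mem⁺ : ∀ i → A (ψ⁺ i) ≡ true
  mem⁺ fzero = eq
  mem⁺ (fsuc i) = mem i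

==-sym : ∀ {n} (i j : Fin n) → (i == j) ≡ (j == i)
==-sym fzero fzero = refl
==-sym fzero (fsuc j) = refl
==-sym (fsuc i) fzero = refl
==-sym (fsuc i) (fsuc j) = ==-sym i j

-- Pulling G back along a map into K disjoint copies of itself.
pullback : ∀ {m n K} → Graph n → (Fin m → Fin K) → (Fin m → Fin n) → Graph m
adj (pullback G β φ) u v = (β u == β v) ∧ adj G (φ u) (φ v)
Graph.sym (pullback G β φ) u v = cong₂ _∧_ (==-sym (β u) (β v)) (Graph.sym G (φ u) (φ v))
irrefl (pullback G β φ) u = trans (cong₂ _∧_ (==-refl (β u)) (Graph.irrefl G (φ u))) refl

pullback-indep : ∀ {m n K} (G : Graph n) (β : Fin m → Fin K) (φ : Fin m → Fin n) →
  (∀ u v → β u ≡ β v → φ u ≡ φ v → u ≡ v) → ∀ a → (∀ S → IndepSet G S → card S ≤ a) →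
  ∀ S → IndepSet (pullback G β φ) S → card S ≤ K * a
pullback-indep {m} {n} {K} G β φ inj a bound S ind = begin
  card S ≡⟨ ∑-cong (allFin m) (λ u → sym (∑-pick (β u) (λ _ → 𝟙 (S u)))) ⟩
  ∑ (allFin m) (λ u → ∑ (allFin K) (λ b → 𝟙 (b == β u) * 𝟙 (S u))) ≡⟨ ∑-swap (allFin m) (allFin K) _ ⟩
  ∑ (allFin K) (λ b → ∑ (allFin m) (λ u → 𝟙 (b == β u) * 𝟙 (S u)))
    ≡⟨ ∑-cong (allFin K) (λ b → ∑-cong (allFin m) λ u → sym (𝟙-∧ (b == β u) (S u))) ⟩
  ∑ (allFin K) (λ b → card (block b)) ≤⟨ ∑-mono (allFin K) block≤a ⟩
  ∑ (allFin K) (λ _ → a) ≡⟨ ∑-allFin-const K a ⟩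
  K * a ∎
  where
  open ≤-Reasoning
  block : Fin K → VSet
  block b u = (b == β u) ∧ S u
  in-block : ∀ b u → block b u ≡ true → b ≡ β u
  in-block b u p = ==-sound b (β u) (∧-elimˡ p)
  block≤a : ∀ b → card (block b) ≤ a
  block≤a b with image (block b) φ (λ u v p q → inj u v (trans (sym (in-block b u p)) (in-block b v q)))
  ... | I , card≡ , extract , _ = subst (_≤ a) card≡ (bound I λ w w′ p q → ≢true⇒≡false λ ww′ →
      extract w p λ u u∈ φu → extract w′ q λ v v∈ φv → contradict w w′ u v u∈ v∈ φu φv ww′)
    where
    contradict : ∀ w w′ u v → block b u ≡ true → block b v ≡ true → φ u ≡ w → φ v ≡ w′ → adj G w w′ ≡ true → ⊥
    contradict w w′ u v u∈ v∈ refl refl ww′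
      with trans (sym (ind u v (∧-elimʳ {b == β u} u∈) (∧-elimʳ {b == β v} v∈)))
             (∧-intro (subst (λ x → (β u == x) ≡ true) (trans (sym (in-block b u u∈)) (in-block b v v∈)) (==-refl (β u))) ww′)
    ... | ()

five-in-large : ∀ {n} (G : Graph n) a q b → 0 < n → IsIndepNumber G a → IsQ 5 n q → suc b * a ≤ q →
  ∀ K → K ≤ b → Cliques.FiveIn (adj G) (Graph.sym G) K
five-in-large {n} G a q b 0<n isα isQ small K K≤b A n≤KA cont = <⇒≱ Ka<q (Q-bound isQ H free (K * a)
    (pullback-indep G β φ separated a (α-bound G a isα)))
  where
  k : ℕ
  k = proj₁ (enumerate A)
  k≡ : k ≡ card A
  k≡ = proj₁ (proj₂ (enumerate A))
  ψ : Fin k → Fin n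
  ψ = proj₁ (proj₂ (proj₂ (enumerate A)))
  ψ-inj : ∀ i j → ψ i ≡ ψ j → i ≡ j
  ψ-inj = proj₁ (proj₂ (proj₂ (proj₂ (enumerate A))))
  ψ∈A : ∀ i → A (ψ i) ≡ true
  ψ∈A = proj₂ (proj₂ (proj₂ (proj₂ (enumerate A))))
  n≤Kk : n ≤ K * k
  n≤Kk = subst (λ x → n ≤ K * x) (sym k≡) n≤KA
  -- An index splits into a block and an offset in `A`. By `n ≤ K * k` there is room for exactly `n`
  -- vertices, the order for which `q` is defined.
  position : Fin n → Fin K × Fin k
  position u = remQuot k (inject≤ u n≤Kk)
  β : Fin n → Fin K
  β u = proj₁ (position u)
  φ : Fin n → Fin n
  φ u = ψ (proj₂ (position u))
  separated : ∀ u v → β u ≡ β v → φ u ≡ φ v → u ≡ v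
  separated u v p q = inject≤-injective n≤Kk n≤Kk u v (trans (sym (combine-remQuot {K} k (inject≤ u n≤Kk)))
    (trans (cong₂ combine p (ψ-inj _ _ q)) (combine-remQuot {K} k (inject≤ v n≤Kk))))
  H : Graph n
  H = pullback G β φ
  free : CliqueFree 5 H
  free (f , _ , cl) = cont (tabulate (φ ∘ f)) refl
    (clique⇒list 5 (adj G) f φ λ i j i≢j → ∧-elimʳ {β (f i) == β (f j)} (cl i j i≢j))
    (All.tabulate⁺ λ i → ψ∈A (proj₂ (position (f i))))
  v₀ : Fin n
  v₀ = Data.Fin.fromℕ< 0<n
  -- Positivity of `a` makes `suc b * a` strictly larger than `K * a`.
  1≤a : 1 ≤ a
  1≤a = subst (_≤ a) (card-single v₀) (α-bound G a isα (single v₀) λ u v p q →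
    subst (λ x → adj G u x ≡ false) (trans (==-sound u v₀ p) (sym (==-sound v v₀ q))) (Graph.irrefl G u))
  Ka<q : K * a < q
  Ka<q = ≤-trans (+-mono-≤ 1≤a (*-monoˡ-≤ a K≤b)) small

edges-sum : ∀ {n} (G : Graph n) → 2 * edges G ≡ Pairs.e (adj G) (Graph.sym G) (λ _ → true) (λ _ → true)
edges-sum {n} G = begin
  2 * edges G ≡⟨ cong (2 *_) (trans (sum-∑ (allFin n) _) (∑-cong (allFin n) λ i → sum-∑ (allFin n) _)) ⟩
  2 * ∑∑ t ≡⟨ cong (∑∑ t +_) (+-identityʳ _) ⟩
  ∑∑ t + ∑∑ t ≡⟨ cong (∑∑ t +_) (∑-swap (allFin n) (allFin n) t) ⟩
  ∑∑ t + ∑∑ (λ i j → t j i) ≡⟨ sym (trans (∑-cong (allFin n) λ i → ∑-+ (allFin n) (t i) (λ j → t j i)) (∑-+ (allFin n) _ _)) ⟩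
  ∑∑ (λ i j → t i j + t j i) ≡⟨ ∑-cong (allFin n) (λ i → ∑-cong (allFin n) λ j → pointwise i j) ⟩
  ∑∑ (λ i j → 1 * 𝟙 (adj G i j)) ≡⟨ ∑-cong (allFin n) (λ i → sym (+-identityʳ _)) ⟩
  ∑ (allFin n) (λ i → 1 * ∑ (allFin n) (λ j → 1 * 𝟙 (adj G i j))) ∎
  where
  open ≡-Reasoning
  ∑∑ : (Fin n → Fin n → ℕ) → ℕ
  ∑∑ f = ∑ (allFin n) (λ i → ∑ (allFin n) (f i))
  t : Fin n → Fin n → ℕ
  t i j = if does (toℕ i Data.Nat.<? toℕ j) then (if adj G i j then 1 else 0) else 0
  sum-∑ : ∀ {I : Set} (xs : List I) (f : I → ℕ) → Data.Nat.ListAction.sum (mapL f xs) ≡ ∑ xs f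
  sum-∑ [] f = refl
  sum-∑ (x ∷ xs) f = cong (f x +_) (sum-∑ xs f)
  ifs : ∀ b → (if b then 1 else 0) ≡ 𝟙 b
  ifs true = refl
  ifs false = refl
  pointwise : ∀ i j → t i j + t j i ≡ 1 * 𝟙 (adj G i j)
  pointwise i j with <-cmp (toℕ i) (toℕ j)
  ... | tri< i<j _ i≯j rewrite dec-true (toℕ i Data.Nat.<? toℕ j) i<j | dec-false (toℕ j Data.Nat.<? toℕ i) i≯j = cong (_+ 0) (ifs (adj G i j))
  ... | tri> i≮j _ i>j rewrite dec-false (toℕ i Data.Nat.<? toℕ j) i≮j | dec-true (toℕ j Data.Nat.<? toℕ i) i>j =
    trans (ifs (adj G j i)) (trans (cong 𝟙 (Graph.sym G j i)) (sym (+-identityʳ _)))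
  ... | tri≈ i≮j i≡j j≮i rewrite dec-false (toℕ i Data.Nat.<? toℕ j) i≮j | dec-false (toℕ j Data.Nat.<? toℕ i) j≮i with Data.Fin.Properties.toℕ-injective i≡j
  ... | refl rewrite Graph.irrefl G i = refl

-- Random graphs and the deletion method

∑-split : ∀ k m (f : Fin (k + m) → ℕ) →
  ∑ (allFin (k + m)) f ≡ ∑ (allFin k) (λ i → f (i ↑ˡ m)) + ∑ (allFin m) (λ j → f (k ↑ʳ j))
∑-split zero m f = refl
∑-split (suc k) m f = begin
  ∑ (allFin (suc k + m)) f ≡⟨ ∑-suc (k + m) f ⟩
  f fzero + ∑ (allFin (k + m)) (f ∘ fsuc) ≡⟨ cong (f fzero +_) (∑-split k m (f ∘ fsuc)) ⟩
  f fzero + (∑ (allFin k) (λ i → f (fsuc i ↑ˡ m)) + R) ≡⟨ sym (+-assoc (f fzero) _ _) ⟩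
  f fzero + ∑ (allFin k) (λ i → f (fsuc i ↑ˡ m)) + R ≡⟨ cong (_+ R) (sym (∑-suc k (λ i → f (i ↑ˡ m)))) ⟩
  ∑ (allFin (suc k)) (λ i → f (i ↑ˡ m)) + R ∎
  where
  open ≡-Reasoning
  R : ℕ
  R = ∑ (allFin m) (λ j → f (suc k ↑ʳ j))

∑-combine : ∀ n k (f : Fin (n * k) → ℕ) → ∑ (allFin (n * k)) f ≡ ∑ (allFin n) (λ i → ∑ (allFin k) (λ j → f (combine i j)))
∑-combine zero k f = refl
∑-combine (suc n) k f = trans (∑-split k (n * k) f) (trans (cong (∑ (allFin k) (λ j → f (j ↑ˡ (n * k))) +_) (∑-combine n k (λ c → f (k ↑ʳ c))))
  (sym (∑-suc n (λ i → ∑ (allFin k) (λ j → f (combine i j))))))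

∑-All≤ : ∀ {I : Set} (xs : List I) f c → All (λ x → f x ≤ c) xs → ∑ xs f ≤ length xs * c
∑-All≤ [] f c [] = z≤n
∑-All≤ (x ∷ xs) f c (p ∷ ps) = +-mono-≤ p (∑-All≤ xs f c ps)

∈⇒≤∑ : ∀ {I : Set} {xs : List I} {x} f → x ∈ˡ xs → f x ≤ ∑ xs f
∈⇒≤∑ f (here refl) = m≤m+n _ _
∈⇒≤∑ f (there p) = ≤-trans (∈⇒≤∑ f p) (m≤n+m _ _)

subsets : ∀ n → ℕ → List (Subset n)
subsets zero zero = [] ∷ []
subsets zero (suc k) = []
subsets (suc n) zero = mapL (false ∷_) (subsets n zero)
subsets (suc n) (suc k) = mapL (true ∷_) (subsets n k) ++ mapL (false ∷_) (subsets n (suc k))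

length-subsets : ∀ n k → length (subsets n k) ≤ n ^ k
length-subsets zero zero = ≤-refl
length-subsets zero (suc k) = z≤n
length-subsets (suc n) zero = subst (_≤ 1) (sym (Data.List.Properties.length-map _ (subsets n zero))) (length-subsets n zero)
length-subsets (suc n) (suc k) = begin
  length (mapL (true ∷_) (subsets n k) ++ mapL (false ∷_) (subsets n (suc k))) ≡⟨ Data.List.Properties.length-++ (mapL (true ∷_) (subsets n k)) ⟩
  length (mapL (true ∷_) (subsets n k)) + length (mapL (false ∷_) (subsets n (suc k)))
    ≡⟨ cong₂ _+_ (Data.List.Properties.length-map _ (subsets n k)) (Data.List.Properties.length-map _ (subsets n (suc k))) ⟩
  length (subsets n k) + length (subsets n (suc k)) ≤⟨ +-mono-≤ (length-subsets n k) (length-subsets n (suc k)) ⟩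
  n ^ k + n * n ^ k ≤⟨ *-monoʳ-≤ (suc n) (^-monoˡ-≤ k (n≤1+n n)) ⟩
  suc n ^ suc k ∎
  where open ≤-Reasoning

subsets-card : ∀ n k → All (λ S → card (lookup S) ≡ k) (subsets n k)
subsets-card zero zero = refl ∷ []
subsets-card zero (suc k) = []
subsets-card (suc n) zero = All.map⁺ (All.map (λ {S} p → trans (∑-suc n (𝟙 ∘ lookup (false ∷ S))) p) (subsets-card n zero))
subsets-card (suc n) (suc k) = All.++⁺
  (All.map⁺ (All.map (λ {S} p → trans (∑-suc n (𝟙 ∘ lookup (true ∷ S))) (cong suc p)) (subsets-card n k)))
  (All.map⁺ (All.map (λ {S} p → trans (∑-suc n (𝟙 ∘ lookup (false ∷ S))) p) (subsets-card n (suc k))))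

∈-subsets : ∀ {n} k (S : Subset n) → card (lookup S) ≡ k → S ∈ˡ subsets n k
∈-subsets {zero} zero [] eq = here refl
∈-subsets {suc n} zero (true ∷ S) eq with trans (sym eq) (∑-suc n (𝟙 ∘ lookup (true ∷ S)))
... | ()
∈-subsets {suc n} zero (false ∷ S) eq = ∈-map⁺ (false ∷_) (∈-subsets zero S (trans (sym (∑-suc n (𝟙 ∘ lookup (false ∷ S)))) eq))
∈-subsets {suc n} (suc k) (true ∷ S) eq = ∈-++⁺ˡ (∈-map⁺ (true ∷_) (∈-subsets k S (suc-injective (trans (sym (∑-suc n (𝟙 ∘ lookup (true ∷ S)))) eq))))
∈-subsets {suc n} (suc k) (false ∷ S) eq = ∈-++⁺ʳ (mapL (true ∷_) (subsets n k))
  (∈-map⁺ (false ∷_) (∈-subsets (suc k) S (trans (sym (∑-suc n (𝟙 ∘ lookup (false ∷ S)))) eq)))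

-- Independent bits, each true with weight 1 and false with weight b out of m = suc b.
module Bits (b : ℕ) where

  m : ℕ
  m = suc b

  -- The expectation multiplied by the total weight `m ^ M`, which keeps it a natural number.
  E : ∀ M → (Vec Bool M → ℕ) → ℕ
  E zero f = f []
  E (suc M) f = E M (λ x → f (true ∷ x)) + b * E M (λ x → f (false ∷ x))

  E-mono : ∀ M {f g} → (∀ x → f x ≤ g x) → E M f ≤ E M g
  E-mono zero p = p []
  E-mono (suc M) p = +-mono-≤ (E-mono M (λ x → p (true ∷ x))) (*-monoʳ-≤ b (E-mono M (λ x → p (false ∷ x))))

  E-cong : ∀ M {f g} → (∀ x → f x ≡ g x) → E M f ≡ E M g
  E-cong zero p = p []
  E-cong (suc M) p = cong₂ _+_ (E-cong M (λ x → p (true ∷ x))) (cong (b *_) (E-cong M (λ x → p (false ∷ x))))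

  E-+ : ∀ M f g → E M (λ x → f x + g x) ≡ E M f + E M g
  E-+ zero f g = refl
  E-+ (suc M) f g = trans (cong₂ (λ x y → x + b * y) (E-+ M (λ x → f (true ∷ x)) (λ x → g (true ∷ x))) (E-+ M (λ x → f (false ∷ x)) (λ x → g (false ∷ x))))
    (eq b (E M (λ x → f (true ∷ x))) (E M (λ x → g (true ∷ x))) (E M (λ x → f (false ∷ x))) (E M (λ x → g (false ∷ x))))
    where
    eq : ∀ b x y z w → x + y + b * (z + w) ≡ x + b * z + (y + b * w)
    eq = solve-∀

  E-*ˡ : ∀ M c f → E M (λ x → c * f x) ≡ c * E M f
  E-*ˡ zero c f = refl
  E-*ˡ (suc M) c f = trans (cong₂ (λ x y → x + b * y) (E-*ˡ M c _) (E-*ˡ M c _)) (eq b c _ _)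
    where
    eq : ∀ b c x y → c * x + b * (c * y) ≡ c * (x + b * y)
    eq = solve-∀

  E-const : ∀ M c → E M (λ _ → c) ≡ c * m ^ M
  E-const zero c = sym (*-identityʳ c)
  E-const (suc M) c = trans (cong₂ (λ x y → x + b * y) (E-const M c) (E-const M c)) (eq b c (m ^ M))
    where
    eq : ∀ b c z → c * z + b * (c * z) ≡ c * ((1 + b) * z)
    eq = solve-∀

  E-∑ : ∀ M {I : Set} (xs : List I) (f : I → Vec Bool M → ℕ) → E M (λ x → ∑ xs (λ i → f i x)) ≡ ∑ xs (λ i → E M (f i))
  E-∑ M [] f = E-const M 0
  E-∑ M (i ∷ xs) f = trans (E-+ M (f i) _) (cong (E M (f i) +_) (E-∑ M xs f))

  xnor : Bool → Bool → Bool
  xnor true c = c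
  xnor false c = not c

  agree : ∀ {M} → Bool → VSet {M} → Vec Bool M → Bool
  agree c R [] = true
  agree c R (d ∷ x) = (not (R fzero) ∨ xnor c d) ∧ agree c (R ∘ fsuc) x

  agree-intro : ∀ {M} c (R : VSet {M}) x → (∀ i → R i ≡ true → lookup x i ≡ c) → agree c R x ≡ true
  agree-intro c R [] p = refl
  agree-intro c R (d ∷ x) p = ∧-intro (first (R fzero) (p fzero)) (agree-intro c (R ∘ fsuc) x (λ i → p (fsuc i)))
    where
    xnor-refl : ∀ c → xnor c c ≡ true
    xnor-refl true = refl
    xnor-refl false = refl
    first : ∀ r → (r ≡ true → d ≡ c) → not r ∨ xnor c d ≡ true
    first false q = refl
    first true q = subst (λ z → xnor c z ≡ true) (sym (q refl)) (xnor-refl c)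

  weight : Bool → ℕ
  weight true = 1
  weight false = b

  -- By independence, all bits in `R` equal `c` with probability `(weight c / m) ^ card R`;
  -- denominators are cleared.
  E-agree : ∀ {M} c (R : VSet {M}) → E M (λ x → 𝟙 (agree c R x)) * m ^ card R ≡ weight c ^ card R * m ^ M
  E-agree {zero} c R = refl
  E-agree {suc M} c R = begin
    E (suc M) (λ x → 𝟙 (agree c R x)) * m ^ card R
      ≡⟨ cong₂ _*_ (cong₂ (λ x y → x + b * y) (part true) (part false)) (cong (m ^_) |R|) ⟩
    (h true * E′ + b * (h false * E′)) * m ^ (r + card R′) ≡⟨ cong ((h true * E′ + b * (h false * E′)) *_) (^-distribˡ-+-* m r (card R′)) ⟩
    (h true * E′ + b * (h false * E′)) * (m ^ r * m ^ card R′) ≡⟨ eq₁ (h true) (h false) b E′ (m ^ r) (m ^ card R′) ⟩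
    ((h true + b * h false) * m ^ r) * (E′ * m ^ card R′) ≡⟨ cong₂ _*_ (local c (R fzero)) (E-agree c R′) ⟩
    (weight c ^ r * m) * (weight c ^ card R′ * m ^ M) ≡⟨ eq₂ (weight c ^ r) m (weight c ^ card R′) (m ^ M) ⟩
    (weight c ^ r * weight c ^ card R′) * (m * m ^ M) ≡⟨ cong (_* (m * m ^ M)) (sym (^-distribˡ-+-* (weight c) r (card R′))) ⟩
    weight c ^ (r + card R′) * m ^ suc M ≡⟨ cong (λ k → weight c ^ k * m ^ suc M) (sym |R|) ⟩
    weight c ^ card R * m ^ suc M ∎
    where
    open ≡-Reasoning
    R′ : VSet
    R′ = R ∘ fsuc
    r E′ : ℕ
    r = 𝟙 (R fzero)
    E′ = E M (λ x → 𝟙 (agree c R′ x))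
    h : Bool → ℕ
    h d = 𝟙 (not (R fzero) ∨ xnor c d)
    |R| : card R ≡ r + card R′
    |R| = ∑-suc M (𝟙 ∘ R)
    part : ∀ d → E M (λ x → 𝟙 (agree c R (d ∷ x))) ≡ h d * E′
    part d = trans (E-cong M λ x → 𝟙-∧ (not (R fzero) ∨ xnor c d) (agree c R′ x)) (E-*ˡ M (h d) _)
    eq₁ : ∀ x y b e p q → (x * e + b * (y * e)) * (p * q) ≡ ((x + b * y) * p) * (e * q)
    eq₁ = solve-∀
    eq₂ : ∀ w m v z → (w * m) * (v * z) ≡ (w * v) * (m * z)
    eq₂ = solve-∀
    local : ∀ c d → (𝟙 (not d ∨ xnor c true) + b * 𝟙 (not d ∨ xnor c false)) * m ^ 𝟙 d ≡ weight c ^ 𝟙 d * m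
    local true true = eq b
      where
      eq : ∀ b → (1 + b * 0) * ((1 + b) * 1) ≡ 1 * (1 + b)
      eq = solve-∀
    local true false = eq b
      where
      eq : ∀ b → (1 + b * 1) * 1 ≡ 1 * (1 + b)
      eq = solve-∀
    local false true = eq b
      where
      eq : ∀ b → (0 + b * 1) * ((1 + b) * 1) ≡ b * 1 * (1 + b)
      eq = solve-∀
    local false false = eq b
      where
      eq : ∀ b → (1 + b * 1) * 1 ≡ 1 * (1 + b)
      eq = solve-∀

less : ∀ {n} → Fin n → Fin n → Bool
less i j = toℕ i <ᵇ toℕ j

less-irrefl : ∀ {n} (i : Fin n) → less i i ≡ false
less-irrefl fzero = refl
less-irrefl (fsuc i) = less-irrefl i

trichotomy : ∀ {n} (i j : Fin n) → 𝟙 (less i j) + 𝟙 (less j i) + 𝟙 (j == i) ≡ 1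
trichotomy fzero fzero = refl
trichotomy fzero (fsuc j) = refl
trichotomy (fsuc i) fzero = refl
trichotomy (fsuc i) (fsuc j) = trichotomy i j

-- There are `n * n` bits, one per ordered pair; the pairs with `i < j` carry the edges.
pairsIn : ∀ {n} → VSet {n} → VSet {n * n}
pairsIn {n} S c = inside (remQuot {n} n c)
  where
  inside : Fin n × Fin n → Bool
  inside (i , j) = less i j ∧ (S i ∧ S j)

pairsIn-combine : ∀ {n} (S : VSet {n}) i j → pairsIn S (combine i j) ≡ less i j ∧ (S i ∧ S j)
pairsIn-combine {n} S i j = cong (λ (k , l) → less k l ∧ (S k ∧ S l)) (remQuot-combine {n} {n} i j)

-- The binomial coefficient of `card S` over 2 without division: `S × S` splits into `i < j`,
-- `j < i` and the diagonal.
card-pairsIn : ∀ {n} (S : VSet {n}) → 2 * card (pairsIn S) + card S ≡ card S * card S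
card-pairsIn {n} S = begin
  2 * card (pairsIn S) + card S ≡⟨ cong (λ k → 2 * k + card S) (trans (∑-combine n n _) (∑-cong V λ i → ∑-cong V λ j → cong 𝟙 (pairsIn-combine S i j))) ⟩
  2 * ∑∑ t + card S ≡⟨ cong (_+ card S) (cong (∑∑ t +_) (trans (+-identityʳ (∑∑ t)) (∑-swap V V t))) ⟩
  ∑∑ t + ∑∑ (λ i j → t j i) + card S ≡⟨ cong₂ _+_ (sym (∑∑-+ t (λ i j → t j i))) (sym (∑-cong V λ i → ∑-pick i (λ j → 𝟙 (S i)))) ⟩
  ∑∑ (λ i j → t i j + t j i) + ∑∑ (λ i j → 𝟙 (j == i) * 𝟙 (S i)) ≡⟨ sym (∑∑-+ _ _) ⟩
  ∑∑ (λ i j → t i j + t j i + 𝟙 (j == i) * 𝟙 (S i)) ≡⟨ ∑-cong V (λ i → ∑-cong V λ j → pointwise i j) ⟩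
  ∑∑ (λ i j → 𝟙 (S i) * 𝟙 (S j)) ≡⟨ ∑-∑*∑ V V (𝟙 ∘ S) (𝟙 ∘ S) ⟩
  card S * card S ∎
  where
  open ≡-Reasoning
  V : List (Fin n)
  V = allFin n
  ∑∑ : (Fin n → Fin n → ℕ) → ℕ
  ∑∑ f = ∑ V (λ i → ∑ V (f i))
  ∑∑-+ : ∀ f g → ∑∑ (λ i j → f i j + g i j) ≡ ∑∑ f + ∑∑ g
  ∑∑-+ f g = trans (∑-cong V λ i → ∑-+ V (f i) (g i)) (∑-+ V _ _)
  t : Fin n → Fin n → ℕ
  t i j = 𝟙 (less i j ∧ (S i ∧ S j))
  diagonal : ∀ i j → 𝟙 (j == i) * 𝟙 (S i) ≡ 𝟙 (j == i) * (𝟙 (S i) * 𝟙 (S j))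
  diagonal i j with j == i in eq
  ... | false = refl
  ... | true rewrite ==-sound j i eq = cong (_+ 0) (idem (S i))
    where
    idem : ∀ b → 𝟙 b ≡ 𝟙 b * 𝟙 b
    idem true = refl
    idem false = refl
  pointwise : ∀ i j → t i j + t j i + 𝟙 (j == i) * 𝟙 (S i) ≡ 𝟙 (S i) * 𝟙 (S j)
  pointwise i j = trans (cong₂ _+_ (cong₂ _+_ (expand i j) (expand j i)) (diagonal i j))
    (trans (factor (𝟙 (less i j)) (𝟙 (less j i)) (𝟙 (j == i)) (𝟙 (S i)) (𝟙 (S j)))
      (trans (cong (_* (𝟙 (S i) * 𝟙 (S j))) (trichotomy i j)) (*-identityˡ _)))
    where
    expand : ∀ i j → t i j ≡ 𝟙 (less i j) * (𝟙 (S i) * 𝟙 (S j))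
    expand i j = trans (𝟙-∧ (less i j) _) (cong (𝟙 (less i j) *_) (𝟙-∧ (S i) (S j)))
    factor : ∀ p q r x y → p * (x * y) + q * (y * x) + r * (x * y) ≡ (p + q + r) * (x * y)
    factor = solve-∀

module RandomGraph (b : ℕ) {n : ℕ} where

  open Bits b

  toGraph : Vec Bool (n * n) → Graph n
  adj (toGraph x) i j = (less i j ∧ lookup x (combine i j)) ∨ (less j i ∧ lookup x (combine j i))
  Graph.sym (toGraph x) i j = ∨-comm (less i j ∧ lookup x (combine i j)) _
  irrefl (toGraph x) i rewrite less-irrefl i = refl

  cliques : ℕ → Vec Bool (n * n) → ℕ
  cliques k x = ∑ (subsets n k) (λ S → 𝟙 (agree true (pairsIn (lookup S)) x))

  anticliques : ℕ → Vec Bool (n * n) → ℕ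
  anticliques k x = ∑ (subsets n k) (λ S → 𝟙 (agree false (pairsIn (lookup S)) x))

  private
    from-pair : (P : Fin n → Fin n → Set) (S : VSet {n}) →
      (∀ i j → less i j ≡ true → S i ≡ true → S j ≡ true → P i j) →
      ∀ c → pairsIn S c ≡ true → P (proj₁ (remQuot {n} n c)) (proj₂ (remQuot {n} n c))
    from-pair P S f c p = f i j (∧-elimˡ p) (∧-elimˡ (∧-elimʳ {less i j} p)) (∧-elimʳ {S i} (∧-elimʳ {less i j} p))
      where
      i j : Fin n
      i = proj₁ (remQuot {n} n c)
      j = proj₂ (remQuot {n} n c)

  agree-pairs : ∀ d S x → (∀ i j → less i j ≡ true → S i ≡ true → S j ≡ true → lookup x (combine i j) ≡ d) →
    agree d (pairsIn S) x ≡ true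
  agree-pairs d S x f = agree-intro d (pairsIn S) x λ c p →
    subst (λ c → lookup x c ≡ d) (combine-remQuot {n} n c) (from-pair (λ i j → lookup x (combine i j) ≡ d) S f c p)

  clique-agrees : ∀ S x → (∀ i j → S i ≡ true → S j ≡ true → i ≢ j → adj (toGraph x) i j ≡ true) →
    agree true (pairsIn S) x ≡ true
  clique-agrees S x cl = agree-pairs true S x λ i j i<j i∈ j∈ → edge i j i<j (cl i j i∈ j∈ (distinct i j i<j))
    where
    distinct : ∀ i j → less i j ≡ true → i ≢ j
    distinct i .i i<i refl with trans (sym i<i) (less-irrefl i)
    ... | ()
    edge : ∀ i j → less i j ≡ true → adj (toGraph x) i j ≡ true → lookup x (combine i j) ≡ true
    edge i j i<j p with less i j | less j i | trichotomy i j
    edge i j refl p | true | false | _ with lookup x (combine i j) | p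
    ... | true | _ = refl

  anticlique-agrees : ∀ S x → IndepSet (toGraph x) S → agree false (pairsIn S) x ≡ true
  anticlique-agrees S x ind = agree-pairs false S x λ i j i<j i∈ j∈ → nonedge i j i<j (ind i j i∈ j∈)
    where
    nonedge : ∀ i j → less i j ≡ true → adj (toGraph x) i j ≡ false → lookup x (combine i j) ≡ false
    nonedge i j i<j p with less i j | lookup x (combine i j) | p
    nonedge i j refl p | true | false | _ = refl

  E-cliques : E (n * n) (cliques 5) * m ^ 10 ≤ n ^ 5 * m ^ (n * n)
  E-cliques = begin
    E (n * n) (cliques 5) * m ^ 10 ≡⟨ cong (_* m ^ 10) (E-∑ (n * n) (subsets n 5) _) ⟩
    ∑ (subsets n 5) (λ S → E (n * n) (λ x → 𝟙 (agree true (pairsIn (lookup S)) x))) * m ^ 10 ≡⟨ sym (∑-*ʳ (subsets n 5) (m ^ 10) _) ⟩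
    ∑ (subsets n 5) (λ S → E (n * n) (λ x → 𝟙 (agree true (pairsIn (lookup S)) x)) * m ^ 10)
      ≤⟨ ∑-All≤ (subsets n 5) _ (m ^ (n * n)) (All.map (λ {S} p → ≤-reflexive (each S p)) (subsets-card n 5)) ⟩
    length (subsets n 5) * m ^ (n * n) ≤⟨ *-monoˡ-≤ (m ^ (n * n)) (length-subsets n 5) ⟩
    n ^ 5 * m ^ (n * n) ∎
    where
    open ≤-Reasoning
    each : ∀ S → card (lookup S) ≡ 5 → E (n * n) (λ x → 𝟙 (agree true (pairsIn (lookup S)) x)) * m ^ 10 ≡ m ^ (n * n)
    each S |S| = subst (λ k → E (n * n) (λ x → 𝟙 (agree true (pairsIn (lookup S)) x)) * m ^ k ≡ m ^ (n * n)) ten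
      (trans (E-agree true (pairsIn (lookup S))) (trans (cong (_* m ^ (n * n)) (^-zeroˡ (card (pairsIn (lookup S))))) (*-identityˡ _)))
      where
      ten : card (pairsIn (lookup S)) ≡ 10
      ten = *-cancelˡ-≡ _ 10 2 (+-cancelʳ-≡ 5 _ 20 (subst (λ k → 2 * card (pairsIn (lookup S)) + k ≡ k * k) |S| (card-pairsIn (lookup S))))

  E-anticliques : ∀ s κ → 2 * κ + s ≡ s * s → E (n * n) (anticliques s) * m ^ κ ≤ n ^ s * (b ^ κ * m ^ (n * n))
  E-anticliques s κ κ-def = begin
    E (n * n) (anticliques s) * m ^ κ ≡⟨ cong (_* m ^ κ) (E-∑ (n * n) (subsets n s) _) ⟩
    ∑ (subsets n s) (λ S → E (n * n) (λ x → 𝟙 (agree false (pairsIn (lookup S)) x))) * m ^ κ ≡⟨ sym (∑-*ʳ (subsets n s) (m ^ κ) _) ⟩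
    ∑ (subsets n s) (λ S → E (n * n) (λ x → 𝟙 (agree false (pairsIn (lookup S)) x)) * m ^ κ)
      ≤⟨ ∑-All≤ (subsets n s) _ (b ^ κ * m ^ (n * n)) (All.map (λ {S} p → ≤-reflexive (each S p)) (subsets-card n s)) ⟩
    length (subsets n s) * (b ^ κ * m ^ (n * n)) ≤⟨ *-monoˡ-≤ _ (length-subsets n s) ⟩
    n ^ s * (b ^ κ * m ^ (n * n)) ∎
    where
    open ≤-Reasoning
    each : ∀ S → card (lookup S) ≡ s → E (n * n) (λ x → 𝟙 (agree false (pairsIn (lookup S)) x)) * m ^ κ ≡ b ^ κ * m ^ (n * n)
    each S |S| = subst (λ k → E (n * n) (λ x → 𝟙 (agree false (pairsIn (lookup S)) x)) * m ^ k ≡ b ^ k * m ^ (n * n)) κ≡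
      (E-agree false (pairsIn (lookup S)))
      where
      κ≡ : card (pairsIn (lookup S)) ≡ κ
      κ≡ = *-cancelˡ-≡ _ κ 2 (+-cancelʳ-≡ s _ _ (trans (subst (λ k → 2 * card (pairsIn (lookup S)) + k ≡ k * k) |S| (card-pairsIn (lookup S))) (sym κ-def)))

  -- Deletion method: F counts 5·#K₅ plus a prohibitive penalty for large independent sets.
  good-graph : ∀ t s κ → 2 * κ + s ≡ s * s → 5 * n ^ 5 ≤ t * m ^ 10 → suc t * (n ^ s * b ^ κ) < m ^ κ →
    (∀ (G : Graph n) (W : VSet {n}) → n ≤ card W + t → (∀ S → IndepSet G S → card S ≤ s) →
      (∀ (f : Fin 5 → Fin n) → (∀ i j → i ≢ j → adj G (f i) (f j) ≡ true) → (∀ i → W (f i) ≡ true) → ⊥) → ⊥) → ⊥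
  good-graph t s κ κ-def few-K₅ few-indep cont = <⇒≱ total (≤-trans (≤-reflexive (sym (E-const (n * n) (suc t)))) (E-mono (n * n) big))
    where
    F : Vec Bool (n * n) → ℕ
    F x = 5 * cliques 5 x + suc t * anticliques s x
    Ω = m ^ (n * n)
    1≤m^ : ∀ k → 1 ≤ m ^ k
    1≤m^ k = 1≤m^n k z<s
    total : E (n * n) F < suc t * Ω
    total = begin-strict
      E (n * n) F ≡⟨ trans (E-+ (n * n) _ _) (cong₂ _+_ (E-*ˡ (n * n) 5 (cliques 5)) (E-*ˡ (n * n) (suc t) (anticliques s))) ⟩
      5 * E (n * n) (cliques 5) + suc t * E (n * n) (anticliques s) <⟨ +-mono-≤-< cliques-small anticliques-small ⟩
      t * Ω + Ω ≡⟨ +-comm (t * Ω) Ω ⟩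
      suc t * Ω ∎
      where
      open ≤-Reasoning
      cliques-small : 5 * E (n * n) (cliques 5) ≤ t * Ω
      cliques-small = cancelˡ-≤ (m ^ 10) (1≤m^ 10) (begin
        m ^ 10 * (5 * E (n * n) (cliques 5)) ≡⟨ eq₁ (m ^ 10) (E (n * n) (cliques 5)) ⟩
        5 * (E (n * n) (cliques 5) * m ^ 10) ≤⟨ *-monoʳ-≤ 5 E-cliques ⟩
        5 * (n ^ 5 * Ω) ≡⟨ sym (*-assoc 5 (n ^ 5) Ω) ⟩
        5 * n ^ 5 * Ω ≤⟨ *-monoˡ-≤ Ω few-K₅ ⟩
        t * m ^ 10 * Ω ≡⟨ eq₂ t (m ^ 10) Ω ⟩
        m ^ 10 * (t * Ω) ∎)
        where
        eq₁ : ∀ x y → x * (5 * y) ≡ 5 * (y * x)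
        eq₁ = solve-∀
        eq₂ : ∀ t x y → t * x * y ≡ x * (t * y)
        eq₂ = solve-∀
      anticliques-small : suc t * E (n * n) (anticliques s) < Ω
      anticliques-small = *-cancelʳ-< (m ^ κ) _ _ (begin-strict
        suc t * E (n * n) (anticliques s) * m ^ κ ≡⟨ *-assoc (suc t) (E (n * n) (anticliques s)) (m ^ κ) ⟩
        suc t * (E (n * n) (anticliques s) * m ^ κ) ≤⟨ *-monoʳ-≤ (suc t) (E-anticliques s κ κ-def) ⟩
        suc t * (n ^ s * (b ^ κ * Ω)) ≡⟨ eq (suc t) (n ^ s) (b ^ κ) Ω ⟩
        suc t * (n ^ s * b ^ κ) * Ω <⟨ *-monoˡ-< Ω {{>-nonZero (1≤m^ (n * n))}} few-indep ⟩
        m ^ κ * Ω ≡⟨ *-comm (m ^ κ) Ω ⟩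
        Ω * m ^ κ ∎)
        where
        eq : ∀ t x y z → t * (x * (y * z)) ≡ t * (x * y) * z
        eq = solve-∀
    big : ∀ x → suc t ≤ F x
    big x with suc t ≤? F x
    ... | yes p = p
    ... | no ¬p = ⊥-elim (cont G W n≤W+t indep-small K₅-free)
      where
      G = toGraph x
      F≤t : F x ≤ t
      F≤t = ≤-pred (≰⇒> ¬p)
      -- `β v` counts the K₅ through `v`. Its sum is at most five times the number of K₅, hence at
      -- most `t`, so `W` omits at most `t` vertices.
      β : Fin n → ℕ
      β v = ∑ (subsets n 5) (λ S → 𝟙 (agree true (pairsIn (lookup S)) x) * 𝟙 (lookup S v))
      W : VSet
      W v = β v ≤ᵇ 0
      ∑β : ∑ (allFin n) β ≤ cliques 5 x * 5
      ∑β = begin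
        ∑ (allFin n) β ≡⟨ ∑-swap (allFin n) (subsets n 5) _ ⟩
        ∑ (subsets n 5) (λ S → ∑ (allFin n) (λ v → 𝟙 (agree true (pairsIn (lookup S)) x) * 𝟙 (lookup S v)))
          ≡⟨ ∑-cong (subsets n 5) (λ S → ∑-*ˡ (allFin n) (𝟙 (agree true (pairsIn (lookup S)) x)) _) ⟩
        ∑ (subsets n 5) (λ S → 𝟙 (agree true (pairsIn (lookup S)) x) * card (lookup S)) ≤⟨ ∑-All-mono (subsets n 5) (subsets-card n 5) ⟩
        ∑ (subsets n 5) (λ S → 𝟙 (agree true (pairsIn (lookup S)) x) * 5) ≡⟨ ∑-*ʳ (subsets n 5) 5 _ ⟩
        cliques 5 x * 5 ∎
        where
        open ≤-Reasoning
        ∑-All-mono : ∀ Ss → All (λ S → card (lookup S) ≡ 5) Ss →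
          ∑ Ss (λ S → 𝟙 (agree true (pairsIn (lookup S)) x) * card (lookup S)) ≤ ∑ Ss (λ S → 𝟙 (agree true (pairsIn (lookup S)) x) * 5)
        ∑-All-mono [] [] = z≤n
        ∑-All-mono (S ∷ Ss) (p ∷ ps) = +-mono-≤ (≤-reflexive (cong (𝟙 (agree true (pairsIn (lookup S)) x) *_) p)) (∑-All-mono Ss ps)
      n≤W+t : n ≤ card W + t
      n≤W+t = begin
        n ≡⟨ sym (trans (∑-allFin-const n 1) (*-identityʳ n)) ⟩
        ∑ (allFin n) (λ _ → 1) ≤⟨ ∑-mono (allFin n) (λ v → split (β v)) ⟩
        ∑ (allFin n) (λ v → 𝟙 (W v) + β v) ≡⟨ ∑-+ (allFin n) (𝟙 ∘ W) β ⟩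
        card W + ∑ (allFin n) β ≤⟨ +-monoʳ-≤ (card W) (≤-trans ∑β (≤-trans (≤-reflexive (*-comm (cliques 5 x) 5)) (≤-trans (m≤m+n _ _) F≤t))) ⟩
        card W + t ∎
        where
        open ≤-Reasoning
        split : ∀ k → 1 ≤ 𝟙 (k ≤ᵇ 0) + k
        split zero = ≤-refl
        split (suc k) = s≤s z≤n
      indep-small : ∀ S → IndepSet G S → card S ≤ s
      indep-small S ind with card S ≤? s
      ... | yes p = p
      ... | no ¬p = ⊥-elim (truncate S s (<⇒≤ (≰⇒> ¬p)) λ S′ S′⊆S |S′| → <⇒≱ (s≤s F≤t)
          (≤-trans (≤-trans (≤-reflexive (sym (*-identityʳ (suc t)))) (*-monoʳ-≤ (suc t) (occurs S′ |S′| (λ u v p q → ind u v (S′⊆S u p) (S′⊆S v q))))) (m≤n+m _ (5 * cliques 5 x))))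
        where
        occurs : ∀ S → card S ≡ s → IndepSet G S → 1 ≤ anticliques s x
        occurs S |S| ind = ≤-trans (≤-reflexive (sym (cong 𝟙 (anticlique-agrees (lookup (tabulateᵛ S)) x ind′))))
            (∈⇒≤∑ (λ S → 𝟙 (agree false (pairsIn (lookup S)) x)) (∈-subsets s (tabulateᵛ S) (trans (card-lookup (tabulateᵛ S)) (trans (card-tabulate S) |S|))))
          where
          ind′ : IndepSet G (lookup (tabulateᵛ S))
          ind′ u v p q = ind u v (trans (sym (lookup∘tabulate S u)) p) (trans (sym (lookup∘tabulate S v)) q)
      K₅-free : ∀ (f : Fin 5 → Fin n) → (∀ i j → i ≢ j → adj G (f i) (f j) ≡ true) → (∀ i → W (f i) ≡ true) → ⊥
      K₅-free f cl inW = contradict (image {5} {n} (λ _ → true) f (λ i j _ _ → f-inj i j))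
        where
        loop : ∀ {u v} → u ≡ v → adj G u v ≡ true → ⊥
        loop {u} refl p with trans (sym p) (irrefl G u)
        ... | ()
        f-inj : ∀ i j → f i ≡ f j → i ≡ j
        f-inj i j eq with i ≟ᶠ j
        ... | yes p = p
        ... | no ¬p = ⊥-elim (loop eq (cl i j ¬p))
        contradict : (Σ (VSet {n}) λ I → card I ≡ 5 × (∀ w → I w ≡ true → (∀ u → true ≡ true → f u ≡ w → ⊥) → ⊥) × (∀ u → true ≡ true → I (f u) ≡ true)) → ⊥
        contradict (I , |I| , extract , member) = <⇒≱ (s≤s (≤ᵇ-sound (β (f fzero)) 0 (inW fzero))) β≥1
          where
          S : Subset n
          S = tabulateᵛ I
          unS : ∀ u → lookup S u ≡ true → I u ≡ true
          unS u p = trans (sym (lookup∘tabulate I u)) p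
          clique : ∀ i j → lookup S i ≡ true → lookup S j ≡ true → i ≢ j → adj G i j ≡ true
          clique i j p q i≢j = ≢false⇒≡true λ ij → extract i (unS i p) λ u _ fu → extract j (unS j q) λ v _ fv →
            conflict i j u v i≢j fu fv ij
            where
            ≢false⇒≡true : ∀ {b} → (b ≡ false → ⊥) → b ≡ true
            ≢false⇒≡true {true} p = refl
            ≢false⇒≡true {false} p = ⊥-elim (p refl)
            conflict : ∀ i j u v → i ≢ j → f u ≡ i → f v ≡ j → adj G i j ≡ false → ⊥
            conflict i j u v i≢j refl refl ij with trans (sym ij) (cl u v λ { refl → i≢j refl })
            ... | ()
          β≥1 : 1 ≤ β (f fzero)
          β≥1 = ≤-trans (≤-reflexive (sym (cong₂ _*_ (cong 𝟙 (clique-agrees (lookup S) x clique))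
              (cong 𝟙 (trans (lookup∘tabulate I (f fzero)) (member fzero refl))))))
            (∈⇒≤∑ (λ S → 𝟙 (agree true (pairsIn (lookup S)) x) * 𝟙 (lookup S (f fzero)))
              (∈-subsets 5 S (trans (card-lookup S) (trans (card-tabulate I) |I|))))

-- Numerical estimates for an upper bound on Q(5,n)

-- With `m = b + 1` this is `(1 + 1/b)^m ≥ 1 + m/b ≥ 2` by Bernoulli: among `m` pairs of edge
-- probability `1/m`, having no edge has probability at most 1/2.
2·b^m≤m^m : ∀ b → 1 ≤ b → 2 * b ^ suc b ≤ suc b ^ suc b
2·b^m≤m^m b 1≤b = cancelˡ-≤ b 1≤b (begin
  b * (2 * b ^ suc b) ≡⟨ eq b (b ^ suc b) ⟩
  b ^ suc b * (b + b) ≤⟨ *-monoʳ-≤ (b ^ suc b) (+-monoʳ-≤ b (n≤1+n b)) ⟩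
  b ^ suc b * (b + suc b) ≤⟨ bernoulli (suc b) ⟩
  b * suc b ^ suc b ∎)
  where
  open ≤-Reasoning
  eq : ∀ b x → b * (2 * x) ≡ x * (b + b)
  eq = solve-∀
  bernoulli : ∀ k → b ^ k * (b + k) ≤ b * suc b ^ k
  bernoulli zero = ≤-reflexive (eq₀ b)
    where
    eq₀ : ∀ b → 1 * (b + 0) ≡ b * 1
    eq₀ = solve-∀
  bernoulli (suc k) = begin
    b * b ^ k * (b + suc k) ≤⟨ m≤m+n _ (b ^ k * k) ⟩
    b * b ^ k * (b + suc k) + b ^ k * k ≡⟨ eq₁ b (b ^ k) k ⟩
    suc b * (b ^ k * (b + k)) ≤⟨ *-monoʳ-≤ (suc b) (bernoulli k) ⟩
    suc b * (b * suc b ^ k) ≡⟨ eq₂ b (suc b ^ k) ⟩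
    b * suc b ^ suc k ∎
    where
    eq₁ : ∀ b x k → b * x * (b + (1 + k)) + x * k ≡ (1 + b) * (x * (b + k))
    eq₁ = solve-∀
    eq₂ : ∀ b x → (1 + b) * (b * x) ≡ b * ((1 + b) * x)
    eq₂ = solve-∀

^-distribʳ : ∀ a b e → (a * b) ^ e ≡ a ^ e * b ^ e
^-distribʳ a b zero = refl
^-distribʳ a b (suc e) = trans (cong (a * b *_) (^-distribʳ a b e)) (eq a b (a ^ e) (b ^ e))
  where
  eq : ∀ a b x y → a * b * (x * y) ≡ a * x * (b * y)
  eq = solve-∀

halving-power : ∀ b e κ → 1 ≤ b → suc b * e ≤ κ → 2 ^ e * b ^ κ ≤ suc b ^ κ
halving-power b e κ 1≤b le = begin
  2 ^ e * b ^ κ ≡⟨ cong (λ k → 2 ^ e * b ^ k) (sym (m+[n∸m]≡n le)) ⟩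
  2 ^ e * b ^ (m * e + d) ≡⟨ cong (2 ^ e *_) (trans (^-distribˡ-+-* b (m * e) d) (cong (_* b ^ d) (sym (^-*-assoc b m e)))) ⟩
  2 ^ e * ((b ^ m) ^ e * b ^ d) ≡⟨ trans (sym (*-assoc (2 ^ e) _ _)) (cong (_* b ^ d) (sym (^-distribʳ 2 (b ^ m) e))) ⟩
  (2 * b ^ m) ^ e * b ^ d ≤⟨ *-mono-≤ (^-monoˡ-≤ e (2·b^m≤m^m b 1≤b)) (^-monoˡ-≤ d (n≤1+n b)) ⟩
  (m ^ m) ^ e * m ^ d ≡⟨ trans (cong (_* m ^ d) (^-*-assoc m m e)) (sym (^-distribˡ-+-* m (m * e) d)) ⟩
  m ^ (m * e + d) ≡⟨ cong (m ^_) (m+[n∸m]≡n le) ⟩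
  m ^ κ ∎
  where
  open ≤-Reasoning
  m = suc b
  d = κ ∸ m * e

2^-mono : ∀ {i j} → i ≤ j → 2 ^ i ≤ 2 ^ j
2^-mono = ^-monoʳ-≤ 2

-- With n ≤ 2^(20L+20), edge probability 2^-(8L+9) on twice as many vertices.
αᴿ : ℕ → ℕ
αᴿ L = 8 * (2 ^ (8 * L + 9) * (20 * L + 21))

-- On N vertices the probability N^(-2/5) balances the expected number N⁵p¹⁰ of K₅ against N, so
-- deletion leaves half the vertices. Independent sets are then at most of order `log N / p`, which
-- is the shape of `αᴿ`.
Q-upper : ∀ L n q → n ≤ 2 ^ (20 * L + 20) → IsQ 5 n q → q ≤ αᴿ L
Q-upper L n q n≤t isQ with q ≤? αᴿ L
... | yes p = p
... | no ¬p = ⊥-elim (RandomGraph.good-graph b {2 ^ ℓ} t s κ κ-def few-K₅ few-indep λ G W N≤W+t α≤s K₅-free →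
    ¬p (use G W N≤W+t α≤s K₅-free))
  where
  ℓ t b s P p κ : ℕ
  ℓ = 20 * L + 21
  t = 2 ^ (20 * L + 20)
  b = 2 ^ (8 * L + 9) ∸ 1
  P = 2 ^ (8 * L + 9) * ℓ
  s = 8 * P
  p = s ∸ 1
  κ = 4 * P * p
  m≡ : suc b ≡ 2 ^ (8 * L + 9)
  m≡ = m+[n∸m]≡n (1≤m^n (8 * L + 9) z<s)
  1≤b : 1 ≤ b
  1≤b = ≤-pred (subst (2 ≤_) (sym m≡) (2^-mono {1} {8 * L + 9} (≤-trans z<s (m≤n+m 9 (8 * L)))))
  1≤ℓ : 1 ≤ ℓ
  1≤ℓ = ≤-trans z<s (m≤n+m 21 (20 * L))
  1≤P : 1 ≤ P
  1≤P = 1≤m*n (1≤m^n (8 * L + 9) z<s) 1≤ℓ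
  s≡ : suc p ≡ s
  s≡ = m+[n∸m]≡n (1≤m*n {8} z<s 1≤P)
  κ-def : 2 * κ + s ≡ s * s
  κ-def = trans (eq P p) (cong (s *_) s≡)
    where
    eq : ∀ P p → 2 * (4 * P * p) + 8 * P ≡ 8 * P * (1 + p)
    eq = solve-∀
  N≡2t : 2 ^ ℓ ≡ 2 * t
  N≡2t = cong (2 ^_) (+-suc (20 * L) 20)
  -- After `5 ≤ 2^5` both exponents equal `100L + 110`.
  few-K₅ : 5 * (2 ^ ℓ) ^ 5 ≤ t * suc b ^ 10
  few-K₅ = begin
    5 * (2 ^ ℓ) ^ 5 ≤⟨ *-mono-≤ {5} {2 ^ 5} (m≤m+n 5 27) (≤-reflexive (^-*-assoc 2 ℓ 5)) ⟩
    2 ^ 5 * 2 ^ (ℓ * 5) ≡⟨ sym (^-distribˡ-+-* 2 5 (ℓ * 5)) ⟩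
    2 ^ (5 + ℓ * 5) ≡⟨ cong (2 ^_) (eq L) ⟩
    2 ^ (20 * L + 20 + (8 * L + 9) * 10) ≡⟨ ^-distribˡ-+-* 2 (20 * L + 20) ((8 * L + 9) * 10) ⟩
    t * 2 ^ ((8 * L + 9) * 10) ≡⟨ cong (t *_) (sym (^-*-assoc 2 (8 * L + 9) 10)) ⟩
    t * (2 ^ (8 * L + 9)) ^ 10 ≡⟨ cong (λ k → t * k ^ 10) (sym m≡) ⟩
    t * suc b ^ 10 ∎
    where
    open ≤-Reasoning
    eq : ∀ L → 5 + (20 * L + 21) * 5 ≡ 20 * L + 20 + (8 * L + 9) * 10
    eq = solve-∀
  -- `ℓ (s + 1)` halvings pay for the `N^s` sets and the penalty `t + 1 ≤ N`; one more makes
  -- `few-indep` strict. Each needs `m` pairs, and `m ℓ s = 8P²` while `κ` is about `32P²`.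
  exponent : suc b * suc (ℓ * suc s) ≤ κ
  exponent = subst (λ k → k * suc (ℓ * suc s) ≤ κ) (sym m≡) (+-cancelʳ-≤ (4 * P) _ _ (begin
    mᴾ * suc (ℓ * suc s) + 4 * P ≡⟨ eq₁ mᴾ ℓ ⟩
    mᴾ + (5 * P * 1 + 8 * P * P) ≤⟨ +-mono-≤ (≤-trans M≤P (≤-reflexive (sym (*-identityʳ P)))) (≤-refl {5 * P * 1 + 8 * P * P}) ⟩
    P * 1 + (5 * P * 1 + 8 * P * P) ≤⟨ +-mono-≤ (*-monoʳ-≤ P 1≤P) (+-monoˡ-≤ (8 * P * P) (*-monoʳ-≤ (5 * P) 1≤P)) ⟩
    P * P + (5 * P * P + 8 * P * P) ≤⟨ m≤m+n _ (18 * P * P) ⟩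
    P * P + (5 * P * P + 8 * P * P) + 18 * P * P ≡⟨ eq₂ P ⟩
    4 * P * s ≡⟨ cong (4 * P *_) (sym s≡) ⟩
    4 * P * suc p ≡⟨ eq₃ P p ⟩
    κ + 4 * P ∎))
    where
    open ≤-Reasoning
    mᴾ = 2 ^ (8 * L + 9)
    M≤P : mᴾ ≤ P
    M≤P = ≤-trans (≤-reflexive (sym (*-identityʳ _))) (*-monoʳ-≤ mᴾ 1≤ℓ)
    eq₁ : ∀ m ℓ → m * (1 + ℓ * (1 + 8 * (m * ℓ))) + 4 * (m * ℓ) ≡ m + (5 * (m * ℓ) * 1 + 8 * (m * ℓ) * (m * ℓ))
    eq₁ = solve-∀
    eq₂ : ∀ P → P * P + (5 * P * P + 8 * P * P) + 18 * P * P ≡ 4 * P * (8 * P)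
    eq₂ = solve-∀
    eq₃ : ∀ P p → 4 * P * (1 + p) ≡ 4 * P * p + 4 * P
    eq₃ = solve-∀
  few-indep : suc t * ((2 ^ ℓ) ^ s * b ^ κ) < suc b ^ κ
  few-indep = begin-strict
    suc t * ((2 ^ ℓ) ^ s * b ^ κ) ≡⟨ sym (*-assoc (suc t) ((2 ^ ℓ) ^ s) (b ^ κ)) ⟩
    suc t * (2 ^ ℓ) ^ s * b ^ κ ≤⟨ *-monoˡ-≤ (b ^ κ) (*-mono-≤ t<N (≤-reflexive (^-*-assoc 2 ℓ s))) ⟩
    2 ^ ℓ * 2 ^ (ℓ * s) * b ^ κ ≡⟨ cong (_* b ^ κ) (trans (sym (^-distribˡ-+-* 2 ℓ (ℓ * s))) (cong (2 ^_) (sym (*-suc ℓ s)))) ⟩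
    2 ^ (ℓ * suc s) * b ^ κ <⟨ *-monoˡ-< (b ^ κ) {{>-nonZero (1≤m^n κ 1≤b)}} (^-monoʳ-< 2 (s≤s z<s) (n<1+n (ℓ * suc s))) ⟩
    2 ^ suc (ℓ * suc s) * b ^ κ ≤⟨ halving-power b (suc (ℓ * suc s)) κ 1≤b exponent ⟩
    suc b ^ κ ∎
    where
    open ≤-Reasoning
    t<N : suc t ≤ 2 ^ ℓ
    t<N = subst (suc t ≤_) (sym N≡2t) (+-mono-≤ (1≤m^n (20 * L + 20) z<s) (m≤m+n t 0))
  use : ∀ (G : Graph (2 ^ ℓ)) W → 2 ^ ℓ ≤ card W + t → (∀ S → IndepSet G S → card S ≤ s) →
    (∀ (f : Fin 5 → Fin (2 ^ ℓ)) → (∀ i j → i ≢ j → adj G (f i) (f j) ≡ true) → (∀ i → W (f i) ≡ true) → ⊥) → q ≤ s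
  use G W N≤W+t α≤s K₅-free = subst (q ≤_) (+-identityʳ s) (Q-bound isQ (pullback G β φ) free (1 * s) (pullback-indep G β φ separated s α≤s))
    where
    k : ℕ
    k = proj₁ (enumerate W)
    k≡ : k ≡ card W
    k≡ = proj₁ (proj₂ (enumerate W))
    ψ : Fin k → Fin (2 ^ ℓ)
    ψ = proj₁ (proj₂ (proj₂ (enumerate W)))
    n≤k : n ≤ k
    n≤k = ≤-trans n≤t (subst (t ≤_) (sym k≡) (+-cancelʳ-≤ t t (card W) (subst (_≤ card W + t) (trans N≡2t (cong (t +_) (+-identityʳ t))) N≤W+t)))
    β : Fin n → Fin 1
    β _ = fzero
    φ : Fin n → Fin (2 ^ ℓ)
    φ u = ψ (inject≤ u n≤k)
    separated : ∀ u v → β u ≡ β v → φ u ≡ φ v → u ≡ v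
    separated u v _ q = inject≤-injective n≤k n≤k u v (proj₁ (proj₂ (proj₂ (proj₂ (enumerate W)))) _ _ q)
    free : CliqueFree 5 (pullback G β φ)
    free (f , _ , cl) = K₅-free (φ ∘ f) (λ i j i≢j → cl i j i≢j) λ i → proj₂ (proj₂ (proj₂ (proj₂ (enumerate W)))) (inject≤ (f i) n≤k)

-- Exponent budget absorbing every constant that depends on b only.
D : ℕ → ℕ
D b = 2 * (b * b) + 4 * b

-- The constants and the logarithmic factor of `αᴿ` cost at most `2^L`, about n^(1/20): the gap
-- between n^(2/5) and the square root n^(9/20) of the surviving set.
Long : ℕ → ℕ → Set
Long b L = 2 ^ (14 + D b) * (20 * L + 21) ≤ 2 ^ L

-- True at `L = 2f + 10`; from there each increment of `L` doubles the right side and at most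
-- doubles the left.
doubling-wins : ∀ f d → 2 ^ f * (20 * (d + (2 * f + 10)) + 21) ≤ 2 ^ (d + (2 * f + 10))
doubling-wins f zero = begin
  2 ^ f * (20 * (2 * f + 10) + 21) ≡⟨ cong (2 ^ f *_) (eq₁ f) ⟩
  2 ^ f * (221 + 40 * f) ≤⟨ *-monoʳ-≤ (2 ^ f) (+-mono-≤ (m≤m+n 221 803) (*-monoˡ-≤ f (m≤m+n 40 984))) ⟩
  2 ^ f * (1024 + 1024 * f) ≡⟨ cong (2 ^ f *_) (sym (*-suc 1024 f)) ⟩
  2 ^ f * (1024 * suc f) ≤⟨ *-monoʳ-≤ (2 ^ f) (*-monoʳ-≤ 1024 (n<2^n f)) ⟩
  2 ^ f * (2 ^ 10 * 2 ^ f) ≡⟨ cong (2 ^ f *_) (sym (^-distribˡ-+-* 2 10 f)) ⟩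
  2 ^ f * 2 ^ (10 + f) ≡⟨ sym (^-distribˡ-+-* 2 f (10 + f)) ⟩
  2 ^ (f + (10 + f)) ≡⟨ cong (2 ^_) (eq₂ f) ⟩
  2 ^ (2 * f + 10) ∎
  where
  open ≤-Reasoning
  eq₁ : ∀ f → 20 * (2 * f + 10) + 21 ≡ 221 + 40 * f
  eq₁ = solve-∀
  eq₂ : ∀ f → f + (10 + f) ≡ 2 * f + 10
  eq₂ = solve-∀
doubling-wins f (suc d) = begin
  2 ^ f * (20 * suc L + 21) ≤⟨ *-monoʳ-≤ (2 ^ f) (≤-trans (m≤m+n _ (20 * L + 1)) (≤-reflexive (eq L))) ⟩
  2 ^ f * (2 * (20 * L + 21)) ≡⟨ swap (2 ^ f) (20 * L + 21) ⟩
  2 * (2 ^ f * (20 * L + 21)) ≤⟨ *-monoʳ-≤ 2 (doubling-wins f d) ⟩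
  2 ^ suc L ∎
  where
  open ≤-Reasoning
  L = d + (2 * f + 10)
  eq : ∀ L → 20 * (1 + L) + 21 + (20 * L + 1) ≡ 2 * (20 * L + 21)
  eq = solve-∀
  swap : ∀ x y → x * (2 * y) ≡ 2 * (x * y)
  swap = solve-∀

-- The binary magnitude of n

2^-cancel-≤ : ∀ i j → 2 ^ i ≤ 2 ^ j → i ≤ j
2^-cancel-≤ i j le with i ≤? j
... | yes p = p
... | no ¬p = ⊥-elim (<⇒≱ (^-monoʳ-< 2 (s≤s z<s) (≰⇒> ¬p)) le)

-- Steps of 20 give n^(1/10), n^(2/5) and n^(9/10) the integral exponents `2L`, `8L` and `18L`, up
-- to constant factors.
magnitude : ∀ n → 1 ≤ n → Σ ℕ λ L → 2 ^ (20 * L) ≤ n × n ≤ 2 ^ (20 * L + 20)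
magnitude n 1≤n = search n (≤-trans (<⇒≤ (n<2^n n)) (2^-mono (≤-trans (m≤m+n n _) (m≤m+n (20 * n) 20))))
  where
  search : ∀ L → n ≤ 2 ^ (20 * L + 20) → Σ ℕ λ L → 2 ^ (20 * L) ≤ n × n ≤ 2 ^ (20 * L + 20)
  search zero le = 0 , 1≤n , le
  search (suc L) le with 2 ^ (20 * suc L) ≤? n
  ... | yes p = suc L , p , le
  ... | no ¬p = search L (subst (λ k → n ≤ 2 ^ k) (eq L) (<⇒≤ (≰⇒> ¬p)))
    where
    eq : ∀ L → 20 * (1 + L) ≡ 20 * L + 20
    eq = solve-∀

magnitude-large : ∀ n L L₀ → n ≤ 2 ^ (20 * L + 20) → 2 ^ (20 * L₀ + 20) < n → L₀ ≤ L
magnitude-large n L L₀ n≤ <n with L₀ ≤? L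
... | yes p = p
... | no ¬p = ⊥-elim (<⇒≱ <n (≤-trans n≤ (2^-mono (+-monoˡ-≤ 20 (*-monoʳ-≤ 20 (<⇒≤ (≰⇒> ¬p)))))))

-- Exponent arithmetic for dependent random choice: X = C^j ≈ n^(1/10), and the surviving set has
-- at least 2^(18L)/2^(D+1) ≈ n^(9/10) vertices.
module Parameters (b L n : ℕ) (lower : 2 ^ (20 * L) ≤ n) (upper : n ≤ 2 ^ (20 * L + 20)) (long : Long b L)
  (K c : ℕ) (K≤b : K ≤ b) (c≤b : c ≤ b) (1≤c : 1 ≤ c) where

  a j : ℕ
  a = 2 * c
  C = 2 ^ a
  instance
    a≢0 : NonZero a
    a≢0 = >-nonZero (1≤m*n {2} z<s 1≤c)
  -- The largest number of rounds with `C^j ≤ 2^(2L)`; rounding down loses less than one factor `C`.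
  j = (2 * L) / a
  r = (2 * L) % a
  X = C ^ j
  u = a * j
  X≡ : X ≡ 2 ^ u
  X≡ = ^-*-assoc 2 a j
  2L≡ : 2 * L ≡ r + u
  2L≡ = trans (m≡m%n+[m/n]*n (2 * L) a) (cong (r +_) (*-comm j a))
  u≤2L : u ≤ 2 * L
  u≤2L = subst (u ≤_) (sym 2L≡) (m≤n+m u r)
  2L≤a+u : 2 * L ≤ a + u
  2L≤a+u = subst (_≤ a + u) (sym 2L≡) (+-monoˡ-≤ u (<⇒≤ (m%n<n (2 * L) a)))
  1≤b : 1 ≤ b
  1≤b = ≤-trans 1≤c c≤b
  2cK≤D : 2 * c * K ≤ D b
  2cK≤D = ≤-trans (*-mono-≤ (*-monoʳ-≤ 2 c≤b) K≤b) (≤-trans (≤-reflexive (*-assoc 2 b b)) (m≤m+n (2 * (b * b)) (4 * b)))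
  2a≤D : 2 * a ≤ D b
  2a≤D = ≤-trans (≤-reflexive (sym (*-assoc 2 2 c))) (≤-trans (*-monoʳ-≤ 4 c≤b) (m≤n+m (4 * b) (2 * (b * b))))
  14+D≤L : 14 + D b ≤ L
  14+D≤L = 2^-cancel-≤ (14 + D b) L (≤-trans (≤-trans (≤-reflexive (sym (*-identityʳ (2 ^ (14 + D b)))))
    (*-monoʳ-≤ (2 ^ (14 + D b)) (≤-trans z<s (m≤n+m 21 (20 * L))))) long)
  ℓ = 2 ^ (18 * L ∸ (D b + 1))
  D+1≤18L : D b + 1 ≤ 18 * L
  D+1≤18L = ≤-trans (≤-trans (≤-reflexive (+-comm (D b) 1)) (+-monoˡ-≤ (D b) {1} {14} z<s)) (≤-trans 14+D≤L (m≤m+n L (17 * L)))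
  ℓ≡ : ℓ * 2 ^ (D b + 1) ≡ 2 ^ (18 * L)
  ℓ≡ = trans (sym (^-distribˡ-+-* 2 (18 * L ∸ (D b + 1)) (D b + 1))) (cong (2 ^_) (m∸n+n≡m D+1≤18L))

  -- By `long`, `2^(1+D) (αᴿ + 1) ≤ 2^(9L)`; squaring gives the size that `triangle-exists`
  -- requires.
  triangle-room : suc (αᴿ L) * suc (αᴿ L) ≤ ℓ
  triangle-room = cancelˡ-≤ (2 ^ (D b + 1)) (1≤m^n (D b + 1) z<s) (begin
    2 ^ (D b + 1) * (suc (αᴿ L) * suc (αᴿ L)) ≤⟨ *-mono-≤ (2^-mono {D b + 1} {(1 + D b) + (1 + D b)} D+1≤) (*-mono-≤ double double) ⟩
    2 ^ ((1 + D b) + (1 + D b)) * (w * w) ≡⟨ cong (_* (w * w)) (^-distribˡ-+-* 2 (1 + D b) (1 + D b)) ⟩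
    2 ^ (1 + D b) * 2 ^ (1 + D b) * (w * w) ≡⟨ eq₁ (2 ^ (1 + D b)) w ⟩
    (2 ^ (1 + D b) * w) * (2 ^ (1 + D b) * w) ≤⟨ *-mono-≤ w≤ w≤ ⟩
    2 ^ (9 * L) * 2 ^ (9 * L) ≡⟨ trans (sym (^-distribˡ-+-* 2 (9 * L) (9 * L))) (cong (2 ^_) (eq₂ L)) ⟩
    2 ^ (18 * L) ≡⟨ sym ℓ≡ ⟩
    ℓ * 2 ^ (D b + 1) ≡⟨ *-comm ℓ (2 ^ (D b + 1)) ⟩
    2 ^ (D b + 1) * ℓ ∎)
    where
    open ≤-Reasoning
    w = 2 ^ (8 * L + 13) * (20 * L + 21)
    eq₁ : ∀ x w → x * x * (w * w) ≡ (x * w) * (x * w)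
    eq₁ = solve-∀
    eq₂ : ∀ L → 9 * L + 9 * L ≡ 18 * L
    eq₂ = solve-∀
    D+1≤ : D b + 1 ≤ (1 + D b) + (1 + D b)
    D+1≤ = ≤-trans (≤-reflexive (+-comm (D b) 1)) (m≤m+n (1 + D b) (1 + D b))
    αᴿ≡ : αᴿ L ≡ 2 ^ (8 * L + 12) * (20 * L + 21)
    αᴿ≡ = trans (sym (*-assoc 8 (2 ^ (8 * L + 9)) (20 * L + 21))) (cong (_* (20 * L + 21))
      (trans (sym (^-distribˡ-+-* 2 3 (8 * L + 9))) (cong (2 ^_) (eq₃ L))))
      where
      eq₃ : ∀ L → 3 + (8 * L + 9) ≡ 8 * L + 12
      eq₃ = solve-∀
    double : suc (αᴿ L) ≤ w
    double = subst (λ k → suc k ≤ w) (sym αᴿ≡) (≤-trans (+-monoˡ-≤ v 1≤v) (≤-reflexive (trans (eq₄ (2 ^ (8 * L + 12)) (20 * L + 21)) (cong (λ k → 2 ^ k * (20 * L + 21)) (sym (+-suc (8 * L) 12))))))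
      where
      v = 2 ^ (8 * L + 12) * (20 * L + 21)
      1≤v : 1 ≤ v
      1≤v = 1≤m*n (1≤m^n (8 * L + 12) z<s) (≤-trans z<s (m≤n+m 21 (20 * L)))
      eq₄ : ∀ x y → x * y + x * y ≡ 2 * x * y
      eq₄ = solve-∀
    w≤ : 2 ^ (1 + D b) * w ≤ 2 ^ (9 * L)
    w≤ = begin
      2 ^ (1 + D b) * (2 ^ (8 * L + 13) * (20 * L + 21)) ≡⟨ sym (*-assoc (2 ^ (1 + D b)) (2 ^ (8 * L + 13)) (20 * L + 21)) ⟩
      2 ^ (1 + D b) * 2 ^ (8 * L + 13) * (20 * L + 21) ≡⟨ cong (_* (20 * L + 21)) (trans (sym (^-distribˡ-+-* 2 (1 + D b) (8 * L + 13)))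
                                                              (trans (cong (2 ^_) (eq₅ (D b) L)) (^-distribˡ-+-* 2 (8 * L) (14 + D b)))) ⟩
      2 ^ (8 * L) * 2 ^ (14 + D b) * (20 * L + 21) ≡⟨ *-assoc (2 ^ (8 * L)) (2 ^ (14 + D b)) (20 * L + 21) ⟩
      2 ^ (8 * L) * (2 ^ (14 + D b) * (20 * L + 21)) ≤⟨ *-monoʳ-≤ (2 ^ (8 * L)) long ⟩
      2 ^ (8 * L) * 2 ^ L ≡⟨ trans (sym (^-distribˡ-+-* 2 (8 * L) L)) (cong (2 ^_) (eq₆ L)) ⟩
      2 ^ (9 * L) ∎
      where
      eq₅ : ∀ D L → 1 + D + (8 * L + 13) ≡ 8 * L + (14 + D)
      eq₅ = solve-∀
      eq₆ : ∀ L → 8 * L + L ≡ 9 * L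
      eq₆ = solve-∀

  -- The numerical hypothesis of `drc`; each summand gets half of the right side. For the triples,
  -- `X^40` is about n⁴ and has to beat n³/x, which is n² up to constants. For the other, `2ℓX ≤ x`
  -- because `2^(18L) · 2^(2L) = 2^(20L) ≤ n`.
  potential : ∀ x → n ≤ 2 * c * K * x → C ^ j * (n * (n * n)) + ℓ * (C * C ^ 41) ^ j ≤ (C ^ 41) ^ j * x
  potential x n≤ = begin
    X * (n * (n * n)) + ℓ * (C * C ^ 41) ^ j ≡⟨ cong₂ (λ p q → p * (n * (n * n)) + ℓ * q) X≡ (power 42) ⟩
    Y * (n * (n * n)) + ℓ * 2 ^ (u * 42) ≤⟨ cancelˡ-≤ 2 z<s (≤-trans (≤-reflexive (*-distribˡ-+ 2 (Y * (n * (n * n))) (ℓ * 2 ^ (u * 42)))) (≤-trans (+-mono-≤ first second) (≤-reflexive (cong (2 ^ (u * 41) * x +_) (sym (+-identityʳ _)))))) ⟩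
    2 ^ (u * 41) * x ≡⟨ cong (_* x) (sym (power 41)) ⟩
    (C ^ 41) ^ j * x ∎
    where
    open ≤-Reasoning
    Y = 2 ^ u
    power : ∀ k → (C ^ k) ^ j ≡ 2 ^ (u * k)
    power k = trans (cong (_^ j) (^-*-assoc 2 a k)) (trans (^-*-assoc 2 (a * k) j) (cong (2 ^_) (eq a k j)))
      where
      eq : ∀ a k j → a * k * j ≡ a * j * k
      eq = solve-∀
    n≤2^D*x : n ≤ 2 ^ D b * x
    n≤2^D*x = ≤-trans n≤ (*-monoˡ-≤ x (≤-trans 2cK≤D (<⇒≤ (n<2^n (D b)))))
    budget : 1 + (u + (20 * L + 20 + (20 * L + 20 + D b))) ≤ u * 41
    budget = +-cancelʳ-≤ (40 * a) _ _ (begin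
      1 + (u + (20 * L + 20 + (20 * L + 20 + D b))) + 40 * a ≤⟨ +-monoʳ-≤ (1 + (u + (20 * L + 20 + (20 * L + 20 + D b)))) (≤-trans (≤-reflexive (*-assoc 20 2 a)) (*-monoʳ-≤ 20 2a≤D)) ⟩
      1 + (u + (20 * L + 20 + (20 * L + 20 + D b))) + 20 * D b ≤⟨ m≤m+n _ (519 + 19 * D b) ⟩
      1 + (u + (20 * L + 20 + (20 * L + 20 + D b))) + 20 * D b + (519 + 19 * D b) ≡⟨ eq₁ u L (D b) ⟩
      u + 40 * L + 40 * (14 + D b) ≤⟨ +-monoʳ-≤ (u + 40 * L) (*-monoʳ-≤ 40 14+D≤L) ⟩
      u + 40 * L + 40 * L ≡⟨ eq₂ u L ⟩
      u + 40 * (2 * L) ≤⟨ +-monoʳ-≤ u (*-monoʳ-≤ 40 2L≤a+u) ⟩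
      u + 40 * (a + u) ≡⟨ eq₃ u a ⟩
      u * 41 + 40 * a ∎)
      where
      eq₁ : ∀ u L D → 1 + (u + (20 * L + 20 + (20 * L + 20 + D))) + 20 * D + (519 + 19 * D) ≡ u + 40 * L + 40 * (14 + D)
      eq₁ = solve-∀
      eq₂ : ∀ u L → u + 40 * L + 40 * L ≡ u + 40 * (2 * L)
      eq₂ = solve-∀
      eq₃ : ∀ u a → u + 40 * (a + u) ≡ u * 41 + 40 * a
      eq₃ = solve-∀
    first : 2 * (Y * (n * (n * n))) ≤ 2 ^ (u * 41) * x
    first = begin
      2 * (Y * (n * (n * n))) ≤⟨ *-monoʳ-≤ 2 (*-monoʳ-≤ Y (*-mono-≤ upper (*-mono-≤ upper n≤2^D*x))) ⟩
      2 * (Y * (R * (R * (2 ^ D b * x)))) ≡⟨ eq Y R (2 ^ D b) x ⟩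
      2 * (Y * (R * (R * 2 ^ D b))) * x ≡⟨ cong (λ k → 2 * (Y * (R * k)) * x) (sym (^-distribˡ-+-* 2 (20 * L + 20) (D b))) ⟩
      2 * (Y * (R * 2 ^ (20 * L + 20 + D b))) * x ≡⟨ cong (λ k → 2 * (Y * k) * x) (sym (^-distribˡ-+-* 2 (20 * L + 20) (20 * L + 20 + D b))) ⟩
      2 * (Y * 2 ^ (20 * L + 20 + (20 * L + 20 + D b))) * x ≡⟨ cong (λ k → 2 * k * x) (sym (^-distribˡ-+-* 2 u (20 * L + 20 + (20 * L + 20 + D b)))) ⟩
      2 ^ (1 + (u + (20 * L + 20 + (20 * L + 20 + D b)))) * x ≤⟨ *-monoˡ-≤ x (2^-mono budget) ⟩
      2 ^ (u * 41) * x ∎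
      where
      R = 2 ^ (20 * L + 20)
      eq : ∀ y r d x → 2 * (y * (r * (r * (d * x)))) ≡ 2 * (y * (r * (r * d))) * x
      eq = solve-∀
    room : 2 * (ℓ * Y) ≤ x
    room = cancelˡ-≤ (2 ^ D b) (1≤m^n (D b) z<s) (begin
      2 ^ D b * (2 * (ℓ * Y)) ≡⟨ eq (2 ^ D b) ℓ Y ⟩
      ℓ * (2 ^ D b * 2) * Y ≡⟨ cong (λ k → ℓ * k * Y) (sym (^-distribˡ-+-* 2 (D b) 1)) ⟩
      ℓ * 2 ^ (D b + 1) * Y ≡⟨ cong (_* Y) ℓ≡ ⟩
      2 ^ (18 * L) * Y ≤⟨ *-monoʳ-≤ (2 ^ (18 * L)) (2^-mono u≤2L) ⟩
      2 ^ (18 * L) * 2 ^ (2 * L) ≡⟨ trans (sym (^-distribˡ-+-* 2 (18 * L) (2 * L))) (cong (2 ^_) (eq₂ L)) ⟩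
      2 ^ (20 * L) ≤⟨ ≤-trans lower n≤2^D*x ⟩
      2 ^ D b * x ∎)
      where
      eq : ∀ d l y → d * (2 * (l * y)) ≡ l * (d * 2) * y
      eq = solve-∀
      eq₂ : ∀ L → 18 * L + 2 * L ≡ 20 * L
      eq₂ = solve-∀
    second : 2 * (ℓ * 2 ^ (u * 42)) ≤ 2 ^ (u * 41) * x
    second = begin
      2 * (ℓ * 2 ^ (u * 42)) ≡⟨ cong (λ k → 2 * (ℓ * k)) (trans (cong (2 ^_) (*-suc u 41)) (^-distribˡ-+-* 2 u (u * 41))) ⟩
      2 * (ℓ * (Y * 2 ^ (u * 41))) ≡⟨ eq ℓ Y (2 ^ (u * 41)) ⟩
      2 ^ (u * 41) * (2 * (ℓ * Y)) ≤⟨ *-monoʳ-≤ (2 ^ (u * 41)) room ⟩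
      2 ^ (u * 41) * x ∎
      where
      eq : ∀ l y z → 2 * (l * (y * z)) ≡ z * (2 * (l * y))
      eq = solve-∀

-- Rational bounds and assembly

open import Data.Integer using (+_)

choices : ∀ {n} (G : Graph n) b L → 0 < n → 2 ^ (20 * L) ≤ n → n ≤ 2 ^ (20 * L + 20) → Long b L →
  (∀ S → IndepSet G S → card S ≤ αᴿ L) → ∀ K c → K ≤ b → c ≤ b → Cliques.Choice (adj G) (Graph.sym G) K c
choices G b L 0<n lower upper long α≤ K zero K≤b c≤b ωs w F U 0<W big dense cont =
  <⇒≱ (1≤m*n (Cliques.pos-of (adj G) (Graph.sym G) K (card U) 0<n big) 0<W) dense
choices {n} G b L 0<n lower upper long α≤ K c@(suc _) K≤b c≤b ωs w F U 0<W big dense cont =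
  DRC.drc ωs w F c C (C ^ 41) ℓ j z<s (<⇒≤ (n<2^n (2 * c))) (1≤m^n 41 (1≤m^n (2 * c) z<s)) 0<W U dense
    (λ x U≤ → potential x (≤-trans big (≤-trans (*-monoʳ-≤ K U≤) (≤-reflexive (eq K (2 * c) x)))))
    λ U′ U′⊆U ℓ≤ good → Ramsey.triangle-exists (adj G) (Graph.sym G) (irrefl G) (αᴿ L) α≤ U′ (≤-trans triangle-room ℓ≤)
      λ x y z x∈ y∈ z∈ xy xz yz → cont x y z ((xy ∷ xz ∷ []) ∷ (yz ∷ []) ∷ [] ∷ []) (U′⊆U x x∈ ∷ U′⊆U y y∈ ∷ U′⊆U z z∈ ∷ [])
        (subst (λ k → DRC.W ωs w F ≤ k * DRC.codeg ωs w F (x , y , z)) (sym (M-def c)) (good x y z x∈ y∈ z∈))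
  where
  open Parameters b L n lower upper long K c K≤b c≤b z<s
  eq : ∀ K d x → K * (d * x) ≡ d * K * x
  eq = solve-∀

private
  +-num : ∀ a b c d → (+ a ℤ.* + b ℤ.+ + c ℤ.* + d) ≡ + (a * b + c * d)
  +-num a b c d = cong₂ ℤ._+_ (sym (ℤ.pos-* a b)) (sym (ℤ.pos-* c d))

ℕtoℚᵘ : ∀ k → toℚᵘ (ℕtoℚ k) ℚᵘ.≃ mkℚᵘ (+ k) 0
ℕtoℚᵘ k = ℚ.toℚᵘ-fromℚᵘ (mkℚᵘ (+ k) 0)

-- `g` is the denominator of `γ`, so `1/g ≤ γ`, and `(4g + 15)/(15g) = 4/15 + 1/g`.
rational-slack : ∀ γ → 0ℚ ℚ.< γ → Σ ℕ λ g → 1 ≤ g ×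
  (∀ E m → 15 * g * E ≤ (4 * g + 15) * m → ℕtoℚ E ℚ.≤ ((+ 4 ℚ./ 15) ℚ.+ γ) ℚ.* ℕtoℚ m)
rational-slack (mkℚ (+ zero) d _) (ℚ.*<* (ℤ.+<+ ()))
rational-slack (mkℚ (ℤ.-[1+ p ]) d _) (ℚ.*<* ())
rational-slack γ@(mkℚ (+ suc p) d _) _ = suc d , s≤s z≤n , bound
  where
  g = suc d
  bound : ∀ E m → 15 * g * E ≤ (4 * g + 15) * m → ℕtoℚ E ℚ.≤ ((+ 4 ℚ./ 15) ℚ.+ γ) ℚ.* ℕtoℚ m
  bound E m le = ℚ.toℚᵘ-cancel-≤ (begin
    toℚᵘ (ℕtoℚ E) ≃⟨ ℕtoℚᵘ E ⟩
    mkℚᵘ (+ E) 0 ≤⟨ ℚᵘ.*≤* cross ⟩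
    (mkℚᵘ (+ 4) 14 ℚᵘ.+ toℚᵘ γ) ℚᵘ.* mkℚᵘ (+ m) 0 ≃⟨ ℚᵘ.*-cong (ℚᵘ.+-cong {y = toℚᵘ (+ 4 ℚ./ 15)} (ℚᵘ.≃-sym (ℚ.toℚᵘ-fromℚᵘ (mkℚᵘ (+ 4) 14))) (ℚᵘ.≃-refl {toℚᵘ γ})) (ℚᵘ.≃-sym (ℕtoℚᵘ m)) ⟩
    (toℚᵘ (+ 4 ℚ./ 15) ℚᵘ.+ toℚᵘ γ) ℚᵘ.* toℚᵘ (ℕtoℚ m) ≃⟨ ℚᵘ.*-congʳ (ℚᵘ.≃-sym (ℚ.toℚᵘ-homo-+ (+ 4 ℚ./ 15) γ)) ⟩
    toℚᵘ ((+ 4 ℚ./ 15) ℚ.+ γ) ℚᵘ.* toℚᵘ (ℕtoℚ m) ≃⟨ ℚᵘ.≃-sym (ℚ.toℚᵘ-homo-* ((+ 4 ℚ./ 15) ℚ.+ γ) (ℕtoℚ m)) ⟩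
    toℚᵘ (((+ 4 ℚ./ 15) ℚ.+ γ) ℚ.* ℕtoℚ m) ∎)
    where
    open ℚᵘ.≤-Reasoning
    nat : E * (15 * g * 1) ≤ (4 * g + suc p * 15) * m * 1
    nat = ≤-trans (≤-reflexive (eq E g)) (≤-trans le (≤-trans (*-monoˡ-≤ m (+-monoʳ-≤ (4 * g) (m≤m+n 15 (p * 15)))) (≤-reflexive (sym (*-identityʳ _)))))
      where
      eq : ∀ E g → E * (15 * g * 1) ≡ 15 * g * E
      eq = solve-∀
    cross : + E ℤ.* + (15 * g * 1) ℤ.≤ ((+ 4 ℤ.* + g ℤ.+ + suc p ℤ.* + 15) ℤ.* + m) ℤ.* + 1
    cross = subst₂ ℤ._≤_ (ℤ.pos-* E (15 * g * 1))
      (trans (ℤ.pos-* ((4 * g + suc p * 15) * m) 1) (cong (ℤ._* + 1) (trans (ℤ.pos-* (4 * g + suc p * 15) m) (cong (ℤ._* + m) (sym (+-num 4 g (suc p) 15))))))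
      (ℤ.+≤+ nat)

reciprocal : ∀ b a q → ℕtoℚ a ℚ.≤ (+ 1 ℚ./ suc b) ℚ.* ℕtoℚ q → suc b * a ≤ q
reciprocal b a q le = convert (begin
    mkℚᵘ (+ a) 0 ≃⟨ ℚᵘ.≃-sym (ℕtoℚᵘ a) ⟩
    toℚᵘ (ℕtoℚ a) ≤⟨ ℚ.toℚᵘ-mono-≤ le ⟩
    toℚᵘ ((+ 1 ℚ./ suc b) ℚ.* ℕtoℚ q) ≃⟨ ℚ.toℚᵘ-homo-* (+ 1 ℚ./ suc b) (ℕtoℚ q) ⟩
    toℚᵘ (+ 1 ℚ./ suc b) ℚᵘ.* toℚᵘ (ℕtoℚ q) ≃⟨ ℚᵘ.*-cong (ℚ.toℚᵘ-fromℚᵘ (mkℚᵘ (+ 1) b)) (ℕtoℚᵘ q) ⟩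
    mkℚᵘ (+ 1) b ℚᵘ.* mkℚᵘ (+ q) 0 ∎)
  where
  open ℚᵘ.≤-Reasoning
  convert : mkℚᵘ (+ a) 0 ℚᵘ.≤ mkℚᵘ (+ 1) b ℚᵘ.* mkℚᵘ (+ q) 0 → suc b * a ≤ q
  convert (ℚᵘ.*≤* p) = subst₂ _≤_ (eq₁ a b) (eq₂ q) (ℤ.drop‿+≤+ (subst₂ ℤ._≤_ (sym (ℤ.pos-* a (suc b * 1)))
      (trans (cong (ℤ._* + 1) (sym (ℤ.pos-* 1 q))) (sym (ℤ.pos-* (1 * q) 1))) p))
    where
    eq₁ : ∀ a b → a * ((1 + b) * 1) ≡ (1 + b) * a
    eq₁ = solve-∀
    eq₂ : ∀ q → 1 * q * 1 ≡ q
    eq₂ = solve-∀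

reciprocal-pos : ∀ b → 0ℚ ℚ.< (+ 1 ℚ./ suc b)
reciprocal-pos b = ℚ.positive⁻¹ (+ 1 ℚ./ suc b) {{ℚ.normalize-pos 1 (suc b)}}

All-≤-sum : ∀ l → All (_≤ ∑ l id) l
All-≤-sum [] = []
All-≤-sum (x ∷ l) = m≤m+n x _ ∷ All.map (λ p → ≤-trans p (m≤n+m _ x)) (All-≤-sum l)

opaque
  threshold : ℕ → ℕ
  threshold g = ∑ (Constants.thresholds g) id

  threshold-≥ : ∀ g → All (_≤ threshold g) (Constants.thresholds g)
  threshold-≥ g = All-≤-sum (Constants.thresholds g)

edge-bound-ℕ : ∀ g b L₀ → 1 ≤ g → All (_≤ b) (Constants.thresholds g) → (∀ d → Long b (d + L₀)) →
  ∀ n → b + 2 ^ (20 * L₀ + 20) < n → (G : Graph n) → CliqueFree 13 G →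
  ∀ a q → IsIndepNumber G a → IsQ 5 n q → suc b * a ≤ q → 15 * g * edges G ≤ (4 * g + 15) * (n * n)
edge-bound-ℕ g b L₀ 1≤g ts long n N<n G free a q isα isQ small =
    cancelˡ-≤ 2 z<s (lin (2 * (15 * g * edges G)) (2 * ((4 * g + 15) * (n * n))) 0 (<⇒≤ bound) (eq g (edges G) (n * n)))
  where
  0<n : 0 < n
  0<n = ≤-trans z<s N<n
  b≤n : b ≤ n
  b≤n = ≤-trans (m≤m+n b (2 ^ (20 * L₀ + 20))) (<⇒≤ N<n)
  L : ℕ
  L = proj₁ (magnitude n 0<n)
  lower : 2 ^ (20 * L) ≤ n
  lower = proj₁ (proj₂ (magnitude n 0<n))
  upper : n ≤ 2 ^ (20 * L + 20)
  upper = proj₂ (proj₂ (magnitude n 0<n))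
  L₀≤L : L₀ ≤ L
  L₀≤L = magnitude-large n L L₀ upper (≤-trans (s≤s (m≤n+m (2 ^ (20 * L₀ + 20)) b)) N<n)
  longL : Long b L
  longL = subst (Long b) (m∸n+n≡m L₀≤L) (long (L ∸ L₀))
  -- The random graph bounds the independence number through Q: `a ≤ (b + 1) a ≤ q ≤ αᴿ L`.
  α≤ : ∀ S → IndepSet G S → card S ≤ αᴿ L
  α≤ S ind = ≤-trans (α-bound G a isα S ind) (≤-trans (≤-trans (m≤m+n a (b * a)) small) (Q-upper L n q upper isQ))
  bound : 15 * g * (2 * edges G) < (8 * g + 15 + 15) * (n * n)
  bound = subst (λ e → 15 * g * e < (8 * g + 15 + 15) * (n * n)) (sym (edges-sum G))
    (MinDegree.edge-bound g 1≤g (adj G) (Graph.sym G) 0<n (no-list 13 G free) b b≤n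
      (five-in-large G a q b 0<n isα isQ small) (choices G b L 0<n lower upper longL α≤) ts)
  eq : ∀ g E m → 2 * (15 * g * E) + (8 * g + 15 + 15) * m + 0 ≡ 2 * ((4 * g + 15) * m) + 15 * g * (2 * E)
  eq = solve-∀

theorem1p6 : (γ : ℚ) → 0ℚ ℚ.< γ →
    Σ ℚ λ δ → (0ℚ ℚ.< δ) × Σ ℕ λ N →
    ∀ (n : ℕ) → n ≥ N → (G : Graph n) → CliqueFree 13 G →
    ∀ (a q : ℕ) → IsIndepNumber G a → IsQ 5 n q →
    ℕtoℚ a ℚ.≤ δ ℚ.* ℕtoℚ q →
    ℕtoℚ (edges G) ℚ.≤ ((+ 4 ℚ./ 15) ℚ.+ γ) ℚ.* ℕtoℚ (n * n)
theorem1p6 γ 0<γ = conclude (rational-slack γ 0<γ)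
  where
  conclude : (Σ ℕ λ g → 1 ≤ g × (∀ E m → 15 * g * E ≤ (4 * g + 15) * m → ℕtoℚ E ℚ.≤ ((+ 4 ℚ./ 15) ℚ.+ γ) ℚ.* ℕtoℚ m)) → _
  conclude (g , 1≤g , slack) = (+ 1 ℚ./ suc b) , reciprocal-pos b , suc (b + 2 ^ (20 * L₀ + 20)) ,
    λ n n≥N G free a q isα isQ a≤δq → slack (edges G) (n * n)
      (edge-bound-ℕ g b L₀ 1≤g (threshold-≥ g) (doubling-wins (14 + D b)) n n≥N G free a q isα isQ (reciprocal b a q a≤δq))
    where
    b = threshold g
    -- The base case of `doubling-wins` for `f = 14 + D b`; the lower bound on `n` forces `L ≥ L₀`.
    L₀ = 2 * (14 + D b) + 10
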